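{- Let $\mathcal{C}$ be a nowhere-dense class of graphs which is uniformly quasi-wide with a computable margin $s_{\mathcal{C}}$ and a computable bound function $N_{\mathcal{C}}$. Then each of the following problems, restricted to input graphs from $\mathcal{C}$, is fixed-parameter tractable: CONNECTED DOMINATING SET, CONNECTED $d$-DOMINATING SET, $d$-CONNECTED $d$-DOMINATING SET, ANNOTATED DOMINATING SET, EFFICIENT DOMINATING SET, MAXIMUM MINIMAL DOMINATING SET, ROMAN DOMINATION, RED-BLUE DOMINATING SET, INDEPENDENT SET, INDEPENDENT DOMINATING SET, PERFECT CODE, and DIGRAPH KERNEL.
   Context: Graphs are finite, simple and undirected unless stated otherwise. $\mathrm{dist}^G$ is shortest-path distance, $N_d^G(v)=\{u:\mathrm{dist}^G(u,v)\le d\}$, and $G[X]$ is the subgraph induced by $X$. A set $X\subseteq V(G)$ $d$-dominates $W\subseteq V(G)$ if every $u\in W$ lies in $N_d(v)$ for some $v\in X$; "dominates" means $1$-dominates; $X$ is a ($d$-)dominating set if it ($d$-)dominates $V(G)$. $G^d$ is the graph on $V(G)$ in which distinct $u,v$ are adjacent iff $\mathrm{dist}^G(u,v)\le d$. The problems (input always contains a graph $G$ and $k\in\mathbb{N}$; the parameter is $k$ unless stated otherwise): - CONNECTED DOMINATING SET: is there a dominating set $X$ with $|X|=k$ and $G[X]$ connected? - CONNECTED $d$-DOMINATING SET (input also $d\in\mathbb{N}$, parameter $k+d$): is there $X\subseteq V(G)$ with $|X|=k$ that $d$-dominates $G$ and with $G[X]$ connected? - $d$-CONNECTED $d$-DOMINATING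 SET (input also $d\in\mathbb{N}$, parameter $k+d$): is there a $d$-dominating set $X$ of $k$ vertices such that $X$ induces a connected subgraph of $G^d$? - ANNOTATED DOMINATING SET (input also $W\subseteq V(G)$): is there a set of at most $k$ vertices of $G$ dominating $W$? - EFFICIENT DOMINATING SET: is there a dominating set $X$ with $|X|=k$ such that all pairs $x\ne y\in X$ have distance at least $3$? - MAXIMUM MINIMAL DOMINATING SET: is there an inclusion-minimal dominating set of size at least $k$? - ROMAN DOMINATION: is there a function $R:V(G)\to\{0,1,2\}$ such that every $v$ with $R(v)=0$ has a neighbour $x$ with $R(x)=2$, and $\sum_{v\in V(G)}R(v)\le k$? - RED-BLUE DOMINATING SET (input also a partition of $V(G)$ into red and blue vertices): is there a set of at most $k$ red vertices dominating all blue vertices? - INDEPENDENT SET: is there a set of $k$ pairwise non-adjacent vertices? - INDEPENDENT DOMINATING SET: is there a dominating set of at most $k$ vertices that is also independent? - PERFECT CODE: is there $X\subseteq V(G)$ with $|X|=k$ such that for every $v\in V(G)$ exactly one element of $X$ lies in $N_1^G(v)$? - DIGRAPH KERNEL (input a digraph $D$ whose underlying undirected graph is in the class): is there a set $X$ of at most $k$ vertices with no arc between two vertices of $X$ and such that every vertex $u\notin X$ has an arc $(u,v)$ to some $v\in X$? A graph $H$ is a minor of $G$ at depth $r$, written $H\preceq_r G$, if there are pairwise disjoint non-empty connected subgraphs $G_v$ of $G$ ($v\in V(H)$) such that for every edge $\{u,v\}$ of $H$ there is an edge of $G$ between a vertex of $G_u$ and a vertex of $G_v$, and for each $v$ there is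 $w\in V(G_v)$ with $V(G_v)\subseteq N_r^{G_v}(w)$. $\mathcal{C}$ is nowhere dense if for every $r\ge 0$ there is a graph $H$ with $H\not\preceq_r G$ for all $G\in\mathcal{C}$. A set $A\subseteq V(G)$ is $r$-scattered in $G$ if $N_r^G(u)\cap N_r^G(v)=\varnothing$ for all distinct $u,v\in A$; $G-S$ is the subgraph induced by $V(G)\setminus S$. $\mathcal{C}$ is uniformly quasi-wide with margin $s_{\mathcal{C}}:\mathbb{N}\to\mathbb{N}$ and bound function $N_{\mathcal{C}}:\mathbb{N}\times\mathbb{N}\to\mathbb{N}$ if for all $r,m\ge 0$, every $G\in\mathcal{C}$ and every $W\subseteq V(G)$ with $|W|>N_{\mathcal{C}}(r,m)$, there is $S\subseteq V(G)$ with $|S|<s_{\mathcal{C}}(r)$ such that $W$ contains a set of size at least $m$ that is $r$-scattered in $G-S$. (Nowhere-dense classes are known to be uniformly quasi-wide; the assumption is that the functions can be taken computable.) A parameterized problem is fixed-parameter tractable if there are a computable function $f$, a constant $c$, and an algorithm solving it in time $f(p)\cdot n^c$, where $p$ is the parameter and $n$ the order of the input graph. -}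

module Defs where

open import Data.Bool.Base using (Bool; true; false; T; _∨_; if_then_else_)
open import Data.Bool.Properties using (∨-comm)
open import Data.Fin.Base using (Fin; toℕ)
open import Data.Fin.Patterns using (0F; 2F)
open import Data.Fin.Subset using (Subset; _∈_; _∉_; _⊆_; _⊂_; ∣_∣; ∁; ⊤)
open import Data.List.Base using (List; []; _∷_; _++_; map; concatMap; allFin; tabulate)
open import Data.Nat.Base using (ℕ; zero; suc; _+_; _*_; _∸_; _^_; _⊔_; _≤_; _<_; _≥_)
open import Data.Nat.ListAction using (sum)
open import Data.Nat.Properties using () renaming (_≟_ to _≟ℕ_)
open import Data.Product using (∃; Σ-syntax; ∃₂; ∃!; ∃-syntax; _×_; _,_; proj₁; proj₂)
open import Data.Vec.Base using (toList)
open import Function.Bundles using (_⇔_)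
open import Level using (Level; 0ℓ) renaming (suc to lsuc)
open import Relation.Binary.Core using (Rel)
open import Relation.Binary.PropositionalEquality using (_≡_; _≢_; cong₂)
open import Relation.Nullary using (¬_; does)
open import Relation.Unary using (Pred)

private
  variable
    ℓ : Level

------------------------------------------------------------------------
-- Graphs

record Graph : Set where
  field
    order  : ℕ
    adj    : Fin order → Fin order → Bool
    sym    : ∀ u v → adj u v ≡ adj v u
    irrefl : ∀ v → adj v v ≡ false

  Vertex : Set
  Vertex = Fin order

  Edge : Rel Vertex 0ℓ
  Edge u v = T (adj u v)

record Digraph : Set where
  field
    order  : ℕ
    arc    : Fin order → Fin order → Bool
    irrefl : ∀ v → arc v v ≡ false

  Arc : Rel (Fin order) 0ℓ
  Arc u v = T (arc u v)

underlying : Digraph → Graph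
underlying D = record
  { order  = D.order
  ; adj    = λ u v → D.arc u v ∨ D.arc v u
  ; sym    = λ u v → ∨-comm (D.arc u v) (D.arc v u)
  ; irrefl = λ v → cong₂ _∨_ (D.irrefl v) (D.irrefl v)
  }
  where module D = Digraph D

open Graph public using (order; Vertex; Edge)

GraphClass : (ℓ : Level) → Set (lsuc ℓ)
GraphClass ℓ = Pred Graph ℓ

-- A bare adjacency relation on an arbitrary vertex type.  Subgraphs and
-- powers of a Graph are formed here, so that their vertices need not be
-- renumbered as an initial segment and adjacency need not be computed.

record RelGraph : Set₁ where
  constructor relGraph
  field
    V   : Set
    _~_ : Rel V 0ℓ

open RelGraph public using (V)

⟦_⟧ : Graph → RelGraph
⟦ G ⟧ = relGraph (Vertex G) (Edge G)

data Walk (H : RelGraph) : ℕ → Rel (V H) 0ℓ where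
  []  : ∀ {v} → Walk H 0 v v
  _∷_ : ∀ {l u w v} → RelGraph._~_ H u w → Walk H l w v → Walk H (suc l) u v

-- Distance is the least length of a walk, and infinite if there is none.

Dist≤ : (H : RelGraph) → ℕ → Rel (V H) 0ℓ
Dist≤ H d u v = ∃[ l ] l ≤ d × Walk H l u v

Dist≥ : (H : RelGraph) → ℕ → Rel (V H) 0ℓ
Dist≥ H d u v = ∀ l → Walk H l u v → d ≤ l

N : (H : RelGraph) → ℕ → V H → Pred (V H) 0ℓ
N H d v u = Dist≤ H d u v

Connected : RelGraph → Set
Connected H = ∀ u v → ∃[ l ] Walk H l u v

induced : (H : RelGraph) → Pred (V H) 0ℓ → RelGraph
induced H P = relGraph (∃ P) (λ x y → RelGraph._~_ H (proj₁ x) (proj₁ y))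

infix 8 _─_

power : RelGraph → ℕ → RelGraph
power H d = relGraph (V H) (λ u v → u ≢ v × Dist≤ H d u v)

_─_ : (G : Graph) → Subset (order G) → RelGraph
G ─ S = induced ⟦ G ⟧ (_∈ ∁ S)

------------------------------------------------------------------------
-- Shallow minors and nowhere density

record Subgraph (G : Graph) : Set where
  field
    vertices : Subset (order G)
    edge     : Vertex G → Vertex G → Bool
    sym      : ∀ u v → edge u v ≡ edge v u
    edge⊆    : ∀ u v → T (edge u v) → Edge G u v × u ∈ vertices × v ∈ vertices

  rel : RelGraph
  rel = relGraph (∃ (_∈ vertices)) (λ x y → T (edge (proj₁ x) (proj₁ y)))

record _≼[_]_ (H : Graph) (r : ℕ) (G : Graph) : Set where
  field
    branch : Vertex H → Subgraph G

  private
    module B (v : Vertex H) = Subgraph (branch v)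

  field
    nonEmpty  : ∀ v → ∃[ x ] x ∈ B.vertices v
    connected : ∀ v → Connected (B.rel v)
    disjoint  : ∀ u v → u ≢ v → ∀ x → x ∈ B.vertices u → x ∉ B.vertices v
    edges     : ∀ u v → Edge H u v →
                ∃₂ λ x y → x ∈ B.vertices u × y ∈ B.vertices v × Edge G x y
    radius    : ∀ v → ∃[ w ] ∀ x → N (B.rel v) r w x

NowhereDense : GraphClass ℓ → Set ℓ
NowhereDense C = ∀ r → ∃[ H ] ∀ G → C G → ¬ (H ≼[ r ] G)

------------------------------------------------------------------------
-- Uniform quasi-wideness

-- A is a set of vertices of G ─ S that is r-scattered in G ─ S.

Scattered : (G : Graph) (S : Subset (order G)) → ℕ → Subset (order G) → Set
Scattered G S r A =
  A ⊆ ∁ S ×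
  (∀ (u v : V (G ─ S)) → proj₁ u ∈ A → proj₁ v ∈ A → proj₁ u ≢ proj₁ v →
   ¬ (∃[ w ] N (G ─ S) r u w × N (G ─ S) r v w))

UniformlyQuasiWide : GraphClass ℓ → (margin : ℕ → ℕ) (bound : ℕ → ℕ → ℕ) → Set ℓ
UniformlyQuasiWide C margin bound =
  ∀ r m G → C G → (W : Subset (order G)) → bound r m < ∣ W ∣ →
  ∃[ S ] ∣ S ∣ < margin r × (∃[ A ] A ⊆ W × m ≤ ∣ A ∣ × Scattered G S r A)

------------------------------------------------------------------------
-- Computation

-- Random access machine with unit-cost addition and truncated subtraction
-- (no multiplication, so running times agree with those of Turing machines
-- up to a polynomial).  Registers and memory cells are indexed by ℕ and
-- hold natural numbers of unbounded size.  Control flow is structured,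
-- which costs a constant factor compared to jumps.

record State : Set where
  constructor state
  field
    reg mem : ℕ → ℕ

open State public

_[_↦_] : (ℕ → ℕ) → ℕ → ℕ → (ℕ → ℕ)
(g [ i ↦ x ]) j = if does (i ≟ℕ j) then x else g j

data Instr : Set where
  const    : (i c : ℕ) → Instr
  add sub  : (i j k : ℕ) → Instr
  load     : (i j : ℕ) → Instr
  store    : (i j : ℕ) → Instr

exec : Instr → State → State
exec (const i c) (state r m) = state (r [ i ↦ c ]) m
exec (add i j k) (state r m) = state (r [ i ↦ r j + r k ]) m
exec (sub i j k) (state r m) = state (r [ i ↦ r j ∸ r k ]) m
exec (load i j)  (state r m) = state (r [ i ↦ m (r j) ]) m
exec (store i j) (state r m) = state r (m [ r i ↦ r j ])

infixr 5 _⨾_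

data Program : Set where
  instr           : Instr → Program
  _⨾_             : Program → Program → Program
  ifnz_then_else_ : ℕ → Program → Program → Program
  whilenz_loop_   : ℕ → Program → Program

-- ⟨ p , s ⟩⇓[ t ] s′: started in s, p halts in s′ after exactly t steps.

data ⟨_,_⟩⇓[_]_ : Program → State → ℕ → State → Set where
  instr   : ∀ {a s} → ⟨ instr a , s ⟩⇓[ 1 ] exec a s
  _⨾_     : ∀ {p q s s′ s″ t t′} →
            ⟨ p , s ⟩⇓[ t ] s′ → ⟨ q , s′ ⟩⇓[ t′ ] s″ → ⟨ p ⨾ q , s ⟩⇓[ t + t′ ] s″
  if-nz   : ∀ {i p q s s′ t} → reg s i ≢ 0 →
            ⟨ p , s ⟩⇓[ t ] s′ → ⟨ ifnz i then p else q , s ⟩⇓[ suc t ] s′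
  if-z    : ∀ {i p q s s′ t} → reg s i ≡ 0 →
            ⟨ q , s ⟩⇓[ t ] s′ → ⟨ ifnz i then p else q , s ⟩⇓[ suc t ] s′
  loop    : ∀ {i p s s′ s″ t t′} → reg s i ≢ 0 →
            ⟨ p , s ⟩⇓[ t ] s′ → ⟨ whilenz i loop p , s′ ⟩⇓[ t′ ] s″ →
            ⟨ whilenz i loop p , s ⟩⇓[ suc (t + t′) ] s″
  exit    : ∀ {i p s} → reg s i ≡ 0 → ⟨ whilenz i loop p , s ⟩⇓[ 1 ] s

cell : List ℕ → ℕ → ℕ
cell []       _       = 0
cell (x ∷ _)  zero    = x
cell (_ ∷ xs) (suc i) = cell xs i

-- The input occupies the first memory cells; everything else is 0.

initial : List ℕ → State
initial xs = state (λ _ → 0) (cell xs)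

output : State → ℕ
output s = reg s 0

Computes : Program → List ℕ → ℕ → Set
Computes p xs y = ∃₂ λ t s → ⟨ p , initial xs ⟩⇓[ t ] s × output s ≡ y

Computable : (ℕ → ℕ) → Set
Computable f = ∃[ p ] ∀ x → Computes p (x ∷ []) (f x)

Computable₂ : (ℕ → ℕ → ℕ) → Set
Computable₂ f = ∃[ p ] ∀ x y → Computes p (x ∷ y ∷ []) (f x y)

------------------------------------------------------------------------
-- Parameterized graph problems

record Problem : Set₁ where
  field
    Instance  : Set
    graph     : Instance → Graph
    parameter : Instance → ℕ
    encode    : Instance → List ℕ
    Yes       : Pred Instance 0ℓ

-- The time bound is f(p) · nᶜ, with n read as 1 for the empty graph (on
-- which nᶜ would leave no time at all).

FPT : GraphClass ℓ → Problem → Set ℓ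
FPT C Π =
  ∃[ p ] ∃[ f ] ∃[ c ] Computable f ×
  (∀ I → C (graph I) →
   ∃₂ λ t s → ⟨ p , initial (encode I) ⟩⇓[ t ] s ×
              t ≤ f (parameter I) * (order (graph I) ⊔ 1) ^ c ×
              (output s ≡ 1 ⇔ Yes I))
  where open Problem Π

-- Encodings: adjacency matrices are written row by row, and sets as
-- characteristic sequences.

bit : Bool → ℕ
bit b = if b then 1 else 0

matrix : {n : ℕ} → (Fin n → Fin n → Bool) → List ℕ
matrix {n} a = concatMap (λ u → map (λ v → bit (a u v)) (allFin n)) (allFin n)

bits : {n : ℕ} → Subset n → List ℕ
bits X = map bit (toList X)

------------------------------------------------------------------------
-- Domination

module _ (G : Graph) where

  Dominates : ℕ → (X W : Subset (order G)) → Set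
  Dominates d X W = ∀ u → u ∈ W → ∃[ v ] v ∈ X × N ⟦ G ⟧ d v u

  Dominating : ℕ → Subset (order G) → Set
  Dominating d X = Dominates d X ⊤

  Independent : Subset (order G) → Set
  Independent X = ∀ u v → u ∈ X → v ∈ X → ¬ Edge G u v

  MinimalDominating : Subset (order G) → Set
  MinimalDominating X = Dominating 1 X × (∀ Y → Y ⊂ X → ¬ Dominating 1 Y)

------------------------------------------------------------------------
-- The problems

graphProblem : (∀ (G : Graph) (k : ℕ) → Set) → Problem
graphProblem Q = record
  { Instance  = Graph × ℕ
  ; graph     = proj₁
  ; parameter = proj₂
  ; encode    = λ (G , k) → order G ∷ k ∷ matrix (Graph.adj G)
  ; Yes       = λ (G , k) → Q G k
  }

graphProblemᵈ : (∀ (G : Graph) (k d : ℕ) → Set) → Problem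
graphProblemᵈ Q = record
  { Instance  = Graph × ℕ × ℕ
  ; graph     = proj₁
  ; parameter = λ (_ , k , d) → k + d
  ; encode    = λ (G , k , d) → order G ∷ k ∷ d ∷ matrix (Graph.adj G)
  ; Yes       = λ (G , k , d) → Q G k d
  }

graphProblemˢ : (∀ (G : Graph) (k : ℕ) → Subset (order G) → Set) → Problem
graphProblemˢ Q = record
  { Instance  = Σ[ G ∈ Graph ] ℕ × Subset (order G)
  ; graph     = proj₁
  ; parameter = λ (_ , k , _) → k
  ; encode    = λ (G , k , W) → order G ∷ k ∷ matrix (Graph.adj G) ++ bits W
  ; Yes       = λ (G , k , W) → Q G k W
  }

digraphProblem : (∀ (D : Digraph) (k : ℕ) → Set) → Problem
digraphProblem Q = record
  { Instance  = Digraph × ℕ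
  ; graph     = λ (D , _) → underlying D
  ; parameter = proj₂
  ; encode    = λ (D , k) → Digraph.order D ∷ k ∷ matrix (Digraph.arc D)
  ; Yes       = λ (D , k) → Q D k
  }

ConnectedDominatingSet : Problem
ConnectedDominatingSet = graphProblem λ G k →
  ∃[ X ] ∣ X ∣ ≡ k × Dominating G 1 X × Connected (induced ⟦ G ⟧ (_∈ X))

ConnectedDDominatingSet : Problem
ConnectedDDominatingSet = graphProblemᵈ λ G k d →
  ∃[ X ] ∣ X ∣ ≡ k × Dominating G d X × Connected (induced ⟦ G ⟧ (_∈ X))

DConnectedDDominatingSet : Problem
DConnectedDDominatingSet = graphProblemᵈ λ G k d →
  ∃[ X ] ∣ X ∣ ≡ k × Dominating G d X × Connected (induced (power ⟦ G ⟧ d) (_∈ X))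

AnnotatedDominatingSet : Problem
AnnotatedDominatingSet = graphProblemˢ λ G k W →
  ∃[ X ] ∣ X ∣ ≤ k × Dominates G 1 X W

EfficientDominatingSet : Problem
EfficientDominatingSet = graphProblem λ G k →
  ∃[ X ] ∣ X ∣ ≡ k × Dominating G 1 X ×
         (∀ x y → x ∈ X → y ∈ X → x ≢ y → Dist≥ ⟦ G ⟧ 3 x y)

MaximumMinimalDominatingSet : Problem
MaximumMinimalDominatingSet = graphProblem λ G k →
  ∃[ X ] MinimalDominating G X × ∣ X ∣ ≥ k

RomanDomination : Problem
RomanDomination = graphProblem λ G k →
  Σ[ R ∈ (Vertex G → Fin 3) ]
    (∀ v → R v ≡ 0F → ∃[ x ] Edge G v x × R x ≡ 2F) ×
    sum (tabulate (λ v → toℕ (R v))) ≤ k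

-- The subset in the input is the set of red vertices; its complement is blue.

RedBlueDominatingSet : Problem
RedBlueDominatingSet = graphProblemˢ λ G k red →
  ∃[ X ] X ⊆ red × ∣ X ∣ ≤ k × Dominates G 1 X (∁ red)

IndependentSet : Problem
IndependentSet = graphProblem λ G k →
  ∃[ X ] ∣ X ∣ ≡ k × Independent G X

IndependentDominatingSet : Problem
IndependentDominatingSet = graphProblem λ G k →
  ∃[ X ] ∣ X ∣ ≤ k × Dominating G 1 X × Independent G X

PerfectCode : Problem
PerfectCode = graphProblem λ G k →
  ∃[ X ] ∣ X ∣ ≡ k × (∀ v → ∃! _≡_ λ x → x ∈ X × N ⟦ G ⟧ 1 v x)

DigraphKernel : Problem
DigraphKernel = digraphProblem λ D k → let open Digraph D in
  ∃[ X ] ∣ X ∣ ≤ k ×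
         (∀ u v → u ∈ X → v ∈ X → ¬ Arc u v) ×
         (∀ u → u ∉ X → ∃[ v ] v ∈ X × Arc u v)

-- Let R be a relation each row of which is empty or a ball of radius at most r.
-- Going through a set W in order, keep a vertex v if some k rows cover all the
-- vertices kept so far (with the same trace on a fixed small set) but not v.  By
-- quasi-wideness the core of kept vertices has size bounded in terms of r and k,
-- and any k rows that cover the core cover W.  Hence only the trace of a vertex on
-- the core matters for domination.
--
-- * Domination without side conditions becomes a covering of the core.
-- * If the vertices of X must be pairwise compatible, a second core, of all vertices
--   with respect to conflicts and within each trace on the first, contains a
--   solution whenever there is one, by exchange.
-- * If X must be connected, one computes bottom-up which parts of the core are
--   dominated by a tree with at most j nodes and a given root.
-- * Since a maximal independent set is a minimal dominating set, a graph without
--   minimal dominating set of size k has no independent set of size k either; by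
--   quasi-wideness it is so small that all sets of vertices can be tried.
--
-- The algorithms are written in a small functional language with bounded loops,
-- whose programs run in polynomial time on the RAM.


module Submission where

open import Defs
open import Data.Bool using (Bool; true; false; T; if_then_else_; _∨_)
open import Data.Bool.Properties using (∨-comm; T-∨) renaming (_≟_ to _≟ᵇ_; T? to T?)
open import Data.Empty using (⊥)
open import Data.Fin using (Fin; zero; suc; toℕ; fromℕ<; inject≤; #_)
open import Data.Fin.Patterns
open import Data.Fin.Properties using (toℕ<n; toℕ-fromℕ<; toℕ-injective; any?; all?; pigeonhole; toℕ-inject≤) renaming (_≟_ to _≟ꟳ_; suc-injective to suc-injectiveᶠ)
open import Data.Fin.Subset using (Subset; inside; outside; _∈_; _∉_; ∣_∣; ∁; _⊆_; _⊂_; _∩_; _∪_; _-_; ⁅_⁆) renaming (⊤ to ⊤ˢ; ⊥ to ⊥ˢ)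
open import Data.Fin.Subset.Properties using (_∈?_; x∉p⇒x∈∁p; x∈∁p⇒x∉p; p⊆q⇒∣p∣≤∣q∣; ∣p∣≤n; ∣⊥∣≡0; ⊆-antisym; p∩q⊆q; ∣p∩q∣≤∣p∣; x∈p∩q⁺; ∈⊤; ∣⊤∣≡n; ∉⊥; p⊂q⇒∣p∣<∣q∣; p⊆p∪q; q⊆p∪q; x∈p∪q⁻; x∈p∪q⁺; x∈⁅x⁆; x∈⁅y⁆⇒x≡y; ∣⁅x⁆∣≡1; x∈p⇒p-x⊂p; x∈p∧x≢y⇒x∈p-y)
open import Data.List using (List; []; _∷_; length; filter; map; _++_; cartesianProductWith; upTo; allFin; concatMap) renaming (tabulate to tabulateᴸ)
open import Data.List.Properties using (length-map; length-++; length-upTo; ++-assoc; ++-identityʳ)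
  renaming (length-tabulate to length-tabulateᴸ)
open import Data.List.Membership.Propositional using () renaming (_∈_ to _∈ᴸ_)
open import Data.List.Membership.Propositional.Properties using (∈-upTo⁺; ∈-allFin; ∈-cartesianProductWith⁺; ∈-map⁺; ∈-++⁺ˡ; ∈-++⁺ʳ)
open import Data.List.Relation.Unary.All using (All; []; _∷_)
import Data.List.Relation.Unary.All as All
import Data.List.Relation.Unary.All.Properties as All
open import Data.List.Relation.Unary.Any using (here; there)
open import Data.List.Relation.Unary.AllPairs using (AllPairs; []; _∷_)
import Data.List.Relation.Unary.AllPairs as AllPairs
import Data.List.Relation.Unary.AllPairs.Properties as AllPairs
open import Data.Nat using (ℕ; zero; suc; _+_; _*_; _∸_; _^_; _⊔_; _≤_; _<_; _≥_; z≤n; s≤s; _≟_; _≡ᵇ_; s≤s⁻¹; >-nonZero)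
open import Data.Nat.Properties
open import Data.Nat.Solver using (module +-*-Solver)
open import Data.Product using (∃; ∃₂; ∃!; _×_; _,_; proj₁; proj₂)
open import Data.Sum using (_⊎_; inj₁; inj₂; [_,_]′)
open import Data.Unit using (⊤; tt)
open import Data.Vec using (Vec; []; _∷_; lookup; here; there; tabulate)
import Data.Vec as Vec
open import Data.Nat.ListAction using () renaming (sum to sumᴸ)
open import Data.Vec.Properties using (lookup-map; lookup∘tabulate; lookup⇒[]=; []=⇒lookup)
open import Data.Vec.Properties.WithK using ([]=-irrelevant)
open import Function using (_∋_; _∘_)
open import Function.Bundles using (_⇔_; mk⇔; Equivalence)
open import Relation.Binary.Core using (Rel)
open import Relation.Binary.Definitions using (tri<; tri≈; tri>)
open import Relation.Binary.PropositionalEquality using (_≡_; _≢_; refl; sym; trans; cong; cong₂; subst; subst₂)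
open import Relation.Nullary using (¬_; Dec; yes; no; does; contradiction)
open import Relation.Nullary.Decidable using (_⊎-dec_; _×-dec_; _→-dec_; ¬?; dec-true; dec-false)

-- A vertex v of W stays out of the core only if no k rows cover the kept vertices before it with
-- its trace and yet miss v. So k rows that cover the core cannot miss v. The obstacle is time:
-- trying all k-tuples of rows costs a power of n that grows with k. In a covering, therefore, rows
-- are not guessed together. For a core of t elements one guesses a table of tk bits saying which
-- slot is to cover which element, and then looks for a suitable row for each slot separately. This
-- takes 2^(tk) guesses and a fixed power of n, and the same device decides membership in the core
-- itself. All running times follow from a bound F(p) n^2 on the ranges of loops. One radius, p + 2,
-- serves every problem: dominating rows have radius at most 1 or d, and conflicts reach no further
-- than distance 2. The number of scattered vertices demanded is a power of two whose exponent
-- counts the tests that might tell vertices apart: the traces, the balls of radius at most p + 2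
-- around the deleted vertices, and the k rows of one vertex; two more leave enough vertices at the
-- end.

-- Expressions with bounded loops and their compilation

rec : {A : Set} → A → (ℕ → A → A) → ℕ → A
rec z f zero    = z
rec z f (suc m) = f m (rec z f m)

-- Expressions over s size variables and v value variables.  Only size
-- variables can bound a loop, so the running time is controlled by a bound on
-- the sizes alone, whereas values may be arbitrarily large.

data Exp : ℕ → ℕ → Set
eval : ∀ {s v} → (ℕ → ℕ) → Exp s v → Vec ℕ s → Vec ℕ v → ℕ

data Exp where
  con  : ∀ {s v} → ℕ → Exp s v
  sz   : ∀ {s v} → Fin s → Exp s v
  val  : ∀ {s v} → Fin v → Exp s v
  _⊕_  : ∀ {s v} → Exp s v → Exp s v → Exp s v
  _⊖_  : ∀ {s v} → Exp s v → Exp s v → Exp s v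
  ifz  : ∀ {s v} → Exp s v → Exp s v → Exp s v → Exp s v
  inp  : ∀ {s v} → Exp s v → Exp s v
  wkv  : ∀ {s v} → Exp s v → Exp s (suc v)
  -- A call evaluates to `F` rather than to the body, so a subroutine can be given an opaque meaning
  -- and goals that mention it do not unfold its code.
  proc : ∀ {s v s′ v′} → Vec (Fin s) s′ → Vec (Fin v) v′ → (e : Exp s′ v′) (F : (ℕ → ℕ) → Vec ℕ s′ → Vec ℕ v′ → ℕ) →
         (∀ M σ ρ → eval M e σ ρ ≡ F M σ ρ) → Exp s v
  letv : ∀ {s v} → Exp s v → Exp s (suc v) → Exp s v
  lets : ∀ {s v} → Exp s v → Exp (suc s) v → Exp s v
  fold : ∀ {s v} → Fin s → Exp s v → Exp (suc s) (suc v) → Exp s v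

infixl 9 _⊕_ _⊖_

ifz-sem : {A : Set} → ℕ → A → A → A
ifz-sem zero    a b = a
ifz-sem (suc _) a b = b

eval M (con c)      σ ρ       = c
eval M (sz i)       σ ρ       = lookup σ i
eval M (val i)      σ ρ       = lookup ρ i
eval M (a ⊕ b)      σ ρ       = eval M a σ ρ + eval M b σ ρ
eval M (a ⊖ b)      σ ρ       = eval M a σ ρ ∸ eval M b σ ρ
eval M (ifz c a b)  σ ρ       = ifz-sem (eval M c σ ρ) (eval M a σ ρ) (eval M b σ ρ)
eval M (inp a)      σ ρ       = M (eval M a σ ρ)
eval M (wkv a)      σ (_ ∷ ρ) = eval M a σ ρ
eval M (proc f g a F _) σ ρ   = F M (Vec.map (lookup σ) f) (Vec.map (lookup ρ) g)
eval M (letv a b)   σ ρ       = eval M b σ (eval M a σ ρ ∷ ρ)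
eval M (lets a b)   σ ρ       = eval M b (eval M a σ ρ ∷ σ) ρ
eval M (fold i z b) σ ρ       = rec (eval M z σ ρ) (λ j a → eval M b (j ∷ σ) (a ∷ ρ)) (lookup σ i)

-- The only real condition is at `lets`: a computed number that becomes a size must be at most `Q`.
-- Loop indices stay below a size already in scope. Only the branch taken and the rounds performed
-- have to be safe, so a costly branch may rely on its guard.
data Safe (Q : ℕ) (M : ℕ → ℕ) : ∀ {s v} → Exp s v → Vec ℕ s → Vec ℕ v → Set where
  con  : ∀ {s v c} {σ : Vec ℕ s} {ρ : Vec ℕ v} → Safe Q M (con c) σ ρ
  sz   : ∀ {s v i} {σ : Vec ℕ s} {ρ : Vec ℕ v} → Safe Q M (sz i) σ ρ
  val  : ∀ {s v i} {σ : Vec ℕ s} {ρ : Vec ℕ v} → Safe Q M (val i) σ ρ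
  _⊕_  : ∀ {s v a b} {σ : Vec ℕ s} {ρ : Vec ℕ v} → Safe Q M a σ ρ → Safe Q M b σ ρ → Safe Q M (a ⊕ b) σ ρ
  _⊖_  : ∀ {s v a b} {σ : Vec ℕ s} {ρ : Vec ℕ v} → Safe Q M a σ ρ → Safe Q M b σ ρ → Safe Q M (a ⊖ b) σ ρ
  ifz  : ∀ {s v c a b} {σ : Vec ℕ s} {ρ : Vec ℕ v} → Safe Q M c σ ρ → (eval M c σ ρ ≡ 0 → Safe Q M a σ ρ) →
         (eval M c σ ρ ≢ 0 → Safe Q M b σ ρ) → Safe Q M (ifz c a b) σ ρ
  inp  : ∀ {s v a} {σ : Vec ℕ s} {ρ : Vec ℕ v} → Safe Q M a σ ρ → Safe Q M (inp a) σ ρ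
  wkv  : ∀ {s v a x} {σ : Vec ℕ s} {ρ : Vec ℕ v} → Safe Q M a σ ρ → Safe Q M (wkv a) σ (x ∷ ρ)
  proc : ∀ {s v s′ v′ f g a F e} {σ : Vec ℕ s} {ρ : Vec ℕ v} →
         Safe Q M {s′} {v′} a (Vec.map (lookup σ) f) (Vec.map (lookup ρ) g) → Safe Q M (proc f g a F e) σ ρ
  letv : ∀ {s v a b} {σ : Vec ℕ s} {ρ : Vec ℕ v} → Safe Q M a σ ρ → Safe Q M b σ (eval M a σ ρ ∷ ρ) → Safe Q M (letv a b) σ ρ
  lets : ∀ {s v a b} {σ : Vec ℕ s} {ρ : Vec ℕ v} → Safe Q M a σ ρ → eval M a σ ρ ≤ Q → Safe Q M b (eval M a σ ρ ∷ σ) ρ →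
         Safe Q M (lets a b) σ ρ
  fold : ∀ {s v i z b} {σ : Vec ℕ s} {ρ : Vec ℕ v} → Safe Q M z σ ρ →
         (∀ j → j < lookup σ i → Safe Q M b (j ∷ σ) (rec (eval M z σ ρ) (λ j a → eval M b (j ∷ σ) (a ∷ ρ)) j ∷ ρ)) → Safe Q M (fold i z b) σ ρ

-- Without `lets` no new size is computed, hence such expressions are safe for every `Q`.
Static : ∀ {s v} → Exp s v → Set
Static (con c)      = ⊤
Static (sz i)       = ⊤
Static (val i)      = ⊤
Static (a ⊕ b)      = Static a × Static b
Static (a ⊖ b)      = Static a × Static b
Static (ifz c a b)  = Static c × Static a × Static b
Static (inp a)      = Static a
Static (wkv a)      = Static a
Static (proc f g a _ _) = Static a
Static (letv a b)   = Static a × Static b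
Static (lets a b)   = ⊥
Static (fold i z b) = Static z × Static b

static-safe : ∀ {s v Q M} (e : Exp s v) σ ρ → Static e → Safe Q M e σ ρ
static-safe (con c)            σ ρ       _           = con
static-safe (sz i)             σ ρ       _           = sz
static-safe (val i)            σ ρ       _           = val
static-safe (a ⊕ b)            σ ρ       (p , q)     = static-safe a σ ρ p ⊕ static-safe b σ ρ q
static-safe (a ⊖ b)            σ ρ       (p , q)     = static-safe a σ ρ p ⊖ static-safe b σ ρ q
static-safe (ifz c a b)        σ ρ       (p , q , r) =
  ifz (static-safe c σ ρ p) (λ _ → static-safe a σ ρ q) (λ _ → static-safe b σ ρ r)
static-safe (inp a)            σ ρ       p           = inp (static-safe a σ ρ p)
static-safe (wkv a)            σ (_ ∷ ρ) p           = wkv (static-safe a σ ρ p)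
static-safe (proc f g a _ _)   σ ρ       p           = proc (static-safe a _ _ p)
static-safe (letv a b)         σ ρ       (p , q)     = letv (static-safe a σ ρ p) (static-safe b σ _ q)
static-safe (fold i z b)       σ ρ       (p , q)     = fold (static-safe z σ ρ p) λ j _ → static-safe b _ _ q

-- The code for an expression works on a stack of registers: it leaves its
-- result in register h and does not touch the registers below h, among which
-- are those holding the variables.

move : ℕ → ℕ → Program
move i j = instr (const i 0) ⨾ instr (add i j i)

-- Layout of a `fold` at height h: register h is the accumulator, 1 + h the number of rounds left, 2
-- + h the index, and 3 + h receives the result of the body before it is reused for the constant 1.
next : ℕ → Program
next h = instr (const (3 + h) 1) ⨾ instr (add (2 + h) (2 + h) (3 + h)) ⨾ instr (sub (1 + h) (1 + h) (3 + h))

compile : ∀ {s v} → Exp s v → Vec ℕ s → Vec ℕ v → ℕ → Program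
compile (con c)      sa va       h = instr (const h c)
compile (sz i)       sa va       h = move h (lookup sa i)
compile (val i)      sa va       h = move h (lookup va i)
compile (a ⊕ b)      sa va       h = compile a sa va h ⨾ compile b sa va (1 + h) ⨾ instr (add h h (1 + h))
compile (a ⊖ b)      sa va       h = compile a sa va h ⨾ compile b sa va (1 + h) ⨾ instr (sub h h (1 + h))
compile (ifz c a b)  sa va       h = compile c sa va h ⨾ (ifnz h then compile b sa va h else compile a sa va h)
compile (inp a)      sa va       h = compile a sa va h ⨾ instr (load h h)
compile (wkv a)      sa (_ ∷ va) h = compile a sa va h
compile (proc f g a _ _) sa va   h = compile a (Vec.map (lookup sa) f) (Vec.map (lookup va) g) h
compile (letv a b)   sa va       h = compile a sa va h ⨾ compile b sa (h ∷ va) (1 + h) ⨾ move h (1 + h)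
compile (lets a b)   sa va       h = compile a sa va h ⨾ compile b (h ∷ sa) va (1 + h) ⨾ move h (1 + h)
compile (fold i z b) sa va       h =
  compile z sa va h ⨾ (move (1 + h) (lookup sa i) ⨾ instr (const (2 + h) 0)) ⨾
  (whilenz (1 + h) loop (compile b ((2 + h) ∷ sa) (h ∷ va) (3 + h) ⨾ move h (3 + h) ⨾ next h))

-- The branches of `ifz` are added so that the cost is visibly a polynomial in `Q`. In `fold`, 3
-- instructions set up the counters and 5 follow the body in each round.
cost : ∀ {s v} → Exp s v → ℕ → ℕ
cost (con c)      Q = 1
cost (sz i)       Q = 2
cost (val i)      Q = 2
cost (a ⊕ b)      Q = cost a Q + (cost b Q + 1)
cost (a ⊖ b)      Q = cost a Q + (cost b Q + 1)
cost (ifz c a b)  Q = cost c Q + suc (cost a Q + cost b Q)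
cost (inp a)      Q = cost a Q + 1
cost (wkv a)      Q = cost a Q
cost (proc f g a _ _) Q = cost a Q
cost (letv a b)   Q = cost a Q + (cost b Q + 2)
cost (lets a b)   Q = cost a Q + (cost b Q + 2)
cost (fold i z b) Q = cost z Q + (3 + (Q * suc (cost b Q + 5) + 1))

↦-same : ∀ (g : ℕ → ℕ) i x → (g [ i ↦ x ]) i ≡ x
↦-same g i x rewrite dec-true (i ≟ i) refl = refl

↦-other : ∀ (g : ℕ → ℕ) i x j → i ≢ j → (g [ i ↦ x ]) j ≡ g j
↦-other g i x j i≢j rewrite dec-false (i ≟ j) i≢j = refl

module Compilation where

  record Runs (p : Program) (st : State) (h x c : ℕ) : Set where
    constructor runs
    field
      {time}   : ℕ
      {final}  : State
      run      : ⟨ p , st ⟩⇓[ time ] final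
      time≤    : time ≤ c
      result   : reg final h ≡ x
      frame    : ∀ j → j < h → reg final j ≡ reg st j
      memory   : mem final ≡ mem st

  open Runs

  record Holds {n} (sa σ : Vec ℕ n) (h : ℕ) (st : State) : Set where
    constructor holds
    field
      address< : ∀ i → lookup sa i < h
      value    : ∀ i → reg st (lookup sa i) ≡ lookup σ i

  open Holds

  holds-map : ∀ {n m h st} {sa σ : Vec ℕ n} (f : Vec (Fin n) m) → Holds sa σ h st →
              Holds (Vec.map (lookup sa) f) (Vec.map (lookup σ) f) h st
  holds-map {h = h} {st} {sa} {σ} f H = holds
    (λ i → subst (_< h) (sym (lookup-map i (lookup sa) f)) (address< H (lookup f i)))
    (λ i → trans (cong (reg st) (lookup-map i (lookup sa) f)) (trans (value H (lookup f i)) (sym (lookup-map i (lookup σ) f))))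

  holds-frame : ∀ {n h h′ st st′} {sa σ : Vec ℕ n} → h ≤ h′ → (∀ j → j < h → reg st′ j ≡ reg st j) →
                Holds sa σ h st → Holds sa σ h′ st′
  holds-frame h≤ fr H = holds (λ i → <-≤-trans (address< H i) h≤) (λ i → trans (fr _ (address< H i)) (value H i))

  holds-∷ : ∀ {n h st a x} {sa σ : Vec ℕ n} → a < h → reg st a ≡ x → Holds sa σ h st → Holds (a ∷ sa) (x ∷ σ) h st
  holds-∷ a<h eq H = holds (λ { zero → a<h ; (suc i) → address< H i }) (λ { zero → eq ; (suc i) → value H i })

  holds-tail : ∀ {n h st a x} {sa σ : Vec ℕ n} → Holds (a ∷ sa) (x ∷ σ) h st → Holds sa σ h st
  holds-tail H = holds (λ i → address< H (suc i)) (λ i → value H (suc i))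

  record Bounded {n} (Q : ℕ) (σ : Vec ℕ n) : Set where
    constructor bounded
    field bound : ∀ i → lookup σ i ≤ Q

  open Bounded

  bounded-map : ∀ {n m Q} {σ : Vec ℕ n} (f : Vec (Fin n) m) → Bounded Q σ → Bounded Q (Vec.map (lookup σ) f)
  bounded-map {Q = Q} {σ} f B = bounded λ i → subst (_≤ Q) (sym (lookup-map i (lookup σ) f)) (bound B (lookup f i))

  bounded-∷ : ∀ {n Q x} {σ : Vec ℕ n} → x ≤ Q → Bounded Q σ → Bounded Q (x ∷ σ)
  bounded-∷ x≤Q B = bounded λ { zero → x≤Q ; (suc i) → bound B i }

  instr-runs : ∀ a {st h x} → reg (exec a st) h ≡ x → (∀ j → j < h → reg (exec a st) j ≡ reg st j) →
               mem (exec a st) ≡ mem st → Runs (instr a) st h x 1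
  instr-runs a eq fr m = runs instr ≤-refl eq fr m

  below : ∀ (g : ℕ → ℕ) i x {h} → h ≤ i → ∀ j → j < h → (g [ i ↦ x ]) j ≡ g j
  below g i x h≤i j j<h = ↦-other g i x j (λ eq → <⇒≱ j<h (subst (_ ≤_) eq h≤i))

  move-runs : ∀ {st x} i j → j ≢ i → reg st j ≡ x → Runs (move i j) st i x 2
  move-runs {state r m} {x} i j j≢i eq = runs (instr ⨾ instr) ≤-refl
    (trans (↦-same r₁ i _) (trans (cong₂ _+_ (trans (↦-other r i 0 j (λ p → j≢i (sym p))) eq) (↦-same r i 0)) (+-identityʳ x)))
    (λ k k<i → trans (below r₁ i _ ≤-refl k k<i) (below r i 0 ≤-refl k k<i)) refl
    where r₁ = r [ i ↦ 0 ]

  seq-runs : ∀ {p q st h₁ h x y c₁ c₂} → h ≤ h₁ → (R : Runs p st h₁ x c₁) → Runs q (final R) h y c₂ →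
             Runs (p ⨾ q) st h y (c₁ + c₂)
  seq-runs h≤ R S = runs (run R ⨾ run S) (+-mono-≤ (time≤ R) (time≤ S)) (result S)
    (λ j j<h → trans (frame S j j<h) (frame R j (<-≤-trans j<h h≤))) (trans (memory S) (memory R))

  cast-result : ∀ {p st h x y c} → x ≡ y → Runs p st h x c → Runs p st h y c
  cast-result refl R = R

  ≡ᵇ-refl : ∀ n → (n ≡ᵇ n) ≡ true
  ≡ᵇ-refl n = dec-true (n ≟ n) refl

  ≡ᵇ-below : ∀ k n → (n ≡ᵇ suc k + n) ≡ false
  ≡ᵇ-below k n = dec-false (n ≟ suc k + n) (m≢1+n+m n)

  ≡ᵇ-above : ∀ k n → (suc k + n ≡ᵇ n) ≡ false
  ≡ᵇ-above k n = dec-false (suc k + n ≟ n) (λ eq → m≢1+n+m n (sym eq))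

  record Steps (p : Program) (st : State) (h y i c t : ℕ) : Set where
    field
      {final} : State
      run     : ⟨ p , st ⟩⇓[ t ] final
      acc     : reg final h ≡ y
      left    : reg final (1 + h) ≡ c
      index   : reg final (2 + h) ≡ i
      frame   : ∀ j → j < h → reg final j ≡ reg st j
      memory  : mem final ≡ mem st

  next-steps : ∀ {st h y i c} → reg st (3 + h) ≡ y → reg st (2 + h) ≡ i → reg st (1 + h) ≡ suc c →
               Steps (move h (3 + h) ⨾ next h) st h y (suc i) c 5
  next-steps {state r m} {h} {y} {i} {c} e₃ e₂ e₁ = record
    { run    = (instr ⨾ instr) ⨾ (instr ⨾ instr ⨾ instr)
    ; acc    = acc
    ; left   = left
    ; index  = index
    ; frame  = λ j j<h → trans (below r₄ (1 + h) _ (m≤n+m h 1) j j<h)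
                 (trans (below r₃ (2 + h) _ (m≤n+m h 2) j j<h)
                 (trans (below r₂ (3 + h) _ (m≤n+m h 3) j j<h)
                 (trans (below r₁ h _ ≤-refl j j<h) (below r h _ ≤-refl j j<h))))
    ; memory = refl
    }
    where
    r₁ = r [ h ↦ 0 ]
    r₂ = r₁ [ h ↦ r₁ (3 + h) + r₁ h ]
    r₃ = r₂ [ 3 + h ↦ 1 ]
    r₄ = r₃ [ 2 + h ↦ r₃ (2 + h) + r₃ (3 + h) ]
    r₅ = r₄ [ 1 + h ↦ r₄ (1 + h) ∸ r₄ (3 + h) ]
    acc : r₅ h ≡ y
    acc rewrite ≡ᵇ-refl h | ≡ᵇ-above 0 h | ≡ᵇ-above 1 h | ≡ᵇ-above 2 h | ≡ᵇ-below 2 h | e₃ = +-identityʳ y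
    left : r₅ (1 + h) ≡ c
    left rewrite ≡ᵇ-refl h | ≡ᵇ-above 0 h | ≡ᵇ-above 1 h | ≡ᵇ-below 0 h | e₁ = refl
    index : r₅ (2 + h) ≡ suc i
    index rewrite ≡ᵇ-refl h | ≡ᵇ-above 0 h | ≡ᵇ-above 1 h | ≡ᵇ-below 0 h | ≡ᵇ-below 1 h | e₂ = +-comm i 1

  init-steps : ∀ {st h a z i} → reg st h ≡ z → a < h → reg st a ≡ i →
               Steps (move (1 + h) a ⨾ instr (const (2 + h) 0)) st h z 0 i 3
  init-steps {state r m} {h} {a} {z} {i} e a<h ea = record
    { run    = (instr ⨾ instr) ⨾ instr
    ; acc    = acc
    ; left   = left
    ; index  = ↦-same r₂ (2 + h) 0
    ; frame  = λ j j<h → trans (below r₂ (2 + h) _ (m≤n+m h 2) j j<h)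
                 (trans (below r₁ (1 + h) _ (m≤n+m h 1) j j<h) (below r (1 + h) _ (m≤n+m h 1) j j<h))
    ; memory = refl
    }
    where
    r₁ = r [ 1 + h ↦ 0 ]
    r₂ = r₁ [ 1 + h ↦ r₁ a + r₁ (1 + h) ]
    acc : (r₂ [ 2 + h ↦ 0 ]) h ≡ z
    acc rewrite ≡ᵇ-above 0 h | ≡ᵇ-above 1 h = e
    left : (r₂ [ 2 + h ↦ 0 ]) (1 + h) ≡ i
    left rewrite ≡ᵇ-refl h | ≡ᵇ-above 0 h | dec-false (1 + h ≟ a) (λ eq → <⇒≱ a<h (subst (h ≤_) eq (n≤1+n h))) | ea = +-identityʳ i

  -- Compiled code contains no `store`, so the input stays in memory throughout and one fixed `M`
  -- describes it.
  compile-runs : ∀ {s v} (e : Exp s v) {Q M σ ρ sa va h st} → Safe Q M e σ ρ → Bounded Q σ →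
                 Holds sa σ h st → Holds va ρ h st → mem st ≡ M → Runs (compile e sa va h) st h (eval M e σ ρ) (cost e Q)
  compile-runs (con c) {h = h} {st} S B Hs Hv refl = instr-runs _ (↦-same (reg st) h _) (below _ _ _ ≤-refl) refl
  compile-runs (sz i) S B Hs Hv refl = move-runs _ _ (<⇒≢ (address< Hs i)) (value Hs i)
  compile-runs (val i) S B Hs Hv refl = move-runs _ _ (<⇒≢ (address< Hv i)) (value Hv i)
  compile-runs (a ⊕ b) {h = h} (Sa ⊕ Sb) B Hs Hv refl =
    seq-runs ≤-refl Ra (seq-runs (n≤1+n _) Rb (instr-runs _
      (trans (↦-same (reg (final Rb)) h _) (cong₂ _+_ (trans (frame Rb h ≤-refl) (result Ra)) (result Rb))) (below _ _ _ ≤-refl) refl))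
    where
    Ra = compile-runs a Sa B Hs Hv refl
    Rb = compile-runs b Sb B (holds-frame (n≤1+n _) (frame Ra) Hs) (holds-frame (n≤1+n _) (frame Ra) Hv) (memory Ra)
  compile-runs (a ⊖ b) {h = h} (Sa ⊖ Sb) B Hs Hv refl =
    seq-runs ≤-refl Ra (seq-runs (n≤1+n _) Rb (instr-runs _
      (trans (↦-same (reg (final Rb)) h _) (cong₂ _∸_ (trans (frame Rb h ≤-refl) (result Ra)) (result Rb))) (below _ _ _ ≤-refl) refl))
    where
    Ra = compile-runs a Sa B Hs Hv refl
    Rb = compile-runs b Sb B (holds-frame (n≤1+n _) (frame Ra) Hs) (holds-frame (n≤1+n _) (frame Ra) Hv) (memory Ra)
  compile-runs (ifz c a b) {Q} {M} {σ} {ρ} {sa} {va} {h} {st} (ifz Sc Sa Sb) B Hs Hv refl = seq-runs ≤-refl Rc (branch _ refl (result Rc))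
    where
    Rc = compile-runs c Sc B Hs Hv refl
    branch : ∀ x → eval M c σ ρ ≡ x → reg (final Rc) h ≡ x → Runs (ifnz h then compile b sa va h else compile a sa va h) (final Rc) h
               (ifz-sem x (eval M a σ ρ) (eval M b σ ρ)) (suc (cost a Q + cost b Q))
    branch zero    e eq = runs (if-z eq (run R)) (s≤s (≤-trans (time≤ R) (m≤m+n _ _))) (result R) (frame R) (memory R)
      where R = compile-runs a (Sa e) B (holds-frame ≤-refl (frame Rc) Hs) (holds-frame ≤-refl (frame Rc) Hv) (memory Rc)
    branch (suc _) e eq = runs (if-nz (λ p → 1+n≢0 (trans (sym eq) p)) (run R)) (s≤s (≤-trans (time≤ R) (m≤n+m _ _))) (result R) (frame R) (memory R)
      where R = compile-runs b (Sb λ p → 1+n≢0 (trans (sym e) p)) B (holds-frame ≤-refl (frame Rc) Hs) (holds-frame ≤-refl (frame Rc) Hv) (memory Rc)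
  compile-runs (inp a) {h = h} (inp S) B Hs Hv refl = seq-runs ≤-refl R (instr-runs _
    (trans (↦-same (reg (final R)) h _) (cong₂ (λ m x → m x) (memory R) (result R))) (below _ _ _ ≤-refl) refl)
    where R = compile-runs a S B Hs Hv refl
  compile-runs (wkv a) {ρ = _ ∷ ρ} {va = _ ∷ va} (wkv S) B Hs Hv eq = compile-runs a S B Hs (holds-tail Hv) eq
  compile-runs (proc f g a F spec) {M = M} (proc S) B Hs Hv eq =
    cast-result (spec M _ _) (compile-runs a S (bounded-map f B) (holds-map f Hs) (holds-map g Hv) eq)
  compile-runs (letv a b) {h = h} (letv Sa Sb) B Hs Hv refl =
    seq-runs ≤-refl Ra (seq-runs (n≤1+n _) Rb (move-runs h (1 + h) 1+n≢n (result Rb)))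
    where
    Ra = compile-runs a Sa B Hs Hv refl
    Rb = compile-runs b Sb B (holds-frame (n≤1+n _) (frame Ra) Hs)
           (holds-∷ ≤-refl (result Ra) (holds-frame (n≤1+n _) (frame Ra) Hv)) (memory Ra)
  compile-runs (lets a b) {h = h} (lets Sa a≤Q Sb) B Hs Hv refl =
    seq-runs ≤-refl Ra (seq-runs (n≤1+n _) Rb (move-runs h (1 + h) 1+n≢n (result Rb)))
    where
    Ra = compile-runs a Sa B Hs Hv refl
    Rb = compile-runs b Sb (bounded-∷ a≤Q B) (holds-∷ ≤-refl (result Ra) (holds-frame (n≤1+n _) (frame Ra) Hs))
           (holds-frame (n≤1+n _) (frame Ra) Hv) (memory Ra)
  compile-runs (fold i z b) {Q} {M} {σ} {ρ} {sa} {va} {h} (fold Sz Sb) B Hs Hv refl =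
    seq-runs ≤-refl Rz (assemble (init-steps (result Rz) (address< Hs i) (trans (frame Rz _ (address< Hs i)) (value Hs i))))
    where
    Rz = compile-runs z Sz B Hs Hv refl
    f : ℕ → ℕ → ℕ
    f j a = eval M b (j ∷ σ) (a ∷ ρ)
    z₀ = eval M z σ ρ
    total = lookup σ i
    body = compile b ((2 + h) ∷ sa) (h ∷ va) (3 + h) ⨾ move h (3 + h) ⨾ next h
    loops : ∀ c j {st} → j + c ≡ total → reg st h ≡ rec z₀ f j → reg st (1 + h) ≡ c → reg st (2 + h) ≡ j →
            Holds sa σ h st → Holds va ρ h st → mem st ≡ M →
            Runs (whilenz (1 + h) loop body) st h (rec z₀ f total) (c * suc (cost b Q + 5) + 1)
    loops zero j tot ea el ei Hs Hv em = runs (exit el) ≤-refl (trans ea (cong (rec z₀ f) (trans (sym (+-identityʳ j)) tot))) (λ _ _ → refl) refl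
    loops (suc c) j {st} tot ea el ei Hs Hv em =
      runs (loop (λ p → 1+n≢0 (trans (sym el) p)) (run Rb ⨾ Steps.run S) (run L))
        (s≤s (≤-trans (+-mono-≤ (+-monoˡ-≤ 5 (time≤ Rb)) (time≤ L)) (≤-reflexive (sym (+-assoc (cost b Q + 5) _ 1)))))
        (result L) (λ k k<h → trans (frame L k k<h) (trans (Steps.frame S k k<h) (frame Rb k (≤-trans k<h (m≤n+m h 3)))))
        (trans (memory L) (trans (Steps.memory S) (memory Rb)))
      where
      j<total : j < total
      j<total = subst (j <_) tot (subst (j <_) (sym (+-suc j c)) (s≤s (m≤m+n j c)))
      Rb = compile-runs b {Q} {M} {j ∷ σ} {rec z₀ f j ∷ ρ} {(2 + h) ∷ sa} {h ∷ va} {3 + h} {st} (Sb j j<total)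
             (bounded-∷ (<⇒≤ (<-≤-trans j<total (bound B i))) B)
             (holds-∷ (n<1+n (2 + h)) ei (holds-frame (m≤n+m h 3) (λ _ _ → refl) Hs))
             (holds-∷ (m≤n+m (suc h) 2) ea (holds-frame (m≤n+m h 3) (λ _ _ → refl) Hv)) em
      S = next-steps (result Rb) (trans (frame Rb (2 + h) ≤-refl) ei) (trans (frame Rb (1 + h) (n≤1+n _)) el)
      fr : ∀ k → k < h → reg (Steps.final S) k ≡ reg st k
      fr k k<h = trans (Steps.frame S k k<h) (frame Rb k (≤-trans k<h (m≤n+m h 3)))
      L = loops c (suc j) (trans (sym (+-suc j c)) tot) (Steps.acc S) (Steps.left S) (Steps.index S)
            (holds-frame ≤-refl fr Hs) (holds-frame ≤-refl fr Hv) (trans (Steps.memory S) (trans (memory Rb) em))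
    assemble : (S : Steps (move (1 + h) (lookup sa i) ⨾ instr (const (2 + h) 0)) (final Rz) h z₀ 0 total 3) →
               Runs ((move (1 + h) (lookup sa i) ⨾ instr (const (2 + h) 0)) ⨾ (whilenz (1 + h) loop body))
                 (final Rz) h (rec z₀ f total) (3 + (Q * suc (cost b Q + 5) + 1))
    assemble S = runs (Steps.run S ⨾ run L)
      (+-monoʳ-≤ 3 (≤-trans (time≤ L) (+-monoˡ-≤ 1 (*-monoˡ-≤ (suc (cost b Q + 5)) (bound B i)))))
      (result L) (λ k k<h → trans (frame L k k<h) (Steps.frame S k k<h)) (trans (memory L) (Steps.memory S))
      where
      fr : ∀ k → k < h → reg (Steps.final S) k ≡ _
      fr k k<h = trans (Steps.frame S k k<h) (frame Rz k k<h)
      L = loops total 0 refl (Steps.acc S) (Steps.left S) (Steps.index S)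
            (holds-frame ≤-refl fr Hs) (holds-frame ≤-refl fr Hv) (trans (Steps.memory S) (memory Rz))

open Compilation

-- Polynomial cost

-- The base is `suc Q` so that raising the exponent never decreases the bound, even for `Q` equal to
-- 0.
Poly : (ℕ → ℕ) → Set
Poly f = ∃₂ λ K D → ∀ Q → f Q ≤ K * suc Q ^ D

poly-const : ∀ c → Poly (λ _ → c)
poly-const c = c , 0 , λ Q → ≤-reflexive (sym (*-identityʳ c))

poly-+ : ∀ {f g} → Poly f → Poly g → Poly (λ Q → f Q + g Q)
poly-+ {f} {g} (K , D , p) (L , E , q) = K + L , D + E , λ Q → ≤-trans
  (+-mono-≤ (≤-trans (p Q) (*-monoʳ-≤ K (^-monoʳ-≤ (suc Q) (m≤m+n D E)))) (≤-trans (q Q) (*-monoʳ-≤ L (^-monoʳ-≤ (suc Q) (m≤n+m E D)))))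
  (≤-reflexive (sym (*-distribʳ-+ (suc Q ^ (D + E)) K L)))

poly-Q* : ∀ {f} → Poly f → Poly (λ Q → Q * f Q)
poly-Q* {f} (K , D , p) = K , suc D , λ Q → ≤-trans (*-mono-≤ (n≤1+n Q) (p Q))
  (≤-reflexive (solve 3 (λ q k x → q :* (k :* x) := k :* (q :* x)) refl (suc Q) K (suc Q ^ D)))
  where open +-*-Solver

cost-poly : ∀ {s v} (e : Exp s v) → Poly (cost e)
cost-poly (con c)      = poly-const 1
cost-poly (sz i)       = poly-const 2
cost-poly (val i)      = poly-const 2
cost-poly (a ⊕ b)      = poly-+ (cost-poly a) (poly-+ (cost-poly b) (poly-const 1))
cost-poly (a ⊖ b)      = poly-+ (cost-poly a) (poly-+ (cost-poly b) (poly-const 1))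
cost-poly (ifz c a b)  = poly-+ (cost-poly c) (poly-+ (poly-const 1) (poly-+ (cost-poly a) (cost-poly b)))
cost-poly (inp a)      = poly-+ (cost-poly a) (poly-const 1)
cost-poly (wkv a)      = cost-poly a
cost-poly (proc f g a _ _) = cost-poly a
cost-poly (letv a b)   = poly-+ (cost-poly a) (poly-+ (cost-poly b) (poly-const 2))
cost-poly (lets a b)   = poly-+ (cost-poly a) (poly-+ (cost-poly b) (poly-const 2))
cost-poly (fold i z b) = poly-+ (cost-poly z) (poly-+ (poly-const 3)
  (poly-+ (poly-Q* (poly-+ (poly-const 1) (poly-+ (cost-poly b) (poly-const 5)))) (poly-const 1)))

-- Formulas with bounded quantifiers

Sum : (ℕ → ℕ) → ℕ → ℕ
Sum f = rec 0 (λ j a → a + f j)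

sum : ∀ {s v} → Fin s → Exp (suc s) v → Exp s v
sum i b = fold i (con 0) (val 0F ⊕ wkv b)

data Fm : ℕ → ℕ → Set where
  nz      : ∀ {s v} → Exp s v → Fm s v
  _≐_ _≼_ : ∀ {s v} → Exp s v → Exp s v → Fm s v
  _∧ᶠ_    : ∀ {s v} → Fm s v → Fm s v → Fm s v
  _∨ᶠ_    : ∀ {s v} → Fm s v → Fm s v → Fm s v
  _⇒ᶠ_    : ∀ {s v} → Fm s v → Fm s v → Fm s v
  ¬ᶠ_     : ∀ {s v} → Fm s v → Fm s v
  ex al   : ∀ {s v} → Fin s → Fm (suc s) v → Fm s v
  renᶠ    : ∀ {s v s′ v′} → Vec (Fin s) s′ → Vec (Fin v) v′ → Fm s′ v′ → Fm s v

infix  8 _≐_ _≼_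
infix  7 ¬ᶠ_
infixr 6 _∧ᶠ_
infixr 5 _∨ᶠ_
infixr 4 _⇒ᶠ_

-- Defined by recursion into `Set`, so that the meaning of a concrete formula unfolds to the
-- intended proposition and specifications can often be matched without any rewriting.
Sem : ∀ {s v} → (ℕ → ℕ) → Fm s v → Vec ℕ s → Vec ℕ v → Set
Sem M (nz e)      σ ρ = eval M e σ ρ ≢ 0
Sem M (a ≐ b)     σ ρ = eval M a σ ρ ≡ eval M b σ ρ
Sem M (a ≼ b)     σ ρ = eval M a σ ρ ≤ eval M b σ ρ
Sem M (φ ∧ᶠ ψ)    σ ρ = Sem M φ σ ρ × Sem M ψ σ ρ
Sem M (φ ∨ᶠ ψ)    σ ρ = Sem M φ σ ρ ⊎ Sem M ψ σ ρ
Sem M (φ ⇒ᶠ ψ)    σ ρ = Sem M φ σ ρ → Sem M ψ σ ρ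
Sem M (¬ᶠ φ)      σ ρ = ¬ Sem M φ σ ρ
Sem M (ex i φ)    σ ρ = ∃ λ (x : Fin (lookup σ i)) → Sem M φ (toℕ x ∷ σ) ρ
Sem M (al i φ)    σ ρ = ∀ (x : Fin (lookup σ i)) → Sem M φ (toℕ x ∷ σ) ρ
Sem M (renᶠ f g φ) σ ρ = Sem M φ (Vec.map (lookup σ) f) (Vec.map (lookup ρ) g)

fm : ∀ {s v} → Fm s v → Exp s v
fm (nz e)       = ifz e (con 0) (con 1)
fm (a ≐ b)      = ifz ((a ⊖ b) ⊕ (b ⊖ a)) (con 1) (con 0)
fm (a ≼ b)      = ifz (a ⊖ b) (con 1) (con 0)
fm (φ ∧ᶠ ψ)     = ifz (fm φ) (con 0) (fm ψ)
fm (φ ∨ᶠ ψ)     = ifz (fm φ) (fm ψ) (con 1)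
fm (φ ⇒ᶠ ψ)     = ifz (fm φ) (con 1) (fm ψ)
fm (¬ᶠ φ)       = ifz (fm φ) (con 1) (con 0)
fm (ex i φ)     = ifz (sum i (fm φ)) (con 0) (con 1)
fm (al i φ)     = ifz (sum i (ifz (fm φ) (con 1) (con 0))) (con 1) (con 0)
fm (renᶠ f g φ) = proc f g (fm φ) (λ M → eval M (fm φ)) (λ _ _ _ → refl)

data Reflect (x : ℕ) (P : Set) : Set where
  accepts : x ≡ 1 → P → Reflect x P
  rejects : x ≡ 0 → ¬ P → Reflect x P

Sum-≢0 : ∀ f m → Sum f m ≢ 0 → ∃ λ (x : Fin m) → f (toℕ x) ≢ 0
Sum-≢0 f zero    ne = contradiction refl ne
Sum-≢0 f (suc m) ne with f m ≟ 0
... | no fm≢0 = fromℕ< (n<1+n m) , λ eq → fm≢0 (trans (sym (cong f (toℕ-fromℕ< (n<1+n m)))) eq)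
... | yes fm≡0 with Sum-≢0 f m (λ eq → ne (cong₂ _+_ eq fm≡0))
...   | x , fx≢0 = inject x , λ eq → fx≢0 (trans (sym (cong f (lemma x))) eq)
  where
  inject : Fin m → Fin (suc m)
  inject x = fromℕ< (m<n⇒m<1+n (toℕ<n x))
  lemma : ∀ x → toℕ (inject x) ≡ toℕ x
  lemma x = toℕ-fromℕ< (m<n⇒m<1+n (toℕ<n x))

Sum-term : ∀ f {m} j → j < m → f j ≤ Sum f m
Sum-term f {suc m} j (s≤s j≤m) with m≤n⇒m<n∨m≡n j≤m
... | inj₁ j<m  = ≤-trans (Sum-term f j j<m) (m≤m+n _ _)
... | inj₂ refl = m≤n+m _ _

reflect-≢0 : ∀ {x P} → Reflect x P → (x ≢ 0 → P) × (P → x ≢ 0)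
reflect-≢0 (accepts refl p)  = (λ _ → p) , λ _ ()
reflect-≢0 (rejects refl ¬p) = (λ ne → contradiction refl ne) , λ p → contradiction p ¬p

reflect-Sum : ∀ {m f} {P : Fin m → Set} → (∀ x → Reflect (f (toℕ x)) (P x)) →
              Reflect (ifz-sem (Sum f m) 0 1) (∃ P)
reflect-Sum {m} {f} R with Sum f m in eq
... | zero  = rejects refl λ (x , px) → proj₂ (reflect-≢0 (R x)) px
  (n≤0⇒n≡0 (subst (f (toℕ x) ≤_) eq (Sum-term f (toℕ x) (toℕ<n x))))
... | suc _ with Sum-≢0 f m (λ p → 1+n≢0 (trans (sym eq) p))
...   | x , ne = accepts refl (x , proj₁ (reflect-≢0 (R x)) ne)

reflect-¬ : ∀ {x P} → Reflect x P → Reflect (ifz-sem x 1 0) (¬ P)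
reflect-¬ (accepts refl p)  = rejects refl λ ¬p → ¬p p
reflect-¬ (rejects refl ¬p) = accepts refl ¬p

reflect-map : ∀ {x P Q} → (P → Q) → (Q → P) → Reflect x P → Reflect x Q
reflect-map f g (accepts e p)  = accepts e (f p)
reflect-map f g (rejects e ¬p) = rejects e λ q → ¬p (g q)

reflect-dec : ∀ {x P} → Reflect x P → Dec P
reflect-dec (accepts _ p)  = yes p
reflect-dec (rejects _ ¬p) = no ¬p

fm-reflects : ∀ {s v M} (φ : Fm s v) σ ρ → Reflect (eval M (fm φ) σ ρ) (Sem M φ σ ρ)
fm-reflects {M = M} (nz e) σ ρ with eval M e σ ρ
... | zero  = rejects refl (λ ne → ne refl)
... | suc _ = accepts refl (λ ())
fm-reflects {M = M} (a ≐ b) σ ρ with eval M a σ ρ ≟ eval M b σ ρ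
... | yes eq = accepts (cong (λ x → ifz-sem x 1 0) (cong₂ _+_ (m≤n⇒m∸n≡0 (≤-reflexive eq)) (m≤n⇒m∸n≡0 (≤-reflexive (sym eq))))) eq
... | no neq = rejects (nonzero _ λ eq → neq (≤-antisym (m∸n≡0⇒m≤n (m+n≡0⇒m≡0 _ eq)) (m∸n≡0⇒m≤n (m+n≡0⇒n≡0 (eval M a σ ρ ∸ eval M b σ ρ) eq)))) neq
  where
  nonzero : ∀ x → x ≢ 0 → ifz-sem x 1 0 ≡ 0
  nonzero zero    ne = contradiction refl ne
  nonzero (suc x) ne = refl
fm-reflects {M = M} (a ≼ b) σ ρ with eval M a σ ρ ∸ eval M b σ ρ in eq
... | zero  = accepts refl (m∸n≡0⇒m≤n eq)
... | suc _ = rejects refl λ le → 1+n≢0 (trans (sym eq) (m≤n⇒m∸n≡0 le))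
fm-reflects {M = M} (φ ∧ᶠ ψ) σ ρ with eval M (fm φ) σ ρ | fm-reflects {M = M} φ σ ρ
... | _ | rejects refl ¬p = rejects refl λ pq → ¬p (proj₁ pq)
... | _ | accepts refl p  = reflect-map (p ,_) proj₂ (fm-reflects ψ σ ρ)
fm-reflects {M = M} (φ ∨ᶠ ψ) σ ρ with eval M (fm φ) σ ρ | fm-reflects {M = M} φ σ ρ
... | _ | rejects refl ¬p = reflect-map inj₂ [ (λ p → contradiction p ¬p) , (λ q → q) ]′ (fm-reflects ψ σ ρ)
... | _ | accepts refl p  = accepts refl (inj₁ p)
fm-reflects {M = M} (φ ⇒ᶠ ψ) σ ρ with eval M (fm φ) σ ρ | fm-reflects {M = M} φ σ ρ
... | _ | rejects refl ¬p = accepts refl λ p → contradiction p ¬p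
... | _ | accepts refl p  = reflect-map (λ q _ → q) (λ f → f p) (fm-reflects ψ σ ρ)
fm-reflects (¬ᶠ φ) σ ρ = reflect-¬ (fm-reflects φ σ ρ)
fm-reflects (ex i φ) σ ρ = reflect-Sum λ x → fm-reflects φ (toℕ x ∷ σ) ρ
fm-reflects {M = M} (al i φ) σ ρ with reflect-Sum {lookup σ i} {λ j → ifz-sem (eval M (fm φ) (j ∷ σ) ρ) 1 0} (λ x → reflect-¬ (fm-reflects φ (toℕ x ∷ σ) ρ))
... | R with Sum (λ j → ifz-sem (eval M (fm φ) (j ∷ σ) ρ) 1 0) (lookup σ i) | R
...   | zero  | accepts () _
...   | zero  | rejects _ ¬∃ = accepts refl λ x → stable x (reflect-dec (fm-reflects {M = M} φ (toℕ x ∷ σ) ρ))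
  where
  stable : ∀ x → Dec (Sem M φ (toℕ x ∷ σ) ρ) → Sem M φ (toℕ x ∷ σ) ρ
  stable x (yes p) = p
  stable x (no ¬p) = contradiction (x , ¬p) ¬∃
...   | suc _ | accepts _ (x , ¬p) = rejects refl λ f → ¬p (f x)
fm-reflects (renᶠ f g φ) σ ρ = fm-reflects φ _ _

-- Tables of bits

-- Finite tables of bits, coded as numbers with the oldest entry as the most
-- significant bit: since addition has unit cost, such a number serves as an
-- array.  The entry j of a table of length m is read off by shifting left j
-- times modulo 2^m.

p2 : ℕ → ℕ
p2 = rec 1 (λ _ a → a + a)

p2E : ∀ {s v} → Fin s → Exp s v
p2E i = proc (i ∷ []) [] (fold 0F (con 1) (val 0F ⊕ val 0F)) (λ _ σ _ → p2 (lookup σ 0F)) λ { _ (_ ∷ []) [] → refl }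

shift : ℕ → ℕ → ℕ
shift P a = ifz-sem (P ∸ (a + a)) ((a + a) ∸ P) (a + a)

opaque
  rd : ℕ → ℕ → ℕ → ℕ
  rd m A j = let r = rec A (λ i a → ifz-sem (j ∸ i) a (shift (p2 m) a)) m in ifz-sem (p2 m ∸ (r + r)) 1 0

rdE : Exp 1 2
rdE = letv (p2E 0F) (letv
  (fold 0F (val 1F) (ifz (val 3F ⊖ sz 0F) (val 0F)
    (ifz (val 1F ⊖ (val 0F ⊕ val 0F)) ((val 0F ⊕ val 0F) ⊖ val 1F) (val 0F ⊕ val 0F))))
  (ifz (val 1F ⊖ (val 0F ⊕ val 0F)) (con 1) (con 0)))

opaque
  unfolding rd
  rdE-spec : ∀ M σ ρ → eval M rdE σ ρ ≡ rd (lookup σ 0F) (lookup ρ 0F) (lookup ρ 1F)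
  rdE-spec M (m ∷ []) (A ∷ j ∷ []) = refl

rdᵉ : ∀ {s v} → Fin s → Exp s v → Exp s v → Exp s v
rdᵉ m A j = letv A (letv (wkv j) (proc (m ∷ []) (1F ∷ 0F ∷ []) rdE (λ _ σ ρ → rd (lookup σ 0F) (lookup ρ 0F) (lookup ρ 1F)) rdE-spec))

Rd : ℕ → ℕ → ℕ → Set
Rd m A j = rd m A j ≢ 0

rdᶠ : ∀ {s v} → Fin s → Exp s v → Exp s v → Fm s v
rdᶠ m A j = nz (rdᵉ m A j)

-- The step function receives the code of the entries so far. This allows course-of-values
-- recursion: the core, the balls and the trees are all computed as such tables.
tab : (ℕ → ℕ → ℕ) → ℕ → ℕ
tab f = rec 0 (λ i a → a + a + f i a)

tabE : ∀ {s v} → Fin s → Exp (suc s) (suc v) → Exp s v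
tabE i b = fold i (con 0) (val 0F ⊕ val 0F ⊕ b)

p2-+ : ∀ i l → p2 (i + l) ≡ p2 i * p2 l
p2-+ zero    l = sym (+-identityʳ _)
p2-+ (suc i) l = trans (cong₂ _+_ (p2-+ i l) (p2-+ i l)) (sym (*-distribʳ-+ (p2 l) (p2 i) (p2 i)))

p2>0 : ∀ i → 0 < p2 i
p2>0 zero    = s≤s z≤n
p2>0 (suc i) = ≤-trans (p2>0 i) (m≤m+n _ _)

p2-mono : ∀ {i j} → i ≤ j → p2 i ≤ p2 j
p2-mono {i} {j} i≤j with m≤n⇒∃[o]m+o≡n i≤j
... | l , refl = ≤-trans (≤-trans (≤-reflexive (sym (*-identityʳ (p2 i)))) (*-monoʳ-≤ (p2 i) (p2>0 l))) (≤-reflexive (sym (p2-+ i l)))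

n≤p2 : ∀ n → n ≤ p2 n
n≤p2 zero    = z≤n
n≤p2 (suc n) = +-mono-≤ (p2>0 n) (n≤p2 n)

module _ (f : ℕ → ℕ → ℕ) (f≤1 : ∀ i a → f i a ≤ 1) where
  private
    b : ℕ → ℕ
    b j = f j (tab f j)

    -- The number coded by the l entries from j on. Writing a table extends it at the back, reading
    -- consumes it from the front; this form supports both.
    suffix : ℕ → ℕ → ℕ
    suffix j zero    = 0
    suffix j (suc l) = b j * p2 l + suffix (suc j) l

    suffix-snoc : ∀ j l → suffix j (suc l) ≡ suffix j l + suffix j l + b (j + l)
    suffix-snoc j zero = trans (+-identityʳ _) (trans (*-identityʳ _) (cong b (sym (+-identityʳ j))))
    suffix-snoc j (suc l) = trans (cong (b j * p2 (suc l) +_) (suffix-snoc (suc j) l))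
      (trans (cong (λ x → b j * (p2 l + p2 l) + (suffix (suc j) l + suffix (suc j) l + b x)) (sym (+-suc j l)))
      (solve 4 (λ x p s y → x :* (p :+ p) :+ (s :+ s :+ y) := x :* p :+ s :+ (x :* p :+ s) :+ y) refl
        (b j) (p2 l) (suffix (suc j) l) (b (j + suc l))))
      where open +-*-Solver

    tab-suffix : ∀ m → tab f m ≡ suffix 0 m
    tab-suffix zero    = refl
    tab-suffix (suc m) = trans (cong₂ (λ x y → x + y + b m) (tab-suffix m) (tab-suffix m)) (sym (suffix-snoc 0 m))

    suffix< : ∀ j l → suffix j l < p2 l
    suffix< j zero    = s≤s z≤n
    suffix< j (suc l) = ≤-trans (≤-reflexive (sym (+-suc _ _)))
      (+-mono-≤ (≤-trans (*-monoˡ-≤ (p2 l) (f≤1 j _)) (≤-reflexive (+-identityʳ _))) (suffix< (suc j) l))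

    -- Here c is the leading bit of x: comparison with `P` detects it, and subtraction of `P`
    -- removes it.
    split : ∀ {P x y} c → c ≤ 1 → y < P → x ≡ c * P + y → ifz-sem (P ∸ x) 1 0 ≡ c × ifz-sem (P ∸ x) (x ∸ P) x ≡ y
    split {P} {x} {y} zero c≤1 y<P refl with P ∸ y in eq
    ... | zero  = contradiction (m∸n≡0⇒m≤n eq) (<⇒≱ y<P)
    ... | suc _ = refl , refl
    split {P} {x} {y} (suc zero) c≤1 y<P refl
      rewrite +-identityʳ P | m≤n⇒m∸n≡0 (m≤m+n P y) = refl , m+n∸m≡n P y
    split (suc (suc _)) (s≤s ()) y<P eq

    doubled : ∀ i l → let x = suffix i (suc l) * p2 i in x + x ≡ b i * p2 (i + suc l) + suffix (suc i) l * p2 (suc i)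
    doubled i l = trans (solve 4 (λ c p s q → (c :* p :+ s) :* q :+ (c :* p :+ s) :* q := c :* (q :* (p :+ p)) :+ s :* (q :+ q)) refl
        (b i) (p2 l) (suffix (suc i) l) (p2 i))
      (cong (λ z → b i * z + suffix (suc i) l * p2 (suc i)) (sym (p2-+ i (suc l))))
      where open +-*-Solver

    rest< : ∀ i l → suffix (suc i) l * p2 (suc i) < p2 (i + suc l)
    rest< i l = subst (λ z → suffix (suc i) l * p2 (suc i) < z)
      (trans (*-comm (p2 l) (p2 (suc i))) (trans (sym (p2-+ (suc i) l)) (cong p2 (sym (+-suc i l)))))
      (*-monoˡ-< (p2 (suc i)) {{>-nonZero (p2>0 (suc i))}} (suffix< (suc i) l))

    module _ (j m : ℕ) where
      step : ℕ → ℕ → ℕ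
      step i a = ifz-sem (j ∸ i) a (shift (p2 m) a)

      before : ∀ i → i ≤ j → ∀ l → i + l ≡ m → rec (tab f m) step i ≡ suffix i l * p2 i
      before zero    _   l refl = trans (tab-suffix l) (sym (*-identityʳ _))
      before (suc i) i<j l refl rewrite before i (<⇒≤ i<j) (suc l) (+-suc i l) with j ∸ i in eq
      ... | zero  = contradiction (m∸n≡0⇒m≤n eq) (<⇒≱ i<j)
      ... | suc _ = proj₂ (split (b i) (f≤1 i _) (subst (λ z → suffix (suc i) l * p2 (suc i) < p2 z) (+-suc i l) (rest< i l))
                     (trans (doubled i l) (cong (λ z → b i * p2 z + suffix (suc i) l * p2 (suc i)) (+-suc i l))))

      -- A loop must be bounded by a size, here the length m, whereas the index j is only a value;
      -- so the rounds from the j-th on leave the number alone.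
      after : ∀ c → rec (tab f m) step (j + c) ≡ rec (tab f m) step j
      after zero    = cong (rec _ step) (+-identityʳ j)
      after (suc c) rewrite +-suc j c | m≤n⇒m∸n≡0 (m≤m+n j c) = after c

  opaque
    unfolding rd
    rd-tab : ∀ {m} j → j < m → rd m (tab f m) j ≡ f j (tab f j)
    rd-tab {m} j j<m with m≤n⇒∃[o]m+o≡n j<m
    ... | l , refl = proj₁ (split (b j) (f≤1 j _) (rest< j l ▸ +-suc j l)
      (trans (cong (λ x → x + x) (trans (cong (rec (tab f m) (step j m)) (sym (+-suc j l))) (trans (after j m (suc l)) (before j m j ≤-refl (suc l) (+-suc j l)))))
        (trans (doubled j l) (cong (λ z → b j * p2 z + suffix (suc j) l * p2 (suc j)) (+-suc j l)))))
      where
      _▸_ : ∀ {x y} → suffix (suc j) l * p2 (suc j) < p2 x → x ≡ y → suffix (suc j) l * p2 (suc j) < p2 y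
      lt ▸ refl = lt

  tab< : ∀ m → tab f m < p2 m
  tab< m = subst (_< p2 m) (sym (tab-suffix m)) (suffix< 0 m)

-- Makes `ex` over the size `p2 m` a quantifier over all subsets of m positions.
guess : ∀ m (b : ℕ → Bool) → ∃ λ (G : Fin (p2 m)) → ∀ j → j < m → rd m (toℕ G) j ≡ bit (b j)
guess m b = fromℕ< lt , λ j j<m → trans (cong (λ x → rd m x j) (toℕ-fromℕ< lt)) (rd-tab (λ i _ → bit (b i)) ≤1 j j<m)
  where
  ≤1 : ∀ i (a : ℕ) → bit (b i) ≤ 1
  ≤1 i a with b i
  ... | true  = ≤-refl
  ... | false = z≤n
  lt = tab< (λ i _ → bit (b i)) ≤1 m

*+-mono-< : ∀ k {r r′ l} l′ → l < k → r < r′ → r * k + l < r′ * k + l′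
*+-mono-< k {r} {r′} {l} l′ l<k r<r′ = ≤-trans (+-monoʳ-< (r * k) l<k)
  (≤-trans (≤-reflexive (+-comm (r * k) k)) (≤-trans (*-monoˡ-≤ k r<r′) (m≤m+n (r′ * k) l′)))

*+-injective : ∀ k {r r′ l l′} → l < k → l′ < k → r * k + l ≡ r′ * k + l′ → r ≡ r′ × l ≡ l′
*+-injective k {r} {r′} {l} {l′} l<k l′<k eq with <-cmp r r′
... | tri< r<r′ _ _ = contradiction eq (<⇒≢ (*+-mono-< k l′ l<k r<r′))
... | tri≈ _ refl _ = refl , +-cancelˡ-≡ (r * k) l l′ eq
... | tri> _ _ r>r′ = contradiction (sym eq) (<⇒≢ (*+-mono-< k l l′<k r>r′))

-- Composition of computable functions

-- Computable functions are composed by running the programs in disjoint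
-- residue classes modulo 4 of the registers and of the memory.  Class 0 is for
-- the composed program itself.

emb : Fin 4 → ℕ → ℕ
emb c i = toℕ c + ((i + i) + (i + i))

emb-injective : ∀ c c′ i j → emb c i ≡ emb c′ j → c ≡ c′ × i ≡ j
emb-injective c c′ i j eq = let q , r = *+-injective 4 (toℕ<n c) (toℕ<n c′) (trans (sym (lemma c i)) (trans eq (lemma c′ j))) in toℕ-injective r , q
  where
  lemma : ∀ c i → emb c i ≡ i * 4 + toℕ c
  lemma c i = solve 2 (λ c i → c :+ ((i :+ i) :+ (i :+ i)) := i :* con 4 :+ c) refl (toℕ c) i
    where open +-*-Solver

-- Registers 0 and 4 belong to class 0 and serve as scratch. Two doublings and the addition of c
-- turn a pointer of the relocated program into an address of its own class.
address : Fin 4 → ℕ → Program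
address c i = instr (add 0 (emb c i) (emb c i)) ⨾ instr (add 0 0 0) ⨾ instr (const 4 (toℕ c)) ⨾ instr (add 0 4 0)

relocate : Fin 4 → Program → Program
relocate c (instr (const i x))       = instr (const (emb c i) x)
relocate c (instr (add i j k))       = instr (add (emb c i) (emb c j) (emb c k))
relocate c (instr (sub i j k))       = instr (sub (emb c i) (emb c j) (emb c k))
relocate c (instr (load i j))        = address c j ⨾ instr (load (emb c i) 0)
relocate c (instr (store i j))       = address c i ⨾ instr (store 0 (emb c j))
relocate c (p ⨾ q)                   = relocate c p ⨾ relocate c q
relocate c (ifnz i then p else q)    = ifnz emb c i then relocate c p else relocate c q
relocate c (whilenz i loop p)        = whilenz emb c i loop relocate c p

module Composition where

  record Sim (c : Fin 4) (s S : State) : Set where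
    constructor sim
    field
      regs : ∀ i → reg S (emb c i) ≡ reg s i
      mems : ∀ i → mem S (emb c i) ≡ mem s i

  open Sim

  record Frame (c : Fin 4) (S S′ : State) : Set where
    constructor frames
    field
      regs : ∀ i → i ≢ 0 → i ≢ 4 → (∀ j → i ≢ emb c j) → reg S′ i ≡ reg S i
      mems : ∀ i → (∀ j → i ≢ emb c j) → mem S′ i ≡ mem S i

  frame-trans : ∀ {c S S′ S″} → Frame c S S′ → Frame c S′ S″ → Frame c S S″
  frame-trans F G = frames (λ i a b n → trans (Frame.regs G i a b n) (Frame.regs F i a b n))
                           (λ i n → trans (Frame.mems G i n) (Frame.mems F i n))

  Relocated : Fin 4 → Program → State → State → Set
  Relocated c p S s′ = ∃₂ λ t S′ → ⟨ relocate c p , S ⟩⇓[ t ] S′ × Sim c s′ S′ × Frame c S S′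

  ↦-cong : ∀ {c g G x y} → x ≡ y → (∀ i → G (emb c i) ≡ g i) → ∀ i j → (G [ emb c i ↦ x ]) (emb c j) ≡ (g [ i ↦ y ]) j
  ↦-cong {c} {g} {G} {x} refl eq i j with i ≟ j
  ... | yes refl = trans (↦-same G (emb c i) x) (sym (↦-same g i x))
  ... | no i≢j   = trans (↦-other G (emb c i) x (emb c j) (λ p → i≢j (proj₂ (emb-injective c c i j p)))) (trans (eq j) (sym (↦-other g i x j i≢j)))

  module _ {c : Fin 4} (c≢0 : c ≢ 0F) where

    private
      reg0 : ∀ j → 0 ≢ emb c j
      reg0 j eq = c≢0 (sym (proj₁ (emb-injective 0F c 0 j eq)))
      reg4 : ∀ j → 4 ≢ emb c j
      reg4 j eq = c≢0 (sym (proj₁ (emb-injective 0F c 1 j eq)))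

    reg-update : ∀ i {s S x y} → Sim c s S → x ≡ y →
                 Sim c (state (reg s [ i ↦ y ]) (mem s)) (state (reg S [ emb c i ↦ x ]) (mem S)) ×
                 Frame c S (state (reg S [ emb c i ↦ x ]) (mem S))
    reg-update i {s} {S} {x} R eq = sim (↦-cong {c} {reg s} {reg S} eq (regs R) i) (mems R) ,
      frames (λ j _ _ n → ↦-other (reg S) (emb c i) x j (λ p → n i (sym p))) (λ _ _ → refl)

    Addressed : State → ℕ → Set
    Addressed S x = ∃₂ λ t S′ → ⟨ address c x , S ⟩⇓[ t ] S′ × reg S′ 0 ≡ emb c (reg S (emb c x)) × mem S′ ≡ mem S ×
                    (∀ i → i ≢ 0 → i ≢ 4 → reg S′ i ≡ reg S i)

    address-runs : ∀ S x → Addressed S x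
    address-runs (state r m) x = _ , _ , instr ⨾ instr ⨾ instr ⨾ instr , refl , refl , same
      where
      r₁ = r [ 0 ↦ r (emb c x) + r (emb c x) ]
      r₂ = r₁ [ 0 ↦ r₁ 0 + r₁ 0 ]
      r₃ = r₂ [ 4 ↦ toℕ c ]
      same : ∀ i → i ≢ 0 → i ≢ 4 → (r₃ [ 0 ↦ r₃ 4 + r₃ 0 ]) i ≡ r i
      same i i≢0 i≢4 = trans (↦-other r₃ 0 _ i (λ p → i≢0 (sym p))) (trans (↦-other r₂ 4 _ i (λ p → i≢4 (sym p)))
        (trans (↦-other r₁ 0 _ i (λ p → i≢0 (sym p))) (↦-other r 0 _ i (λ p → i≢0 (sym p)))))

    addressed-sim : ∀ {s S S′} → Sim c s S → mem S′ ≡ mem S → (∀ i → i ≢ 0 → i ≢ 4 → reg S′ i ≡ reg S i) → Sim c s S′ × Frame c S S′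
    addressed-sim R em er =
      sim (λ i → trans (er _ (λ p → reg0 i (sym p)) (λ p → reg4 i (sym p))) (regs R i)) (λ i → trans (cong (λ m → m (emb c i)) em) (mems R i)) ,
      frames (λ i a b _ → er i a b) (λ i _ → cong (λ m → m i) em)

    relocate-runs : ∀ {p s t s′ S} → ⟨ p , s ⟩⇓[ t ] s′ → Sim c s S → Relocated c p S s′
    relocate-runs (instr {const i x}) R = _ , _ , instr , reg-update i R refl
    relocate-runs (instr {add i j k}) R = _ , _ , instr , reg-update i R (cong₂ _+_ (regs R j) (regs R k))
    relocate-runs (instr {sub i j k}) R = _ , _ , instr , reg-update i R (cong₂ _∸_ (regs R j) (regs R k))
    relocate-runs {s = s} {S = S} (instr {load i j}) R with address-runs S j
    ... | t , S′ , run , e0 , em , er with addressed-sim R em er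
    ...   | R′ , F = _ , _ , run ⨾ instr , proj₁ U , frame-trans F (proj₂ U)
      where U = reg-update i R′ (trans (cong (mem S′) (trans e0 (cong (emb c) (regs R j)))) (mems R′ _))
    relocate-runs {s = s} {S = S} (instr {store i j}) R with address-runs S i
    ... | t , S′ , run , e0 , em , er with addressed-sim R em er
    ...   | R′ , F = _ , _ , run ⨾ instr ,
      sim (regs R′) (λ k → trans (cong (λ a → (mem S′ [ a ↦ reg S′ (emb c j) ]) (emb c k)) e1) (↦-cong {c} {mem s} {mem S′} (regs R′ j) (mems R′) (reg s i) k)) ,
      frame-trans F (frames (λ _ _ _ _ → refl) (λ k n → ↦-other (mem S′) _ _ k (λ p → n (reg s i) (trans (sym p) e1))))
      where
      e1 : reg S′ 0 ≡ emb c (reg s i)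
      e1 = trans e0 (cong (emb c) (regs R i))
    relocate-runs (d ⨾ e) R with relocate-runs d R
    ... | _ , _ , d′ , R′ , F with relocate-runs e R′
    ...   | _ , _ , e′ , R″ , G = _ , _ , d′ ⨾ e′ , R″ , frame-trans F G
    relocate-runs (if-nz {i} ne d) R with relocate-runs d R
    ... | _ , _ , d′ , R′ , F = _ , _ , if-nz (λ p → ne (trans (sym (regs R i)) p)) d′ , R′ , F
    relocate-runs (if-z {i} e d) R with relocate-runs d R
    ... | _ , _ , d′ , R′ , F = _ , _ , if-z (trans (regs R i) e) d′ , R′ , F
    relocate-runs (loop {i} ne d e) R with relocate-runs d R
    ... | _ , _ , d′ , R′ , F with relocate-runs e R′
    ...   | _ , _ , e′ , R″ , G = _ , _ , loop (λ p → ne (trans (sym (regs R i)) p)) d′ e′ , R″ , frame-trans F G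
    relocate-runs (exit {i} e) R = _ , _ , exit (trans (regs R i) e) , R , frames (λ _ _ _ _ → refl) (λ _ _ → refl)

  -- Programs are specified from a state that is 0 apart from the input, so a class may host a
  -- program only if nothing has touched it before.
  Clean : Fin 4 → State → Set
  Clean c S = Sim c (initial []) S

  clean-frame : ∀ {c c′ S S′} → c ≢ 0F → c ≢ c′ → Frame c′ S S′ → Clean c S → Clean c S′
  clean-frame {c} {c′} c≢0 c≢c′ F C = sim
    (λ i → trans (Frame.regs F (emb c i) (λ p → c≢0 (proj₁ (emb-injective c 0F i 0 p)))
       (λ p → c≢0 (proj₁ (emb-injective c 0F i 1 p))) (λ j p → c≢c′ (proj₁ (emb-injective c c′ i j p)))) (regs C i))
    (λ i → trans (Frame.mems F (emb c i) (λ j p → c≢c′ (proj₁ (emb-injective c c′ i j p)))) (mems C i))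

  put : Fin 4 → ℕ → ℕ → Program
  put c a i = instr (const 4 (emb c a)) ⨾ instr (store 4 i)

  putState : Fin 4 → ℕ → ℕ → State → State
  putState c a x (state r m) = state (r [ 4 ↦ emb c a ]) (m [ emb c a ↦ x ])

  put-runs : ∀ c a i {S} → i ≢ 4 → ⟨ put c a i , S ⟩⇓[ 2 ] putState c a (reg S i) S
  put-runs c a i {state r m} i≢4 = subst (λ x → ⟨ put c a i , state r m ⟩⇓[ 2 ] state (r [ 4 ↦ emb c a ]) (m [ emb c a ↦ x ]))
    (↦-other r 4 (emb c a) i (λ p → i≢4 (sym p))) (instr ⨾ instr)

  put-regs : ∀ {c a x S} i → i ≢ 4 → reg (putState c a x S) i ≡ reg S i
  put-regs {c} {a} {S = S} i i≢4 = ↦-other (reg S) 4 (emb c a) i (λ p → i≢4 (sym p))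

  put-clean : ∀ c c′ a {x S} → c ≢ 0F → c ≢ c′ → Clean c S → Clean c (putState c′ a x S)
  put-clean c c′ a {x} {S} c≢0 c≢c′ C = sim
    (λ i → trans (put-regs {c′} {a} {x} {S} (emb c i) (λ p → c≢0 (proj₁ (emb-injective c 0F i 1 p)))) (regs C i))
    (λ i → trans (↦-other (mem S) (emb c′ a) x (emb c i) (λ p → c≢c′ (sym (proj₁ (emb-injective c′ c a i p))))) (mems C i))

  put-input : ∀ xs a {c x S} → c ≢ 0F → Sim c (initial xs) S → (∀ i → (cell xs [ a ↦ x ]) i ≡ cell (xs ++ x ∷ []) i) →
              Sim c (initial (xs ++ x ∷ [])) (putState c a x S)
  put-input xs a {c} {x} {S} c≢0 C eq = sim
    (λ i → trans (put-regs {c} {a} {x} {S} (emb c i) (λ p → c≢0 (proj₁ (emb-injective c 0F i 1 p)))) (regs C i))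
    (λ i → trans (↦-cong {c} {cell xs} {mem S} refl (mems C) a i) (eq i))

  first-input : ∀ x i → (cell [] [ 0 ↦ x ]) i ≡ cell (x ∷ []) i
  first-input x zero    = refl
  first-input x (suc i) = refl

  second-input : ∀ x y i → (cell (x ∷ []) [ 1 ↦ y ]) i ≡ cell (x ∷ y ∷ []) i
  second-input x y zero          = refl
  second-input x y (suc zero)    = refl
  second-input x y (suc (suc i)) = refl

  call-runs : ∀ xs {c p y S} → c ≢ 0F → Computes p xs y → Sim c (initial xs) S →
              ∃₂ λ t S′ → ⟨ relocate c p , S ⟩⇓[ t ] S′ × reg S′ (emb c 0) ≡ y × Frame c S S′
  call-runs xs c≢0 (_ , _ , d , refl) R with relocate-runs c≢0 d R
  ... | _ , _ , d′ , R′ , F = _ , _ , d′ , regs R′ 0 , F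

  -- Register 8 is in class 0 but is not scratch, so the argument survives all calls and can be
  -- passed on twice.
  read-input : Program
  read-input = instr (const 0 0) ⨾ instr (load 8 0)

  read-clean : ∀ {x} c → c ≢ 0F → Clean c (exec (load 8 0) (exec (const 0 0) (initial (x ∷ []))))
  read-clean {x} c c≢0 = sim
    (λ i → trans (↦-other (reg (exec (const 0 0) (initial (x ∷ [])))) 8 x (emb c i) (λ p → c≢0 (sym (proj₁ (emb-injective 0F c 2 i p)))))
      (↦-other (λ _ → 0) 0 0 (emb c i) (λ p → c≢0 (sym (proj₁ (emb-injective 0F c 0 i p)))))) (zero-cell c c≢0)
    where
    zero-cell : ∀ c → c ≢ 0F → ∀ i → cell (x ∷ []) (emb c i) ≡ 0
    zero-cell zero    c≢0 i = contradiction refl c≢0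
    zero-cell (suc c) c≢0 i = refl

  record Called (c : Fin 4) (p : Program) (S : State) (y : ℕ) : Set where
    constructor called
    field
      {time} : ℕ
      {S′}   : State
      run    : ⟨ p , S ⟩⇓[ time ] S′
      result : reg S′ (emb c 0) ≡ y
      keeps  : ∀ i → i ≢ 0 → i ≢ 4 → (∀ j → i ≢ emb c j) → reg S′ i ≡ reg S i
      cleans : ∀ c′ → c′ ≢ 0F → c′ ≢ c → Clean c′ S → Clean c′ S′

  open Called

  cast : ∀ {c S xs ys} → xs ≡ ys → Sim c (initial xs) S → Sim c (initial ys) S
  cast refl s = s

  call₁ : ∀ c i {p x y S} → c ≢ 0F → i ≢ 4 → reg S i ≡ x → Clean c S → Computes p (x ∷ []) y →
          Called c (put c 0 i ⨾ relocate c p) S y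
  call₁ c i {p} {x} {y} {S} c≢0 i≢4 refl C P with call-runs (x ∷ []) c≢0 P (put-input [] 0 {S = S} c≢0 C (first-input x))
  ... | _ , S₁ , d , e , F = called (put-runs c 0 i i≢4 ⨾ d) e
    (λ j j≢0 j≢4 n → trans (Frame.regs F j j≢0 j≢4 n) (put-regs {c} {0} {x} {S} j j≢4))
    (λ c′ c′≢0 c′≢c C′ → clean-frame c′≢0 c′≢c F (put-clean c′ c 0 {S = S} c′≢0 c′≢c C′))

  call₂ : ∀ c i i′ {p x x′ y S} → c ≢ 0F → i ≢ 4 → i′ ≢ 4 → reg S i ≡ x → reg S i′ ≡ x′ → Clean c S → Computes p (x ∷ x′ ∷ []) y →
          Called c (put c 0 i ⨾ put c 1 i′ ⨾ relocate c p) S y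
  call₂ c i i′ {p} {x} {_} {y} {S} c≢0 i≢4 i′≢4 refl refl C P
    with call-runs (x ∷ reg S i′ ∷ []) c≢0 P (cast {xs = _ ∷ _ ∷ []} (cong (λ z → x ∷ z ∷ []) same)
           (put-input (x ∷ []) 1 {S = putState c 0 x S} c≢0 (put-input [] 0 {S = S} c≢0 C (first-input x)) (second-input x _)))
    where
    same : reg (putState c 0 x S) i′ ≡ reg S i′
    same = put-regs {c} {0} {x} {S} i′ i′≢4
  ... | _ , S₁ , d , e , F = called (put-runs c 0 i i≢4 ⨾ put-runs c 1 i′ i′≢4 ⨾ d) e
    (λ j j≢0 j≢4 n → trans (Frame.regs F j j≢0 j≢4 n) (trans (put-regs {c} {1} {reg S i′} {putState c 0 x S} j j≢4) (put-regs {c} {0} {x} {S} j j≢4)))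
    (λ c′ c′≢0 c′≢c C′ → clean-frame c′≢0 c′≢c F (put-clean c′ c 1 {S = putState c 0 x S} c′≢0 c′≢c (put-clean c′ c 0 {S = S} c′≢0 c′≢c C′)))

  record Started (x : ℕ) : Set where
    constructor started
    field
      {S₀}   : State
      run    : ⟨ read-input , initial (x ∷ []) ⟩⇓[ 2 ] S₀
      input  : reg S₀ 8 ≡ x
      cleans : ∀ c → c ≢ 0F → Clean c S₀

  starts : ∀ x → Started x
  starts x = started (instr ⨾ instr) refl read-clean

  -- The output register of class c is register c itself, which is where intermediate results are
  -- picked up.
  compose₁ : ∀ {f g} → Computable f → Computable g → Computable (λ x → g (f x))
  compose₁ {f} {g} (p , P) (q , Q) = read-input ⨾ (put 1F 0 8 ⨾ relocate 1F p) ⨾ (put 2F 0 1 ⨾ relocate 2F q) ⨾ move 0 2 , computes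
    where
    computes : ∀ x → Computes _ (x ∷ []) (g (f x))
    computes x with starts x
    ... | started d₀ e₀ C with call₁ 1F 8 (λ ()) (λ ()) e₀ (C 1F λ ()) (P x)
    ... | K₁ with call₁ 2F 1 (λ ()) (λ ()) (result K₁) (cleans K₁ 2F (λ ()) (λ ()) (C 2F λ ())) (Q (f x))
    ... | K₂ with move-runs 0 2 (λ ()) (result K₂)
    ... | R = _ , _ , d₀ ⨾ run K₁ ⨾ run K₂ ⨾ Runs.run R , Runs.result R

  compose₂ : ∀ {f g h} → Computable f → Computable g → Computable₂ h → Computable (λ x → h (f x) (g x))
  compose₂ {f} {g} {h} (p , P) (q , Q) (r , H) =
    read-input ⨾ (put 1F 0 8 ⨾ relocate 1F p) ⨾ (put 2F 0 8 ⨾ relocate 2F q) ⨾ (put 3F 0 1 ⨾ put 3F 1 2 ⨾ relocate 3F r) ⨾ move 0 3 , computes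
    where
    8-outside : ∀ {c} → c ≢ 0F → ∀ j → 8 ≢ emb c j
    8-outside {c} c≢0 j eq = c≢0 (sym (proj₁ (emb-injective 0F c 2 j eq)))
    1-outside : ∀ j → 1 ≢ emb 2F j
    1-outside j eq with () ← proj₁ (emb-injective 1F 2F 0 j eq)
    computes : ∀ x → Computes _ (x ∷ []) (h (f x) (g x))
    computes x with starts x
    ... | started d₀ e₀ C with call₁ 1F 8 (λ ()) (λ ()) e₀ (C 1F λ ()) (P x)
    ... | K₁ with call₁ 2F 8 (λ ()) (λ ()) (trans (keeps K₁ 8 (λ ()) (λ ()) (8-outside {1F} λ ())) e₀) (cleans K₁ 2F (λ ()) (λ ()) (C 2F λ ())) (Q x)
    ... | K₂ with call₂ 3F 1 2 (λ ()) (λ ()) (λ ()) (trans (keeps K₂ 1 (λ ()) (λ ()) 1-outside) (result K₁)) (result K₂)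
                    (cleans K₂ 3F (λ ()) (λ ()) (cleans K₁ 3F (λ ()) (λ ()) (C 3F λ ()))) (H (f x) (g x))
    ... | K₃ with move-runs 0 3 (λ ()) (result K₃)
    ... | R = _ , _ , d₀ ⨾ run K₁ ⨾ run K₂ ⨾ run K₃ ⨾ Runs.run R , Runs.result R

open Composition using (compose₁; compose₂)

-- Scattered sets and the bound on ladders

-- In descending order, so that the head of any sublist is its greatest element, from which the
-- ladder argument starts.
elems : ∀ {n} → Subset n → List (Fin n)
elems []            = []
elems (inside ∷ p)  = map suc (elems p) ++ zero ∷ []
elems (outside ∷ p) = map suc (elems p)

length-elems : ∀ {n} (p : Subset n) → length (elems p) ≡ ∣ p ∣
length-elems []            = refl
length-elems (inside ∷ p)  = trans (length-++ (map suc (elems p))) (trans (+-comm _ 1) (cong suc (trans (length-map suc (elems p)) (length-elems p))))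
length-elems (outside ∷ p) = trans (length-map suc (elems p)) (length-elems p)

elems-∈ : ∀ {n} (p : Subset n) → All (_∈ p) (elems p)
elems-∈ []            = []
elems-∈ (inside ∷ p)  = All.++⁺ (All.map⁺ (All.map there (elems-∈ p))) (here ∷ [])
elems-∈ (outside ∷ p) = All.map⁺ (All.map there (elems-∈ p))

∈-elems : ∀ {n} {p : Subset n} {x} → x ∈ p → x ∈ᴸ elems p
∈-elems {p = inside ∷ p}  here        = ∈-++⁺ʳ (map suc (elems p)) (here refl)
∈-elems {p = inside ∷ p}  (there x∈p) = ∈-++⁺ˡ (∈-map⁺ suc (∈-elems x∈p))
∈-elems {p = outside ∷ p} (there x∈p) = ∈-map⁺ suc (∈-elems x∈p)

Above : ∀ {n} → Rel (Fin n) _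
Above u v = toℕ v < toℕ u

elems-descending : ∀ {n} (p : Subset n) → AllPairs Above (elems p)
elems-descending []            = []
elems-descending (inside ∷ p)  = AllPairs.++⁺ (AllPairs.map⁺ (AllPairs.map s≤s (elems-descending p))) ([] ∷ [])
  (All.map⁺ (All.universal (λ _ → s≤s z≤n ∷ []) (elems p)))
elems-descending (outside ∷ p) = AllPairs.map⁺ (AllPairs.map s≤s (elems-descending p))

module _ {A : Set} where

  Constant : List A → (A → Bool) → Set
  Constant xs p = ∃ λ b → All (λ x → p x ≡ b) xs

  length-split : ∀ (p : A → Bool) xs → length (filter (λ x → p x ≟ᵇ true) xs) + length (filter (λ x → p x ≟ᵇ false) xs) ≡ length xs
  length-split p []       = refl
  length-split p (x ∷ xs) with p x
  ... | true  = cong suc (length-split p xs)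
  ... | false = trans (+-suc _ _) (cong suc (length-split p xs))

  record Halved (P : A → Set) (R : Rel A _) (ps : List (A → Bool)) (c : ℕ) : Set where
    constructor halved
    field
      list     : List A
      long     : c ≤ length list
      constant : All (Constant list) ps
      all      : All P list
      pairs    : AllPairs R list

  -- Each test splits the list in two, and a part with at least half of the elements is kept;
  -- filtering preserves properties and order.
  halve : ∀ {P R} ps c xs → 2 ^ length ps * c ≤ length xs → All P xs → AllPairs R xs → Halved P R ps c
  halve [] c xs len aP aR = halved xs (subst (_≤ length xs) (+-identityʳ c) len) [] aP aR
  halve {P} {R} (p ∷ ps) c xs len aP aR = choose (2 ^ length ps * c ≤? length (part true))
    where
    part : Bool → List A
    part b = filter (λ x → p x ≟ᵇ b) xs
    half : ∀ b → 2 ^ length ps * c ≤ length (part b) → Halved P R (p ∷ ps) c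
    half b len with halve {λ x → p x ≡ b × P x} ps c (part b) len (All.zip (All.all-filter (λ x → p x ≟ᵇ b) xs , All.filter⁺ (λ x → p x ≟ᵇ b) aP)) (AllPairs.filter⁺ (λ x → p x ≟ᵇ b) aR)
    ... | halved ys l cs aP′ prs = halved ys l ((b , All.map proj₁ aP′) ∷ cs) (All.map proj₂ aP′) prs
    choose : Dec (2 ^ length ps * c ≤ length (part true)) → Halved P R (p ∷ ps) c
    choose (yes l) = half true l
    choose (no ¬l) = half false (+-cancelˡ-≤ (length (part true)) _ _ (≤-trans (+-monoˡ-≤ _ (<⇒≤ (≰⇒> ¬l)))
      (subst (2 ^ length ps * c + 2 ^ length ps * c ≤_) (sym (length-split p xs)) (≤-trans (≤-reflexive lemma) len))))
      where
      lemma : 2 ^ length ps * c + 2 ^ length ps * c ≡ 2 * 2 ^ length ps * c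
      lemma = solve 2 (λ x c → x :* c :+ x :* c := con 2 :* x :* c) refl (2 ^ length ps) c
        where open +-*-Solver

length-product : ∀ {A B C : Set} (f : A → B → C) xs ys → length (cartesianProductWith f xs ys) ≡ length xs * length ys
length-product f []       ys = refl
length-product f (x ∷ xs) ys = trans (length-++ (map (f x) ys)) (cong₂ _+_ (length-map (f x) ys) (length-product f xs ys))

module Balls {n : ℕ} (E : Fin n → Fin n → Bool) where

  -- `E` need not be symmetric. For digraphs the balls follow arcs, while quasi-wideness speaks of
  -- the undirected graph that contains them.
  Ball : ℕ → Fin n → Fin n → Set
  Ball zero    x a = x ≡ a
  Ball (suc i) x a = Ball i x a ⊎ ∃ λ w → Ball i x w × T (E w a)

  ball? : ∀ i x a → Dec (Ball i x a)
  ball? zero    x a = x ≟ꟳ a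
  ball? (suc i) x a = ball? i x a ⊎-dec any? λ w → ball? i x w ×-dec T? (E w a)

  ball-refl : ∀ i x → Ball i x x
  ball-refl zero    x = refl
  ball-refl (suc i) x = inj₁ (ball-refl i x)

constant-T : ∀ {A : Set} {a b} {P : A → Bool} {xs} → Constant xs P → a ∈ᴸ xs → b ∈ᴸ xs → T (P a) → T (P b)
constant-T (c , aP′) a∈ b∈ t = subst T (trans (All.lookup aP′ a∈) (sym (All.lookup aP′ b∈))) t

T-does : ∀ {P : Set} (d : Dec P) → P → T (does d)
T-does (yes _) p = tt
T-does (no ¬p) p = ¬p p

does-T : ∀ {P : Set} (d : Dec P) → T (does d) → P
does-T (yes p) _ = p

snoc : ∀ {H l u w v} → Walk H l u w → RelGraph._~_ H w v → Walk H (suc l) u v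
snoc []      e = e ∷ []
snoc (f ∷ p) e = f ∷ snoc p e

module Scatter (G : Graph) (E : Vertex G → Vertex G → Bool) (E⊆ : ∀ u v → T (E u v) → Edge G u v) where

  open Balls E

  -- Either a short path from x to a avoids S, or x reaches a through a
  -- vertex s of S, in which case it also reaches whatever s reaches.

  Avoids : Subset (order G) → ℕ → Vertex G → Vertex G → Set
  Avoids S i x a = ∃₂ λ (pa : a ∈ ∁ S) (px : x ∈ ∁ S) → Dist≤ (G ─ S) i (x , px) (a , pa)

  Through : Subset (order G) → ℕ → Vertex G → Vertex G → Set
  Through S i x a = ∃₂ λ s j → s ∈ S × j ≤ i × Ball j s a × (∀ b → Ball j s b → Ball i x b)

  avoid : ∀ S i x a → a ∈ ∁ S → Ball i x a → Avoids S i x a ⊎ Through S i x a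
  avoid S zero    x a a∈ refl     = inj₁ (a∈ , a∈ , 0 , z≤n , [])
  avoid S (suc i) x a a∈ (inj₁ p) with avoid S i x a a∈ p
  ... | inj₁ (pa , px , l , l≤ , w)      = inj₁ (pa , px , l , m≤n⇒m≤1+n l≤ , w)
  ... | inj₂ (s , j , s∈ , j≤ , b , all) = inj₂ (s , j , s∈ , m≤n⇒m≤1+n j≤ , b , λ c q → inj₁ (all c q))
  avoid S (suc i) x a a∈ (inj₂ (w , p , e)) with w ∈? S
  -- The vertex s is the last one of `S` on the walk and j bounds the steps from there to a, so
  -- whatever s reaches in j steps is reached from x in time as well. Here s is the vertex just
  -- before a.
  ... | yes w∈S = inj₂ (w , 1 , w∈S , s≤s z≤n , inj₂ (w , refl , e) ,
    λ { b (inj₁ refl) → inj₁ p ; b (inj₂ (_ , refl , e′)) → inj₂ (w , p , e′) })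
  ... | no w∉S with avoid S i x w (x∉p⇒x∈∁p w∉S) p
  ...   | inj₁ (pw , px , l , l≤ , wk)     = inj₁ (a∈ , px , suc l , s≤s l≤ , snoc {w = w , pw} wk (E⊆ w a e))
  ...   | inj₂ (s , j , s∈ , j≤ , b , all) = inj₂ (s , suc j , s∈ , s≤s j≤ , inj₂ (w , b , e) ,
    λ { c (inj₁ q) → inj₁ (all c q) ; c (inj₂ (w′ , q , e′)) → inj₂ (w′ , all w′ q , e′) })

  -- A large W has a large part that is r-scattered in G − S.  It is halved until
  -- the traces on qs, the balls around S and the rows of its greatest element v
  -- no longer distinguish its elements other than v.  Some row of v contains two
  -- of them, u and u′: its centre reaches one of them through S, and then it
  -- reaches v as well, or both while avoiding S, which is impossible.

  module Ladder
    {r k N : ℕ} (R : Fin N → Vertex G → Set) (R? : ∀ x a → Dec (R x a))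
    (rows : ∀ x → (∀ a → ¬ R x a) ⊎ ∃₂ λ w i → i ≤ r × (∀ a → R x a → Ball i w a) × (∀ a → Ball i w a → R x a))
    (qs : List (Vertex G → Bool)) (W : Subset (order G))
    (ladder : ∀ v → v ∈ W → ∃ λ (y : Fin k → Fin N) → (∀ l → ¬ R (y l) v) ×
       (∀ u → u ∈ W → toℕ u < toℕ v → (∀ q → q ∈ᴸ qs → q u ≡ q v) → ∃ λ l → R (y l) u))
    {s m bound : ℕ}
    (wide : bound < ∣ W ∣ → ∃ λ S → ∣ S ∣ < s × ∃ λ A → A ⊆ W × m ≤ ∣ A ∣ × Scattered G S r A)
    (large : 2 ^ (length qs + s * suc r) * 2 ^ (k + 2) ≤ m)
    where

    contradict : ∀ {S A} → A ⊆ W → Scattered G S r A → ∀ us v →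
      All (_∈ A) (v ∷ us) → AllPairs Above (v ∷ us) →
      (∀ q → q ∈ᴸ qs → Constant (v ∷ us) q) → (∀ s j → s ∈ S → j ≤ r → Constant (v ∷ us) (λ a → does (ball? j s a))) →
      2 ^ k * 2 ≤ length us → ⊥
    contradict {S} {A} A⊆W (A⊆ , scattered) us v (v∈ ∷ us∈) (v> ∷ descending) cq cs len with ladder v (A⊆W v∈)
    ... | y , y∌v , covers with halve {P = λ u → u ∈ᴸ us} (map (λ l a → does (R? (y l) a)) (allFin k)) 2 us
                                  (subst (λ z → 2 ^ z * 2 ≤ length us) (sym (trans (length-map _ (allFin k)) (length-tabulateᴸ (λ (i : Fin k) → i)))) len)
                                  (All.tabulate (λ x → x)) descending
    ...   | halved (u ∷ u′ ∷ _) _ cl (u∈ ∷ u′∈ ∷ _) ((u>u′ ∷ _) ∷ _) = finish (covers u (A⊆W (All.lookup us∈ u∈)) (All.lookup v> u∈) λ q q∈ → agree (cq q q∈))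
      where
      agree : ∀ {q} → Constant (v ∷ us) q → q u ≡ q v
      agree (b , e ∷ es) = trans (All.lookup es u∈) (sym e)
      finish : (∃ λ l → R (y l) u) → ⊥
      finish (l , Ru) with rows (y l)
      ... | inj₁ empty = empty u Ru
      ... | inj₂ (w , i , i≤r , R⇒B , B⇒R) = both (avoid S i w u (A⊆ (All.lookup us∈ u∈)) (R⇒B u Ru)) (avoid S i w u′ (A⊆ (All.lookup us∈ u′∈)) (R⇒B u′ Ru′))
        where
        Ru′ : R (y l) u′
        Ru′ = does-T (R? (y l) u′) (constant-T (All.lookup cl (∈-map⁺ _ (∈-allFin l))) (here refl) (there (here refl)) (T-does (R? (y l) u) Ru))
        hit : ∀ {a} → a ∈ᴸ us → Through S i w a → ⊥
        hit {a} a∈ (s , j , s∈ , j≤ , b , all) = y∌v l (B⇒R v (all v (does-T (ball? j s v)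
          (constant-T (cs s j s∈ (≤-trans j≤ i≤r)) (there a∈) (here refl) (T-does (ball? j s a) b)))))
        both : Avoids S i w u ⊎ Through S i w u → Avoids S i w u′ ⊎ Through S i w u′ → ⊥
        both (inj₂ t) _        = hit u∈ t
        both (inj₁ _) (inj₂ t) = hit u′∈ t
        both (inj₁ (pu , pw , lu , lu≤ , wu)) (inj₁ (pu′ , pw′ , lu′ , lu′≤ , wu′)) with []=-irrelevant pw pw′
        ... | refl = scattered (u , pu) (u′ , pu′) (All.lookup us∈ u∈) (All.lookup us∈ u′∈) (λ e → <⇒≢ u>u′ (sym (cong toℕ e)))
                       ((w , pw) , (lu , ≤-trans lu≤ i≤r , wu) , (lu′ , ≤-trans lu′≤ i≤r , wu′))
    ...   | halved []      () _ _ _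
    ...   | halved (_ ∷ []) (s≤s ()) _ _ _

    ladder-bound : ∣ W ∣ ≤ bound
    ladder-bound = ≮⇒≥ λ big → go (wide big)
      where
      go : ¬ (∃ λ S → ∣ S ∣ < s × ∃ λ A → A ⊆ W × m ≤ ∣ A ∣ × Scattered G S r A)
      go (S , S<s , A , A⊆W , m≤A , sc) = conclude
        (halve {P = _∈ A} ps (2 ^ (k + 2)) (elems A) enough (elems-∈ A) (elems-descending A))
        where
        test : Vertex G → ℕ → Vertex G → Bool
        test s j a = does (ball? j s a)
        ps : List (Vertex G → Bool)
        ps = qs ++ cartesianProductWith test (elems S) (upTo (suc r))
        length-ps : length ps ≤ length qs + s * suc r
        length-ps = ≤-trans (≤-reflexive (trans (length-++ qs) (cong (length qs +_)
          (trans (length-product test (elems S) (upTo (suc r))) (cong₂ _*_ (length-elems S) (length-upTo (suc r)))))))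
          (+-monoʳ-≤ (length qs) (*-monoˡ-≤ (suc r) (<⇒≤ S<s)))
        enough : 2 ^ length ps * 2 ^ (k + 2) ≤ length (elems A)
        enough = ≤-trans (*-monoˡ-≤ (2 ^ (k + 2)) (^-monoʳ-≤ 2 length-ps)) (≤-trans large (≤-trans m≤A (≤-reflexive (sym (length-elems A)))))
        -- One of the two summands pays for the greatest element; the other leaves enough for k
        -- further tests to end with two elements.
        size : 2 ^ (k + 2) ≡ 2 ^ k * 2 + 2 ^ k * 2
        size = trans (^-distribˡ-+-* 2 k 2) (solve 1 (λ x → x :* con 4 := x :* con 2 :+ x :* con 2) refl (2 ^ k))
          where open +-*-Solver
        positive : 1 ≤ 2 ^ k * 2
        positive = *-mono-≤ (m^n>0 2 k) (s≤s z≤n)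
        conclude : Halved (_∈ A) Above ps (2 ^ (k + 2)) → ⊥
        conclude (halved []       long _  _  _)  = contradiction (≤-trans (m^n>0 2 (k + 2)) long) λ ()
        conclude (halved (v ∷ us) long cs aP′ prs) = contradict A⊆W sc us v aP′ prs
          (λ q q∈ → All.lookup cs (∈-++⁺ˡ q∈))
          (λ s j s∈ j≤ → All.lookup cs (∈-++⁺ʳ qs (∈-cartesianProductWith⁺ test (∈-elems s∈) (∈-upTo⁺ (s≤s j≤)))))
          (s≤s⁻¹ (≤-trans (+-monoˡ-≤ (2 ^ k * 2) positive) (subst (_≤ suc (length us)) size long)))

-- Counting, ranks and guesses

subset : ∀ {n} {P : Fin n → Set} → (∀ x → Dec (P x)) → Subset n
subset P? = tabulate (λ x → does (P? x))

∈-subset⁺ : ∀ {n} {P : Fin n → Set} (P? : ∀ x → Dec (P x)) {x} → P x → x ∈ subset P?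
∈-subset⁺ P? {x} p = lookup⇒[]= x _ (trans (lookup∘tabulate _ x) (dec-true (P? x) p))

∈-subset⁻ : ∀ {n} {P : Fin n → Set} (P? : ∀ x → Dec (P x)) {x} → x ∈ subset P? → P x
∈-subset⁻ P? {x} x∈ = does-T (P? x) (subst T (sym (trans (sym (lookup∘tabulate _ x)) ([]=⇒lookup x∈))) tt)

Sum-first : ∀ f m → Sum f (suc m) ≡ f 0 + Sum (λ j → f (suc j)) m
Sum-first f zero    = sym (+-identityʳ (f 0))
Sum-first f (suc m) = trans (cong (_+ f (suc m)) (Sum-first f m)) (+-assoc (f 0) _ _)

Sum-subset : ∀ {n f} {P : Fin n → Set} (P? : ∀ x → Dec (P x)) → (∀ x → Reflect (f (toℕ x)) (P x)) → Sum f n ≡ ∣ subset P? ∣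
Sum-subset {zero}  P? R = refl
Sum-subset {suc n} {f} P? R with P? zero | R zero | Sum-subset {n} {λ j → f (suc j)} (λ x → P? (suc x)) (λ x → R (suc x))
... | yes p | accepts e _  | ih = trans (Sum-first f n) (cong₂ _+_ e ih)
... | yes p | rejects _ ¬p | _  = contradiction p ¬p
... | no ¬p | accepts _ p  | _  = contradiction p ¬p
... | no ¬p | rejects e _  | ih = trans (Sum-first f n) (cong₂ _+_ e ih)

count-fm : ∀ {s v} M (i : Fin s) (φ : Fm (suc s) v) σ ρ {P : Fin (lookup σ i) → Set} (P? : ∀ x → Dec (P x)) →
           (∀ x → Sem M φ (toℕ x ∷ σ) ρ → P x) → (∀ x → P x → Sem M φ (toℕ x ∷ σ) ρ) →
           eval M (sum i (fm φ)) σ ρ ≡ ∣ subset P? ∣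
count-fm M i φ σ ρ P? f g = Sum-subset {lookup σ i} {λ j → eval M (fm φ) (j ∷ σ) ρ} P? λ x →
  reflect-map (f x) (g x) (fm-reflects {M = M} φ (toℕ x ∷ σ) ρ)

Sum-const : ∀ c m → Sum (λ _ → c) m ≡ c * m
Sum-const c zero    = sym (*-zeroʳ c)
Sum-const c (suc m) = trans (cong (_+ c) (Sum-const c m)) (trans (+-comm _ c) (sym (*-suc c m)))

Sum-mono-≤ : ∀ {f g} m → (∀ j → j < m → f j ≤ g j) → Sum f m ≤ Sum g m
Sum-mono-≤ zero    le = z≤n
Sum-mono-≤ (suc m) le = +-mono-≤ (Sum-mono-≤ m (λ j j<m → le j (m<n⇒m<1+n j<m))) (le m ≤-refl)

Sum-mono-< : ∀ {f g} m → (∀ j → j < m → f j ≤ g j) → ∀ j → j < m → f j < g j → Sum f m < Sum g m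
Sum-mono-< (suc m) le j j<m lt with m≤n⇒m<n∨m≡n (s≤s⁻¹ j<m)
... | inj₁ j<m′ = +-mono-<-≤ (Sum-mono-< m (λ i i<m → le i (m<n⇒m<1+n i<m)) j j<m′ lt) (le m ≤-refl)
... | inj₂ refl = +-mono-≤-< (Sum-mono-≤ m (λ i i<m → le i (m<n⇒m<1+n i<m))) lt

reflect-≤1 : ∀ {x P} → Reflect x P → x ≤ 1
reflect-≤1 (accepts refl _) = ≤-refl
reflect-≤1 (rejects refl _) = z≤n

reflect-1 : ∀ {x P} → Reflect x P → P → x ≡ 1
reflect-1 (accepts e _)  p = e
reflect-1 (rejects _ ¬p) p = contradiction p ¬p

reflect-0 : ∀ {x P} → Reflect x P → ¬ P → x ≡ 0
reflect-0 (accepts _ p) ¬p = contradiction p ¬p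
reflect-0 (rejects e _) ¬p = e

reflect-mono : ∀ {x y P Q} → Reflect x P → Reflect y Q → (P → Q) → x ≤ y
reflect-mono (rejects refl _) _ f = z≤n
reflect-mono (accepts refl p) R f = ≤-reflexive (sym (reflect-1 R (f p)))

ix : ℕ → ℕ → ℕ → ℕ
ix n x y = x * n + y

ix< : ∀ {n N x y} → x < N → y < n → ix n x y < N * n
ix< {n} {N} {x} {y} x<N y<n =
  ≤-trans (+-monoʳ-< (x * n) y<n) (≤-trans (≤-reflexive (+-comm (x * n) n)) (*-monoˡ-≤ n x<N))

-- The machine cannot multiply, so a value is multiplied by a size through repeated addition.
mulᵉ : ∀ {s v} → Fin s → Exp s v → Exp s v
mulᵉ i e = letv e (proc (i ∷ []) (0F ∷ []) (sum 0F (val 0F)) (λ _ σ ρ → lookup ρ 0F * lookup σ 0F)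
  λ { _ (n ∷ []) (x ∷ []) → Sum-const x n })

ixᵉ : ∀ {s v} → Fin s → Exp s v → Exp s v → Exp s v
ixᵉ i e e′ = mulᵉ i e ⊕ e′

_≺_ : ∀ {s v} → Exp s v → Exp s v → Fm s v
a ≺ b = (con 1 ⊕ a) ≼ b

infix 8 _≺_

-- Guesses are indexed by rank within the core instead of by vertex. Their length then depends only
-- on the size of the core and not on n.
rankF : Fm 3 2
rankF = sz 0F ≺ val 1F ∧ᶠ rdᶠ 2F (val 0F) (sz 0F)

rankE : Exp 2 2
rankE = sum 0F (fm rankF)

opaque
  rank : ℕ → ℕ → ℕ → ℕ → ℕ
  rank n m A u = eval (λ _ → 0) rankE (n ∷ m ∷ []) (A ∷ u ∷ [])

  rankE-spec : ∀ M σ ρ → eval M rankE σ ρ ≡ rank (lookup σ 0F) (lookup σ 1F) (lookup ρ 0F) (lookup ρ 1F)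
  rankE-spec M (n ∷ m ∷ []) (A ∷ u ∷ []) = refl

rankᵉ : ∀ {s v} → Fin s → Fin s → Exp s v → Exp s v → Exp s v
rankᵉ n m A u = letv A (letv (wkv u) (proc (n ∷ m ∷ []) (1F ∷ 0F ∷ []) rankE
  (λ _ σ ρ → rank (lookup σ 0F) (lookup σ 1F) (lookup ρ 0F) (lookup ρ 1F)) rankE-spec))

rank-bit : ℕ → ℕ → ℕ → ℕ → ℕ → ℕ
rank-bit n m A u j = eval (λ _ → 0) (fm rankF) (j ∷ n ∷ m ∷ []) (A ∷ u ∷ [])

rank-reflects : ∀ n m A u j → Reflect (rank-bit n m A u j) (j < u × Rd m A j)
rank-reflects n m A u j = fm-reflects {M = λ _ → 0} rankF (j ∷ n ∷ m ∷ []) (A ∷ u ∷ [])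

opaque
  unfolding rank
  rank-Sum : ∀ n m A u → rank n m A u ≡ Sum (rank-bit n m A u) n
  rank-Sum n m A u = refl

rank-mono-< : ∀ {n m A u v} → u < n → u < v → Rd m A u → rank n m A u < rank n m A v
rank-mono-< {n} {m} {A} {u} {v} u<n u<v Au = subst (_< rank n m A v) (sym (rank-Sum n m A u)) (subst (_ <_) (sym (rank-Sum n m A v)) (Sum-mono-< {rank-bit n m A u} {rank-bit n m A v} n
  (λ j _ → reflect-mono (rank-reflects n m A u j) (rank-reflects n m A v j) (λ (j<u , Aj) → <-trans j<u u<v , Aj)) u u<n
  (subst (_< rank-bit n m A v u) (sym (reflect-0 (rank-reflects n m A u u) (λ (u<u , _) → <-irrefl refl u<u)))
    (subst (0 <_) (sym (reflect-1 (rank-reflects n m A v u) (u<v , Au))) ≤-refl))))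

rank-injective : ∀ {n} m A (u v : Fin n) → Rd m A (toℕ u) → Rd m A (toℕ v) → rank n m A (toℕ u) ≡ rank n m A (toℕ v) → u ≡ v
rank-injective {n} m A u v Au Av eq with <-cmp (toℕ u) (toℕ v)
... | tri< u<v _ _ = contradiction eq (<⇒≢ (rank-mono-< {n} {m} {A} (toℕ<n u) u<v Au))
... | tri≈ _ e _   = toℕ-injective e
... | tri> _ _ v<u = contradiction (sym eq) (<⇒≢ (rank-mono-< {n} {m} {A} (toℕ<n v) v<u Av))

rd? : ∀ m A j → Dec (Rd m A j)
rd? m A j = ¬? (rd m A j ≟ 0)

below? : ∀ {n} m A u (x : Fin n) → Dec (toℕ x < u × Rd m A (toℕ x))
below? m A u x = (suc (toℕ x) ≤? u) ×-dec rd? m A (toℕ x)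

rank-card : ∀ n m A u → rank n m A u ≡ ∣ subset {n} (below? m A u) ∣
rank-card n m A u = trans (rank-Sum n m A u) (Sum-subset {n} {rank-bit n m A u} (below? m A u) (λ x → rank-reflects n m A u (toℕ x)))

-- Any relation between the entries of a set P, enumerated by rk, and Fin k is
-- coded by a table of length t k.

guess₂ : ∀ {n k t} {P : Fin n → Set} (P? : ∀ u → Dec (P u)) (rk : Fin n → ℕ) →
         (∀ u → P u → rk u < t) → (∀ u v → P u → P v → rk u ≡ rk v → u ≡ v) →
         {B : Fin n → Fin k → Set} (B? : ∀ u l → Dec (B u l)) →
         ∃ λ (G : Fin (p2 (t * k))) → ∀ u l → P u →
           (Rd (t * k) (toℕ G) (ix k (rk u) (toℕ l)) → B u l) × (B u l → Rd (t * k) (toℕ G) (ix k (rk u) (toℕ l)))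
guess₂ {n} {k} {t} {P} P? rk rk< inj {B} B? =
  G , λ u l p → (λ r → decode u l p (coded u l p r)) , λ b → encoded u l p b
  where
  Coded : ℕ → Set
  Coded j = ∃ λ u → P u × ∃ λ l → ix k (rk u) (toℕ l) ≡ j × B u l
  coded? : ∀ j → Dec (Coded j)
  coded? j = any? λ u → P? u ×-dec any? λ l → (ix k (rk u) (toℕ l) ≟ j) ×-dec B? u l
  guessed = guess (t * k) (λ j → does (coded? j))
  G = proj₁ guessed
  reads = proj₂ guessed
  index : Fin n → Fin k → ℕ
  index u l = ix k (rk u) (toℕ l)
  index< : ∀ u l → P u → index u l < t * k
  index< u l p = ix< (rk< u p) (toℕ<n l)
  bit-T : ∀ b → bit b ≢ 0 → T b
  bit-T true  _  = tt
  bit-T false ne = ne refl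
  coded : ∀ u l → P u → Rd (t * k) (toℕ G) (index u l) → Coded (index u l)
  coded u l p r = does-T (coded? (index u l)) (bit-T _ (λ e → r (trans (reads (index u l) (index< u l p)) e)))
  decode : ∀ u l → P u → Coded (index u l) → B u l
  decode u l p (u′ , p′ , l′ , eq , b) with *+-injective k (toℕ<n l′) (toℕ<n l) eq
  ... | e₁ , e₂ with inj u′ u p′ p e₁ | toℕ-injective e₂
  ... | refl | refl = b
  encoded : ∀ u l → P u → B u l → Rd (t * k) (toℕ G) (index u l)
  encoded u l p b e = contradiction (trans (sym (cong bit (dec-true (coded? (index u l)) (u , p , l , refl , b)))) (trans (sym (reads (index u l) (index< u l p))) e)) λ ()

-- The core

-- The core of W with respect to R: going through W in increasing order, v is
-- put into the core if some k rows of R jointly cover those earlier elements of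
-- the core that have the same trace on C as v, but not v itself.  Then any k
-- rows that cover the part of the core with the trace of v also cover v.
-- What k rows cover among the t earlier elements is guessed as a table of
-- length t k, so no enumeration of k-tuples of rows is needed.

sameF : Fm 4 2
sameF = al 0F (rdᶠ 1F (val 1F) (sz 0F) ⇒ᶠ
  ((rdᶠ 2F (val 0F) (ixᵉ 1F (sz 3F) (sz 0F)) ⇒ᶠ rdᶠ 2F (val 0F) (ixᵉ 1F (sz 4F) (sz 0F))) ∧ᶠ
   (rdᶠ 2F (val 0F) (ixᵉ 1F (sz 4F) (sz 0F)) ⇒ᶠ rdᶠ 2F (val 0F) (ixᵉ 1F (sz 3F) (sz 0F)))))

-- Sizes: the number of guesses, their length, v, n, N, k and the lengths of `R` and `D`; values:
-- the core so far, `R`, `W`, `D`, `C`. A row is only asked to contain what the guess assigns to its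
-- slot, so the rows are found one slot at a time.
stepF : Fm 8 5
stepF = ex 0F (
  al 4F ((sz 0F ≺ sz 4F ∧ᶠ rdᶠ 4F (val 0F) (sz 0F) ∧ᶠ renᶠ (5F ∷ 9F ∷ 0F ∷ 4F ∷ []) (3F ∷ 4F ∷ []) sameF) ⇒ᶠ
    ex 7F (rdᶠ 4F (sz 2F) (ixᵉ 8F (rankᵉ 6F 5F (val 0F) (sz 1F)) (sz 0F)))) ∧ᶠ
  al 6F (ex 6F (¬ᶠ rdᶠ 9F (val 1F) (ixᵉ 6F (sz 0F) (sz 5F)) ∧ᶠ
    al 6F ((sz 0F ≺ sz 6F ∧ᶠ rdᶠ 6F (val 0F) (sz 0F) ∧ᶠ rdᶠ 5F (sz 3F) (ixᵉ 9F (rankᵉ 7F 6F (val 0F) (sz 0F)) (sz 2F))) ⇒ᶠ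
      rdᶠ (suc 9F) (val 1F) (ixᵉ 7F (sz 1F) (sz 0F))))))

coreStep : Exp 6 5
coreStep = ifz (fm (rdᶠ 1F (val 2F) (sz 0F))) (con 0)
  (lets (mulᵉ 3F (rankᵉ 1F 0F (val 0F) (sz 0F))) (lets (p2E 0F) (fm stepF)))

coreE : Exp 5 4
coreE = tabE 0F coreStep

opaque
  coreV : (ℕ → ℕ) → Vec ℕ 5 → Vec ℕ 4 → ℕ
  coreV M = eval M coreE

  coreV-spec : ∀ M σ ρ → eval M coreE σ ρ ≡ coreV M σ ρ
  coreV-spec M σ ρ = refl

-- `R` codes N rows of n bits, each row being the set that it covers. Row u of `D`, restricted to
-- the members of `C`, is the trace of u.
module Core (M : ℕ → ℕ) (n N k lR lD R W D C : ℕ) where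

  private
    σ : Vec ℕ 5
    σ = n ∷ N ∷ k ∷ lR ∷ lD ∷ []

    ρ : Vec ℕ 4
    ρ = R ∷ W ∷ D ∷ C ∷ []

  core : ℕ
  core = coreV M σ ρ

  row : ℕ → ℕ → Set
  row x v = Rd lR R (ix n x v)

  row? : ∀ x v → Dec (row x v)
  row? x v = rd? lR R (ix n x v)

  Same : ℕ → ℕ → Set
  Same u v = ∀ (w : Fin n) → Rd n C (toℕ w) →
    (Rd lD D (ix n u (toℕ w)) → Rd lD D (ix n v (toℕ w))) × (Rd lD D (ix n v (toℕ w)) → Rd lD D (ix n u (toℕ w)))

  step : ℕ → ℕ → ℕ
  step i a = eval M coreStep (i ∷ σ) (a ∷ ρ)

  private
    length′ : ℕ → ℕ → ℕ
    length′ i a = rank n i a i * k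

    Step : ℕ → ℕ → Set
    Step i a = Sem M stepF (p2 (length′ i a) ∷ length′ i a ∷ i ∷ σ) (a ∷ ρ)

    step-reflects : ∀ i a → Reflect (step i a) (Rd n W i × Step i a)
    step-reflects i a with eval M (fm (rdᶠ 1F (val 2F) (sz 0F))) (i ∷ σ) (a ∷ ρ) | fm-reflects {M = M} (rdᶠ 1F (val 2F) (sz 0F)) (i ∷ σ) (a ∷ ρ)
    ... | _ | rejects refl ¬w = rejects refl λ (w , _) → ¬w w
    ... | _ | accepts refl w  = reflect-map (w ,_) proj₂ (fm-reflects {M = M} stepF (p2 (length′ i a) ∷ length′ i a ∷ i ∷ σ) (a ∷ ρ))

    opaque
      unfolding coreV
      core-tab : core ≡ tab step n
      core-tab = refl

    step≤1 : ∀ i a → step i a ≤ 1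
    step≤1 i a = reflect-≤1 (step-reflects i a)

    read : ∀ {v} u → u < v → rd v (tab step v) u ≡ step u (tab step u)
    read u u<v = rd-tab step step≤1 u u<v

    read-core : ∀ u → u < n → rd n core u ≡ step u (tab step u)
    read-core u u<n = trans (cong (λ A → rd n A u) core-tab) (read u u<n)

    partial⁺ : ∀ {v} (u : Fin n) → toℕ u < v → Rd n core (toℕ u) → Rd v (tab step v) (toℕ u)
    partial⁺ u u<v c = λ e → c (trans (read-core (toℕ u) (toℕ<n u)) (trans (sym (read (toℕ u) u<v)) e))

    partial⁻ : ∀ {v} (u : Fin n) → toℕ u < v → Rd v (tab step v) (toℕ u) → Rd n core (toℕ u)
    partial⁻ u u<v c = λ e → c (trans (read (toℕ u) u<v) (trans (sym (read-core (toℕ u) (toℕ<n u))) e))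

  Separated : Fin n → Set
  Separated v = ∃ λ (y : Fin k → Fin N) → (∀ l → ¬ row (toℕ (y l)) (toℕ v)) ×
    (∀ (u : Fin n) → toℕ u < toℕ v → Rd n core (toℕ u) → Same (toℕ u) (toℕ v) → ∃ λ l → row (toℕ (y l)) (toℕ u))

  private
    step⁻ : ∀ v → Step (toℕ v) (tab step (toℕ v)) → Separated v
    step⁻ v (G , covered , rows) = (λ l → proj₁ (rows l)) , (λ l → proj₁ (proj₂ (rows l))) ,
      λ u u<v cu same → let Au = partial⁺ u u<v cu ; l , b = covered u (u<v , Au , same) in l , proj₂ (proj₂ (rows l)) u (u<v , Au , b)

    step⁺ : ∀ v → Separated v → Step (toℕ v) (tab step (toℕ v))
    step⁺ v (y , y∌v , covers) = proj₁ g ,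
      (λ u (u<v , Au , same) → let l , r = covers u u<v (partial⁻ u u<v Au) same in l , proj₂ (proj₂ g u l (u<v , Au)) r) ,
      λ l → y l , y∌v l , λ u (u<v , Au , b) → proj₁ (proj₂ g u l (u<v , Au)) b
      where
      A = tab step (toℕ v)
      g = guess₂ (below? (toℕ v) A (toℕ v)) (λ u → rank n (toℕ v) A (toℕ u))
            (λ u (u<v , Au) → rank-mono-< {n} {toℕ v} {A} (toℕ<n u) u<v Au)
            (λ u u′ (_ , Au) (_ , Au′) → rank-injective (toℕ v) A u u′ Au Au′)
            (λ u l → row? (toℕ (y l)) (toℕ u))

  core⁻ : ∀ v → Rd n core (toℕ v) → Rd n W (toℕ v) × Separated v
  core⁻ v c with step-reflects (toℕ v) (tab step (toℕ v))
  ... | accepts _ (w , s) = w , step⁻ v s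
  ... | rejects e _       = contradiction (trans (read-core (toℕ v) (toℕ<n v)) e) c

  -- If the rows all missed v, they would separate v from the earlier core elements with its trace.
  -- Then v would itself be in the core, and so be covered by assumption.
  core-covers : ∀ v → Rd n W (toℕ v) → (y : Fin k → Fin N) →
    (∀ (u : Fin n) → Rd n core (toℕ u) → Same (toℕ u) (toℕ v) → ∃ λ l → row (toℕ (y l)) (toℕ u)) → ∃ λ l → row (toℕ (y l)) (toℕ v)
  core-covers v w y covers with any? (λ l → row? (toℕ (y l)) (toℕ v))
  ... | yes c = c
  ... | no ¬c with step-reflects (toℕ v) (tab step (toℕ v))
  ...   | accepts e _ = covers v (λ e′ → contradiction (trans (sym e) (trans (sym (read-core (toℕ v) (toℕ<n v))) e′)) λ ()) (λ w _ → (λ r → r) , (λ r → r))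
  ...   | rejects _ ¬s = contradiction (w , step⁺ v (y , (λ l r → ¬c (l , r)) , λ u _ → covers u)) ¬s

  earlier : ℕ → Subset n
  earlier v = subset {n} λ u → (suc (toℕ u) ≤? v) ×-dec rd? n core (toℕ u)

  private
    rank≤ : ∀ v → rank n v (tab step v) v ≤ ∣ earlier v ∣
    rank≤ v = subst (_≤ ∣ earlier v ∣) (sym (rank-card n v (tab step v) v)) (p⊆q⇒∣p∣≤∣q∣ inclusion)
      where
      inclusion : subset {n} (below? v (tab step v) v) ⊆ earlier v
      inclusion {u} u∈ with ∈-subset⁻ (below? v (tab step v) v) u∈
      ... | u<v , Au = ∈-subset⁺ (λ u → (suc (toℕ u) ≤? v) ×-dec rd? n core (toℕ u)) (u<v , partial⁻ u u<v Au)

  core-safe : ∀ {Q} → (∀ v → v ≤ n → p2 (∣ earlier v ∣ * k) ≤ Q) → Safe Q M coreE σ ρ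
  core-safe {Q} small = fold con λ v v<n → (val ⊕ val) ⊕
    let P≤ = ≤-trans (p2-mono (*-monoˡ-≤ k (rank≤ v))) (small v (<⇒≤ v<n)) in
    ifz (static-safe _ _ _ _) (λ _ → con) λ _ →
      lets (static-safe _ _ _ _) (≤-trans (n≤p2 _) P≤) (lets (static-safe _ _ _ _) P≤ (static-safe _ _ _ _))

-- The computable time bound

p2≡2^ : ∀ i → p2 i ≡ 2 ^ i
p2≡2^ zero    = refl
p2≡2^ (suc i) = trans (cong₂ _+_ (p2≡2^ i) (p2≡2^ i)) (cong (2 ^ i +_) (sym (+-identityʳ (2 ^ i))))

exp-computes : ∀ (e : Exp 0 0) xs {Q} → Safe Q (cell xs) e [] [] →
               ∃₂ λ t s → ⟨ compile e [] [] 0 , initial xs ⟩⇓[ t ] s × t ≤ cost e Q × output s ≡ eval (cell xs) e [] []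
exp-computes e xs S with compile-runs e {st = initial xs} S (bounded λ ()) (holds (λ ()) (λ ())) (holds (λ ()) (λ ())) refl
... | R = _ , _ , Runs.run R , Runs.time≤ R , Runs.result R

exp-computable₁ : ∀ (e : Exp 0 0) → (∀ x → ∃ λ Q → Safe Q (cell (x ∷ [])) e [] []) → Computable (λ x → eval (cell (x ∷ [])) e [] [])
exp-computable₁ e safe = compile e [] [] 0 , λ x → let t , s , d , _ , o = exp-computes e (x ∷ []) (proj₂ (safe x)) in t , s , d , o

exp-computable₂ : ∀ (e : Exp 0 0) → (∀ x y → ∃ λ Q → Safe Q (cell (x ∷ y ∷ [])) e [] []) → Computable₂ (λ x y → eval (cell (x ∷ y ∷ [])) e [] [])
exp-computable₂ e safe = compile e [] [] 0 , λ x y → let t , s , d , _ , o = exp-computes e (x ∷ y ∷ []) (proj₂ (safe x y)) in t , s , d , o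

id-computable : Computable (λ x → x)
id-computable = exp-computable₁ (inp (con 0)) (λ _ → 0 , inp con)

2+-computable : Computable (λ x → x + 2)
2+-computable = exp-computable₁ (inp (con 0) ⊕ con 2) (λ _ → 0 , inp con ⊕ con)

+-computable : Computable₂ _+_
+-computable = exp-computable₂ (inp (con 0) ⊕ inp (con 1)) (λ _ _ → 0 , inp con ⊕ inp con)

-- For x = s(p + 2) and y = p: at most x deleted vertices with y + 3 radii each give the first
-- summand of the exponent, and p rows with two spare factors the second.
width : ℕ → ℕ → ℕ
width x y = p2 (x * (y + 3) + (y + 2))

width-computable : Computable₂ width
width-computable = exp-computable₂ (lets (inp (con 1) ⊕ con 3) (lets (mulᵉ 0F (inp (con 0)) ⊕ (inp (con 1) ⊕ con 2)) (p2E 0F)))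
  λ x y → (y + 3) + (x * (y + 3) + (y + 2)) , lets (static-safe _ _ _ _) (m≤m+n _ _)
    (lets (static-safe _ _ _ _) (m≤n+m (x * (y + 3) + (y + 2)) (y + 3)) (static-safe _ _ _ _))

-- Each of the y possible elements of the first core is one more test and doubles the number of
-- scattered vertices needed.
widen : ℕ → ℕ → ℕ
widen x y = x * p2 y

widen-computable : Computable₂ widen
widen-computable = exp-computable₂ (lets (inp (con 1)) (lets (p2E 0F) (mulᵉ 0F (inp (con 0)))))
  λ x y → y + p2 y , lets (inp con) (m≤m+n _ _) (lets (static-safe _ _ _ _) (m≤n+m _ _) (static-safe _ _ _ _))

-- The exponents that occur are a core size times a number of slots, hence at most x * x, and the
-- number of guesses is at times multiplied by one more factor such as k + 1.
power-bound : ℕ → ℕ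
power-bound x = x * p2 (x * x)

power-bound-computable : Computable power-bound
power-bound-computable = exp-computable₁ (lets (inp (con 0)) (lets (mulᵉ 0F (inp (con 0))) (lets (p2E 0F) (mulᵉ 0F (inp (con 0))))))
  λ x → x + (x * x + p2 (x * x)) , lets (inp con) (m≤m+n x _)
    (lets (static-safe _ _ _ _) (≤-trans (m≤m+n _ _) (m≤n+m _ x)) (lets (static-safe _ _ _ _) (≤-trans (m≤n+m _ (x * x)) (m≤n+m _ x)) (static-safe _ _ _ _)))

timesE : ℕ → ℕ → Exp 1 0
timesE K zero    = con K
timesE K (suc D) = mulᵉ 0F (timesE K D)

timesE-static : ∀ K D → Static (timesE K D)
timesE-static K zero    = tt
timesE-static K (suc D) = timesE-static K D , tt , tt , tt

-- The base is x + x because `suc Q` is at most `Q + Q` once `Q` is positive, and the sum keeps the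
-- product form of the bound.
polynomial : ℕ → ℕ → ℕ → ℕ
polynomial K D x = eval (cell (x ∷ [])) (timesE K D) (x + x ∷ []) []

polynomial≡ : ∀ K D x → polynomial K D x ≡ K * (x + x) ^ D
polynomial≡ K zero    x = sym (*-identityʳ K)
polynomial≡ K (suc D) x = trans (cong (_* (x + x)) (polynomial≡ K D x))
  (solve 3 (λ k q y → k :* q :* y := k :* (y :* q)) refl K ((x + x) ^ D) (x + x))
  where open +-*-Solver

polynomial-computable : ∀ K D → Computable (polynomial K D)
polynomial-computable K D = exp-computable₁ (lets (inp (con 0) ⊕ inp (con 0)) (timesE K D))
  λ x → x + x , lets (inp con ⊕ inp con) ≤-refl (static-safe (timesE K D) (x + x ∷ []) [] (timesE-static K D))

*-^ : ∀ x y D → (x * y) ^ D ≡ x ^ D * y ^ D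
*-^ x y zero    = refl
*-^ x y (suc D) = trans (cong (x * y *_) (*-^ x y D))
  (solve 4 (λ x y a b → x :* y :* (a :* b) := x :* a :* (y :* b)) refl x y (x ^ D) (y ^ D))
  where open +-*-Solver

-- Wrapped as a record so that types are compared by their parameters, without
-- evaluating the program.

record Decides {s v} (Q : ℕ) (M : ℕ → ℕ) (e : Exp s v) (σ : Vec ℕ s) (ρ : Vec ℕ v) (P : Set) : Set where
  constructor decides
  field
    safe     : Safe Q M e σ ρ
    reflects : Reflect (eval M e σ ρ) P

decides-lets : ∀ {s v Q M P} {a : Exp s v} {b σ ρ x} → Safe Q M a σ ρ → eval M a σ ρ ≡ x → x ≤ Q →
               Decides Q M b (x ∷ σ) ρ P → Decides Q M (lets a b) σ ρ P
decides-lets S refl x≤ (decides T R) = decides (lets S x≤ T) R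

decides-letv : ∀ {s v Q M P} {a : Exp s v} {b σ ρ x} → Safe Q M a σ ρ → eval M a σ ρ ≡ x →
               Decides Q M b σ (x ∷ ρ) P → Decides Q M (letv a b) σ ρ P
decides-letv S refl (decides T R) = decides (letv S T) R

decides-proc : ∀ {s v s′ v′ Q M P} {f : Vec (Fin s) s′} {g : Vec (Fin v) v′} {e} {σ ρ} → Decides Q M e (Vec.map (lookup σ) f) (Vec.map (lookup ρ) g) P →
               Decides Q M (proc f g e (λ M → eval M e) (λ _ _ _ → refl)) σ ρ P
decides-proc (decides S R) = decides (proc S) R

decides-map : ∀ {s v Q M P P′} {e : Exp s v} {σ ρ} → (P → P′) → (P′ → P) → Decides Q M e σ ρ P → Decides Q M e σ ρ P′
decides-map f g (decides S R) = decides S (reflect-map f g R)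

exp-fpt : ∀ {ℓ} {C : GraphClass ℓ} (Π : Problem) (e : Exp 0 0) (f : ℕ → ℕ) → Computable f → (∀ p → 1 ≤ f p) → let open Problem Π in
  (∀ I → C (graph I) → Decides (f (parameter I) * (order (graph I) ⊔ 1) ^ 2) (cell (encode I)) e [] [] (Yes I)) → FPT C Π
exp-fpt Π e f f-computable 1≤f correct with cost-poly e
... | K , D , poly = compile e [] [] 0 , (λ p → polynomial K D (f p)) , 2 * D , compose₁ f-computable (polynomial-computable K D) , runs-on
  where
  open Problem Π
  runs-on : ∀ I → _ → _
  runs-on I CI with correct I CI
  ... | decides safe R with exp-computes e (encode I) safe
  ...   | t , s , d , t≤ , o = t , s , d , ≤-trans t≤ (≤-trans (poly Q) bound′) , answer R o
    where
    n = order (graph I) ⊔ 1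
    F = f (parameter I)
    Q = F * n ^ 2
    1≤Q : 1 ≤ Q
    1≤Q = *-mono-≤ (1≤f (parameter I)) (m^n>0 n {{>-nonZero (m≤n⊔m (order (graph I)) 1)}} 2)
    bound′ : K * suc Q ^ D ≤ polynomial K D F * n ^ (2 * D)
    bound′ = ≤-trans (*-monoʳ-≤ K (^-monoˡ-≤ D (+-monoˡ-≤ Q 1≤Q))) (≤-reflexive (trans (cong (K *_) (trans (cong (_^ D) (sym (*-distribʳ-+ (n ^ 2) F F)))
      (trans (*-^ (F + F) (n ^ 2) D) (cong ((F + F) ^ D *_) (^-*-assoc n 2 D)))))
      (trans (sym (*-assoc K _ _)) (cong (_* n ^ (2 * D)) (sym (polynomial≡ K D F))))))
    answer : ∀ {x} → Reflect x (Yes I) → output s ≡ x → output s ≡ 1 ⇔ Yes I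
    answer (accepts e y)  o = mk⇔ (λ _ → y) (λ _ → trans o e)
    answer (rejects e ¬y) o = mk⇔ (λ o′ → contradiction (trans (sym o′) (trans o e)) λ ()) (λ y → contradiction y ¬y)

module Resources (s : ℕ → ℕ) (b : ℕ → ℕ → ℕ) (s-computable : Computable s) (b-computable : Computable₂ b) where

  -- The index 1 refers to the core for domination, the index 2 to the core for conflicts, which is
  -- formed separately for each trace on the first. The term p + 2 + 2 makes room for k + 1, d + 1
  -- and small constants.
  width₁ core₁ width₂ core₂ total resource : ℕ → ℕ
  width₁ p = width (s (p + 2)) p
  core₁ p = b (p + 2) (width₁ p)
  width₂ p = widen (width₁ p) (core₁ p)
  core₂ p = b (p + 2) (width₂ p)
  total p = (core₁ p + core₂ p) + (p + 2 + 2)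
  resource p = power-bound (total p)

  resource-computable : Computable resource
  resource-computable = compose₁ (compose₂ (compose₂ c₁ c₂ +-computable) (compose₁ 2+-computable 2+-computable) +-computable) power-bound-computable
    where
    w₁ : Computable width₁
    w₁ = compose₂ (compose₁ 2+-computable s-computable) id-computable width-computable
    c₁ : Computable core₁
    c₁ = compose₂ 2+-computable w₁ b-computable
    c₂ : Computable core₂
    c₂ = compose₂ 2+-computable (compose₂ w₁ c₁ widen-computable) b-computable

  p≤total : ∀ p → p + 2 + 2 ≤ total p
  p≤total p = m≤n+m (p + 2 + 2) (core₁ p + core₂ p)

  core₁≤total : ∀ p → core₁ p ≤ total p
  core₁≤total p = ≤-trans (m≤m+n _ _) (m≤m+n _ _)

  core₂≤total : ∀ p → core₂ p ≤ total p
  core₂≤total p = ≤-trans (m≤n+m _ (core₁ p)) (m≤m+n _ _)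

  1≤total : ∀ p → 1 ≤ total p
  1≤total p = ≤-trans (≤-trans (s≤s z≤n) (m≤n+m 2 (p + 2))) (p≤total p)

  1≤resource : ∀ p → 1 ≤ resource p
  1≤resource p = *-mono-≤ (1≤total p) (p2>0 (total p * total p))

-- The size of the core

Wide : (G : Graph) (r s m B : ℕ) → Set
Wide G r s m B = ∀ W → B < ∣ W ∣ → ∃ λ S → ∣ S ∣ < s × ∃ λ A → A ⊆ W × m ≤ ∣ A ∣ × Scattered G S r A

members : (n A : ℕ) → Subset n
members n A = subset {n} λ w → rd? n A (toℕ w)

module _ (G : Graph) (E : Vertex G → Vertex G → Bool) (E⊆ : ∀ u v → T (E u v) → Edge G u v) where

  open Balls E
  open Scatter G E E⊆

  Rows : (r N : ℕ) → (ℕ → ℕ → Set) → Set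
  Rows r N row = ∀ (x : Fin N) → (∀ (a : Vertex G) → ¬ row (toℕ x) (toℕ a)) ⊎
    ∃₂ λ w i → i ≤ r × (∀ a → row (toℕ x) (toℕ a) → Ball i w a) × (∀ a → Ball i w a → row (toℕ x) (toℕ a))

  module _ (M : ℕ → ℕ) (N k lR lD R W D C : ℕ) where

    open Core M (order G) N k lR lD R W D C

    -- The `Separated` witness of each core element is the hypothesis of the ladder argument, and
    -- membership in the trace at each of the at most c elements of `C` is an additional test.
    core-bound : ∀ {r s m B} c → Rows r N row → ∣ members (order G) C ∣ ≤ c → Wide G r s m B →
                 2 ^ (c + s * suc r) * 2 ^ (k + 2) ≤ m → ∀ v → ∣ earlier v ∣ ≤ B
    core-bound {r} {s} {m} {B} c rows few wide large v = Ladder.ladder-bound {r} {k} {N} (λ x a → row (toℕ x) (toℕ a)) (λ x a → row? (toℕ x) (toℕ a))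
      rows qs (earlier v) ladder (wide (earlier v)) (≤-trans (*-monoˡ-≤ (2 ^ (k + 2)) (^-monoʳ-≤ 2 (+-monoˡ-≤ (s * suc r) length-qs))) large)
      where
      n = order G
      trace? : ∀ w u → Dec (Rd lD D (ix n (toℕ u) (toℕ w)))
      trace? w u = rd? lD D (ix n (toℕ u) (toℕ w))
      test : Vertex G → Vertex G → Bool
      test w u = does (trace? w u)
      qs : List (Vertex G → Bool)
      qs = map test (elems (members n C))
      length-qs : length qs ≤ c
      length-qs = ≤-trans (≤-reflexive (trans (length-map test (elems (members n C))) (length-elems (members n C)))) few
      ∈-earlier : ∀ {u} → u ∈ earlier v → toℕ u < v × Rd n core (toℕ u)
      ∈-earlier = ∈-subset⁻ (λ u → (suc (toℕ u) ≤? v) ×-dec rd? n core (toℕ u))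
      same : ∀ u x → (∀ q → q ∈ᴸ qs → q u ≡ q x) → Same (toℕ u) (toℕ x)
      same u x agree w Cw = transfer u x (agree (test w) w∈) , transfer x u (sym (agree (test w) w∈))
        where
        w∈ : test w ∈ᴸ qs
        w∈ = ∈-map⁺ test (∈-elems (∈-subset⁺ (λ w → rd? n C (toℕ w)) Cw))
        transfer : ∀ u x → test w u ≡ test w x → Rd lD D (ix n (toℕ u) (toℕ w)) → Rd lD D (ix n (toℕ x) (toℕ w))
        transfer u x e r = does-T (trace? w x) (subst T e (T-does (trace? w u) r))
      ladder : ∀ x → x ∈ earlier v → ∃ λ (y : Fin k → Fin N) → (∀ l → ¬ row (toℕ (y l)) (toℕ x)) ×
        (∀ u → u ∈ earlier v → toℕ u < toℕ x → (∀ q → q ∈ᴸ qs → q u ≡ q x) → ∃ λ l → row (toℕ (y l)) (toℕ u))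
      ladder x x∈ with core⁻ x (proj₂ (∈-earlier x∈))
      ... | _ , y , y∌x , covers = y , y∌x , λ u u∈ u<x agree → covers u u<x (proj₂ (∈-earlier u∈)) (same u x agree)

    core-size : ∀ {B} → (∀ v → ∣ earlier v ∣ ≤ B) → ∣ members (order G) core ∣ ≤ B
    core-size small = ≤-trans (p⊆q⇒∣p∣≤∣q∣ λ {u} u∈ → ∈-subset⁺ (λ u → (suc (toℕ u) ≤? order G) ×-dec rd? (order G) core (toℕ u))
      (toℕ<n u , ∈-subset⁻ (λ w → rd? (order G) core (toℕ w)) u∈)) (small (order G))

-- Relations as tables

-- Tables defined by formulas; the formula may refer to the earlier entries.

tableᵉ : ∀ {s v} → Fin s → Fm (suc s) (suc v) → Exp s v
tableᵉ m φ = tabE m (fm φ)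

module _ {s v} (M : ℕ → ℕ) (m : Fin s) (φ : Fm (suc s) (suc v)) (σ : Vec ℕ s) (ρ : Vec ℕ v) where

  private
    entry : ℕ → ℕ → ℕ
    entry i a = eval M (fm φ) (i ∷ σ) (a ∷ ρ)

  upto : ℕ → ℕ
  upto = tab entry

  table-reflects : ∀ {l} j → j < l → Reflect (rd l (upto l) j) (Sem M φ (j ∷ σ) (upto j ∷ ρ))
  table-reflects {l} j j<l = subst (λ x → Reflect x (Sem M φ (j ∷ σ) (upto j ∷ ρ)))
    (sym (rd-tab entry (λ i a → reflect-≤1 (fm-reflects {M = M} φ (i ∷ σ) (a ∷ ρ))) j j<l)) (fm-reflects {M = M} φ (j ∷ σ) (upto j ∷ ρ))

  table⁻ : ∀ {l} j → j < l → Rd l (upto l) j → Sem M φ (j ∷ σ) (upto j ∷ ρ)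
  table⁻ j j<l = proj₁ (reflect-≢0 (table-reflects j j<l))

  table⁺ : ∀ {l} j → j < l → Sem M φ (j ∷ σ) (upto j ∷ ρ) → Rd l (upto l) j
  table⁺ j j<l = proj₂ (reflect-≢0 (table-reflects j j<l))

  table-earlier : ∀ {l l′} j → j < l → j < l′ → Rd l (upto l) j → Rd l′ (upto l′) j
  table-earlier j j<l j<l′ r = table⁺ j j<l′ (table⁻ j j<l r)

-- A binary relation on the vertices, given by a formula on (v , w), as a table
-- whose rows are indexed by w; rows that are not vertices are empty.

relF : ∀ {s v} → Fin s → Fm (3 + s) v → Fm (suc s) v
relF n ψ = ex (suc n) (ex (suc (suc n)) (sz 2F ≐ ixᵉ (suc (suc (suc n))) (sz 1F) (sz 0F) ∧ᶠ ψ))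

relᵉ : ∀ {s v} → Fin s → Fin s → Fm (3 + s) (suc v) → Exp s v
relᵉ n l ψ = tableᵉ l (relF n ψ)

table-static : ∀ {s v} {m : Fin s} {φ : Fm (suc s) (suc v)} → Static (fm φ) → Static (tableᵉ m φ)
table-static sφ = tt , (tt , tt) , sφ

relF-static : ∀ {s v} {n : Fin s} {ψ : Fm (3 + s) v} → Static (fm ψ) → Static (fm (relF n ψ))
relF-static sψ = (tt , tt , (tt , tt , _ , tt , sψ) , tt , tt) , tt , tt

module _ {s v} (M : ℕ → ℕ) (n l : Fin s) (ψ : Fm (3 + s) (suc v)) (σ : Vec ℕ s) (ρ : Vec ℕ v) where

  private
    n′ = lookup σ n
    l′ = lookup σ l
    φ = relF n ψ
    up = upto M l φ σ ρ

  rel⁻ : ∀ x y → y < n′ → ix n′ x y < l′ → Rd l′ (eval M (relᵉ n l ψ) σ ρ) (ix n′ x y) →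
         ∃ λ (w : Fin n′) → x ≡ toℕ w × Sem M ψ (y ∷ toℕ w ∷ ix n′ x y ∷ σ) (up (ix n′ x y) ∷ ρ)
  rel⁻ x y y< i< r with table⁻ M l φ σ ρ (ix n′ x y) i< r
  ... | w , y′ , eq , sem with *+-injective n′ y< (toℕ<n y′) eq
  ...   | e₁ , e₂ = w , e₁ , subst (λ z → Sem M ψ (z ∷ toℕ w ∷ ix n′ x y ∷ σ) (up (ix n′ x y) ∷ ρ)) (sym e₂) sem

  rel⁺ : ∀ (w y : Fin n′) → ix n′ (toℕ w) (toℕ y) < l′ →
         Sem M ψ (toℕ y ∷ toℕ w ∷ ix n′ (toℕ w) (toℕ y) ∷ σ) (up (ix n′ (toℕ w) (toℕ y)) ∷ ρ) →
         Rd l′ (eval M (relᵉ n l ψ) σ ρ) (ix n′ (toℕ w) (toℕ y))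
  rel⁺ w y i< sem = table⁺ M l φ σ ρ (ix n′ (toℕ w) (toℕ y)) i< (w , y , refl , sem)

-- With 0 in place of `C` all traces agree, so the core is formed without regard to traces.
zero-empty : ∀ m j → j < m → ¬ Rd m 0 j
zero-empty m j j<m r = r (trans (cong (λ A → rd m A j) (sym (zeros m))) (rd-tab (λ _ _ → 0) (λ _ _ → z≤n) j j<m))
  where
  zeros : ∀ m → tab (λ _ _ → 0) m ≡ 0
  zeros zero    = refl
  zeros (suc m) rewrite zeros m = refl

no-members : ∀ n → ∣ members n 0 ∣ ≤ 0
no-members n = ≤-trans (p⊆q⇒∣p∣≤∣q∣ {q = ⊥ˢ} λ {u} u∈ →
  contradiction (∈-subset⁻ (λ w → rd? n 0 (toℕ w)) u∈) (zero-empty n (toℕ u) (toℕ<n u))) (≤-reflexive (∣⊥∣≡0 n))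

-- Covering by at most k rows

-- Covering W by rows of R: j ≤ k rows with numbers below n are chosen, and the
-- weight α per row plus the number of core elements left uncovered is at most
-- β.  The remaining of the k slots hold the last row, which is to be empty.

unmarkedF : Fm 10 6
unmarkedF = rdᶠ 5F (val 0F) (sz 0F) ∧ᶠ ¬ᶠ ex 7F (rdᶠ 5F (sz 2F) (ixᵉ 8F (rankᵉ 6F 6F (val 0F) (sz 1F)) (sz 0F)))

coverF : Fm 7 6
coverF = ex 6F (ex 1F (
  (sum 4F (fm unmarkedF) ⊕ mulᵉ 1F (val 4F) ≼ val 5F) ∧ᶠ
  al 6F (ex 6F (
    ((sz 0F ≺ sz 6F ∧ᶠ sz 1F ≺ sz 3F) ∨ᶠ (con 1 ⊕ sz 0F ≐ sz 7F)) ∧ᶠ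
    al 6F ((rdᶠ 7F (val 0F) (sz 0F) ∧ᶠ rdᶠ 6F (sz 3F) (ixᵉ 9F (rankᵉ 7F 7F (val 0F) (sz 0F)) (sz 2F))) ⇒ᶠ
      rdᶠ (suc 9F) (val 2F) (ixᵉ 7F (sz 1F) (sz 0F)))))))

coverE : Exp 5 4
coverE = letv (con 0) (letv (proc (0F ∷ 1F ∷ 2F ∷ 3F ∷ 3F ∷ []) (1F ∷ 2F ∷ 0F ∷ 0F ∷ []) coreE coreV coreV-spec)
  (lets (mulᵉ 2F (rankᵉ 0F 0F (val 0F) (sz 0F))) (lets (p2E 0F) (fm coverF))))

module Cover (M : ℕ → ℕ) (n N k lR R W α β : ℕ) where

  open Core M n N k lR lR R W 0 0 public

  private
    t = rank n n core n

  uncovered : (Fin k → Fin N) → Subset n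
  uncovered y = subset {n} λ u → rd? n core (toℕ u) ×-dec ¬? (any? λ l → row? (toℕ (y l)) (toℕ u))

  Choice : ℕ → (Fin k → Fin N) → Set
  Choice j y = ∀ l → (toℕ (y l) < n × toℕ l < j) ⊎ (suc (toℕ (y l)) ≡ N)

  Covers : Set
  Covers = ∃ λ (j : Fin (suc k)) → ∃ λ (y : Fin k → Fin N) → ∣ uncovered y ∣ + α * toℕ j ≤ β × Choice (toℕ j) y

  private
    σ₀ : Vec ℕ 7
    σ₀ = p2 (t * k) ∷ t * k ∷ n ∷ N ∷ k ∷ lR ∷ suc k ∷ []
    ρ₀ : Vec ℕ 6
    ρ₀ = core ∷ 0 ∷ R ∷ W ∷ α ∷ β ∷ []

    rank< : ∀ (u : Fin n) → Rd n core (toℕ u) → rank n n core (toℕ u) < t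
    rank< u cu = rank-mono-< {n} {n} {core} (toℕ<n u) (toℕ<n u) cu

    Bit : Fin (p2 (t * k)) → Fin n → Fin k → Set
    Bit G u l = Rd (t * k) (toℕ G) (ix k (rank n n core (toℕ u)) (toℕ l))

    bit? : ∀ G u l → Dec (Bit G u l)
    bit? G u l = rd? (t * k) (toℕ G) (ix k (rank n n core (toℕ u)) (toℕ l))

    unmarked : Fin (p2 (t * k)) → Subset n
    unmarked G = subset {n} λ u → rd? n core (toℕ u) ×-dec ¬? (any? (bit? G u))

    count-unmarked : ∀ j G → eval M (sum 4F (fm unmarkedF)) (toℕ G ∷ j ∷ σ₀) ρ₀ ≡ ∣ unmarked G ∣
    count-unmarked j G = count-fm M 4F unmarkedF (toℕ G ∷ j ∷ σ₀) ρ₀ (λ u → rd? n core (toℕ u) ×-dec ¬? (any? (bit? G u))) (λ u s → s) (λ u s → s)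

  -- A row found for a slot may cover more than was marked; this only lowers the number of uncovered
  -- elements.
  cover⁻ : Sem M coverF σ₀ ρ₀ → Covers
  cover⁻ (j , G , few , rows) = j , (λ l → proj₁ (rows l)) ,
    ≤-trans (+-monoˡ-≤ (α * toℕ j) (subst (∣ uncovered (λ l → proj₁ (rows l)) ∣ ≤_) (sym (count-unmarked (toℕ j) G)) (p⊆q⇒∣p∣≤∣q∣ inclusion))) few ,
    λ l → proj₁ (proj₂ (rows l))
    where
    inclusion : uncovered (λ l → proj₁ (rows l)) ⊆ unmarked G
    inclusion {u} u∈ = let cu , none = ∈-subset⁻ (λ u → rd? n core (toℕ u) ×-dec ¬? (any? λ l → row? (toℕ (proj₁ (rows l))) (toℕ u))) u∈ in
      ∈-subset⁺ (λ u → rd? n core (toℕ u) ×-dec ¬? (any? (bit? G u))) (cu , λ (l , b) → none (l , proj₂ (proj₂ (rows l)) u (cu , b)))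

  cover⁺ : Covers → Sem M coverF σ₀ ρ₀
  cover⁺ (j , y , few , choice) = j , G , ≤-trans (+-monoˡ-≤ (α * toℕ j) (subst (_≤ ∣ uncovered y ∣) (sym (count-unmarked (toℕ j) G)) (p⊆q⇒∣p∣≤∣q∣ inclusion))) few ,
    λ l → y l , choice l , λ u (cu , b) → proj₁ (marks u l cu) b
    where
    guessed = guess₂ (λ u → rd? n core (toℕ u)) (λ u → rank n n core (toℕ u)) rank<
                (λ u v cu cv → rank-injective n core u v cu cv) (λ u l → row? (toℕ (y l)) (toℕ u))
    G = proj₁ guessed
    marks = proj₂ guessed
    inclusion : unmarked G ⊆ uncovered y
    inclusion {u} u∈ = let cu , none = ∈-subset⁻ (λ u → rd? n core (toℕ u) ×-dec ¬? (any? (bit? G u))) u∈ in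
      ∈-subset⁺ (λ u → rd? n core (toℕ u) ×-dec ¬? (any? λ l → row? (toℕ (y l)) (toℕ u))) (cu , λ (l , r) → none (l , proj₂ (marks u l cu) r))

  core-rank : t ≤ ∣ earlier n ∣
  core-rank = ≤-reflexive (rank-card n n core n)

  cover-decides : ∀ {Q} → (∀ v → v ≤ n → p2 (∣ earlier v ∣ * k) ≤ Q) → Decides Q M coverE (n ∷ N ∷ k ∷ lR ∷ suc k ∷ []) (R ∷ W ∷ α ∷ β ∷ []) Covers
  cover-decides {Q} small = decides-letv con refl (decides-letv {x = core} (proc (core-safe small)) refl
    (decides-lets {x = t * k} (static-safe _ _ _ _) refl (≤-trans (n≤p2 _) P≤) (decides-lets {x = p2 (t * k)} (static-safe _ _ _ _) refl P≤
      (decides (static-safe _ _ _ _) (reflect-map cover⁻ cover⁺ (fm-reflects {M = M} coverF σ₀ ρ₀))))))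
    where
    P≤ : p2 (t * k) ≤ Q
    P≤ = ≤-trans (p2-mono (*-monoˡ-≤ k core-rank)) (small n ≤-refl)

-- Reading the input, and bounds on the sizes

cell-++ˡ : ∀ xs ys j → j < length xs → cell (xs ++ ys) j ≡ cell xs j
cell-++ˡ (x ∷ xs) ys zero    lt       = refl
cell-++ˡ (x ∷ xs) ys (suc j) (s≤s lt) = cell-++ˡ xs ys j lt

cell-++ʳ : ∀ xs ys j → cell (xs ++ ys) (length xs + j) ≡ cell ys j
cell-++ʳ []       ys j = refl
cell-++ʳ (x ∷ xs) ys j = cell-++ʳ xs ys j

cell-map-tabulate : ∀ {A : Set} {m} (h : A → ℕ) (g : Fin m → A) v → cell (map h (tabulateᴸ g)) (toℕ v) ≡ h (g v)
cell-map-tabulate h g zero    = refl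
cell-map-tabulate h g (suc v) = cell-map-tabulate h (g ∘ suc) v

module _ {A : Set} {n} (f : A → List ℕ) (length-f : ∀ x → length (f x) ≡ n) (ys : List ℕ) where

  cell-rows : ∀ {m} (g : Fin m → A) u j → j < n → cell (concatMap f (tabulateᴸ g) ++ ys) (ix n (toℕ u) j) ≡ cell (f (g u)) j
  cell-rows g zero j j<n = trans (cong (λ xs → cell xs j) (++-assoc (f (g zero)) _ ys))
    (cell-++ˡ (f (g zero)) _ j (subst (j <_) (sym (length-f (g zero))) j<n))
  cell-rows g (suc u) j j<n = trans (cong₂ cell (++-assoc (f (g zero)) _ ys) (trans (+-assoc n _ j) (cong (_+ ix n (toℕ u) j) (sym (length-f (g zero))))))
    (trans (cell-++ʳ (f (g zero)) _ (ix n (toℕ u) j)) (cell-rows (g ∘ suc) u j j<n))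

  cell-end : ∀ {m} (g : Fin m → A) j → cell (concatMap f (tabulateᴸ g) ++ ys) (m * n + j) ≡ cell ys j
  cell-end {zero}  g j = refl
  cell-end {suc m} g j = trans (cong₂ cell (++-assoc (f (g zero)) _ ys) (trans (+-assoc n _ j) (cong (_+ (m * n + j)) (sym (length-f (g zero))))))
    (trans (cell-++ʳ (f (g zero)) _ (m * n + j)) (cell-end (g ∘ suc) j))

module _ {n} (a : Fin n → Fin n → Bool) where

  private
    line : Fin n → List ℕ
    line u = map (λ v → bit (a u v)) (allFin n)

    length-line : ∀ u → length (line u) ≡ n
    length-line u = trans (length-map _ (allFin n)) (length-tabulateᴸ (λ (i : Fin n) → i))

  cell-matrix-++ : ∀ ys u v → cell (matrix a ++ ys) (ix n (toℕ u) (toℕ v)) ≡ bit (a u v)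
  cell-matrix-++ ys u v = trans (cell-rows line length-line ys (λ i → i) u (toℕ v) (toℕ<n v)) (cell-map-tabulate (λ v → bit (a u v)) (λ i → i) v)

  cell-matrix : ∀ u v → cell (matrix a) (ix n (toℕ u) (toℕ v)) ≡ bit (a u v)
  cell-matrix u v = trans (cong (λ xs → cell xs (ix n (toℕ u) (toℕ v))) (sym (++-identityʳ (matrix a)))) (cell-matrix-++ [] u v)

  cell-bits : ∀ (X : Subset n) v → cell (matrix a ++ bits X) (n * n + toℕ v) ≡ bit (lookup X v)
  cell-bits X v = trans (cell-end line length-line (bits X) (λ i → i) (toℕ v)) (cell-subset X v)
    where
    cell-subset : ∀ {m} (X : Subset m) v → cell (bits X) (toℕ v) ≡ bit (lookup X v)
    cell-subset (x ∷ X) zero    = refl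
    cell-subset (x ∷ X) (suc v) = cell-subset X v

bit⁻ : ∀ {x b} → x ≡ bit b → x ≢ 0 → T b
bit⁻ {b = true}  e ne = tt
bit⁻ {b = false} e ne = ne e

bit⁺ : ∀ {x b} → x ≡ bit b → T b → x ≢ 0
bit⁺ {b = true} e t x≡0 with () ← trans (sym e) x≡0

-- Here a is the number of cells before the matrix: 2, or 3 if d is part of the input.
adjᶠ : ∀ {s v} → ℕ → Fin s → Exp s v → Exp s v → Fm s v
adjᶠ a n e e′ = nz (inp (con a ⊕ ixᵉ n e e′))

module Sizes (s : ℕ → ℕ) (b : ℕ → ℕ → ℕ) (s-computable : Computable s) (b-computable : Computable₂ b) (p n : ℕ) where

  open Resources s b s-computable b-computable

  n′ = n ⊔ 1
  τ = total p

  Q : ℕ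
  Q = resource p * n′ ^ 2

  1≤n′ : 1 ≤ n′
  1≤n′ = m≤n⊔m n 1

  4≤τ : 4 ≤ τ
  4≤τ = ≤-trans (+-monoˡ-≤ 2 (m≤n+m 2 p)) (p≤total p)

  Q≡ : Q ≡ resource p * (n′ * n′)
  Q≡ = cong (λ x → resource p * (n′ * x)) (*-identityʳ n′)

  size≤ : ∀ {x y z} → x ≤ τ * p2 (τ * τ) → y ≤ n′ → z ≤ n′ → x * (y * z) ≤ Q
  size≤ hx hy hz = ≤-trans (*-mono-≤ hx (*-mono-≤ hy hz)) (≤-reflexive (sym Q≡))

  const≤ : ∀ {x} → x ≤ τ * p2 (τ * τ) → x ≤ Q
  const≤ {x} hx = ≤-trans (≤-reflexive (sym (*-identityʳ x))) (size≤ hx 1≤n′ 1≤n′)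

  τ≤ : ∀ {x} → x ≤ τ → x ≤ τ * p2 (τ * τ)
  τ≤ hx = ≤-trans (≤-trans hx (≤-reflexive (sym (*-identityʳ τ)))) (*-monoʳ-≤ τ (p2>0 (τ * τ)))

  n≤Q : n ≤ Q
  n≤Q = ≤-trans (≤-reflexive (trans (sym (*-identityʳ n)) (sym (+-identityʳ (n * 1))))) (size≤ (τ≤ (≤-trans (s≤s z≤n) 4≤τ)) (m≤m⊔n n 1) 1≤n′)

  k≤τ : ∀ {k} → k ≤ p → k ≤ τ
  k≤τ k≤p = ≤-trans k≤p (≤-trans (m≤m+n p 2) (≤-trans (m≤m+n (p + 2) 2) (p≤total p)))

  1+k≤τ : ∀ {k} → k ≤ p → suc k ≤ τ
  1+k≤τ k≤p = ≤-trans (s≤s k≤p) (≤-trans (≤-reflexive (+-comm 1 p)) (≤-trans (+-monoʳ-≤ p (s≤s z≤n)) (≤-trans (m≤m+n (p + 2) 2) (p≤total p))))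

  rows≤ : 1 + (n + n) ≤ 3 * n′
  rows≤ = +-mono-≤ 1≤n′ (+-mono-≤ (m≤m⊔n n 1) (≤-trans (m≤m⊔n n 1) (≤-reflexive (sym (+-identityʳ n′)))))

  3≤ : 3 ≤ τ * p2 (τ * τ)
  3≤ = τ≤ (≤-trans (n≤1+n 3) 4≤τ)

  N≤Q : ∀ {N} → N ≤ 1 + (n + n) → N ≤ Q
  N≤Q N≤ = ≤-trans (≤-trans N≤ rows≤) (≤-trans (*-monoʳ-≤ 3 (≤-reflexive (sym (*-identityʳ n′)))) (size≤ 3≤ ≤-refl 1≤n′))

  Nn≤Q : ∀ {N} → N ≤ 1 + (n + n) → N * n ≤ Q
  Nn≤Q N≤ = ≤-trans (*-mono-≤ (≤-trans N≤ rows≤) (m≤m⊔n n 1)) (≤-trans (≤-reflexive (*-assoc 3 n′ n′)) (size≤ 3≤ ≤-refl ≤-refl))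

  power≤Q : ∀ {x y} → x ≤ τ → y ≤ τ → p2 (x * y) ≤ Q
  power≤Q hx hy = const≤ (≤-trans (p2-mono (*-mono-≤ hx hy)) (≤-trans (≤-reflexive (sym (+-identityʳ _))) (*-monoˡ-≤ (p2 (τ * τ)) (1≤total p))))

  table≤Q : ∀ {x y} → x ≤ τ → y ≤ τ → x * p2 y * n ≤ Q
  table≤Q {x} {y} hx hy = ≤-trans (≤-reflexive (cong (x * p2 y *_) (sym (*-identityʳ n))))
    (size≤ (*-mono-≤ hx (p2-mono (≤-trans hy (≤-trans (≤-reflexive (sym (*-identityʳ τ))) (*-monoʳ-≤ τ (1≤total p)))))) (m≤m⊔n n 1) 1≤n′)

  width₁-large : ∀ {k} → k ≤ p → 2 ^ (0 + s (p + 2) * suc (p + 2)) * 2 ^ (k + 2) ≤ width₁ p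
  width₁-large {k} k≤p = ≤-trans (*-monoʳ-≤ (2 ^ (s (p + 2) * suc (p + 2))) (^-monoʳ-≤ 2 (+-monoˡ-≤ 2 k≤p)))
    (≤-reflexive (trans (sym (^-distribˡ-+-* 2 (s (p + 2) * suc (p + 2)) (p + 2)))
      (trans (cong (λ x → 2 ^ (s (p + 2) * x + (p + 2))) (sym (+-suc p 2))) (sym (p2≡2^ (s (p + 2) * (p + 3) + (p + 2)))))))

  width₂-large : ∀ {k} → k ≤ p → 2 ^ (core₁ p + s (p + 2) * suc (p + 2)) * 2 ^ (k + 2) ≤ width₂ p
  width₂-large {k} k≤p = ≤-trans (≤-reflexive (trans (cong (_* 2 ^ (k + 2)) (^-distribˡ-+-* 2 (core₁ p) _))
    (solve 3 (λ x y z → x :* y :* z := y :* z :* x) refl (2 ^ core₁ p) (2 ^ (s (p + 2) * suc (p + 2))) (2 ^ (k + 2)))))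
    (*-mono-≤ (width₁-large k≤p) (≤-reflexive (sym (p2≡2^ (core₁ p)))))
    where open +-*-Solver

-- Subsets as lists of slots

enum : ∀ {n} (X : Subset n) → Fin ∣ X ∣ → Fin n
enum (inside ∷ X)  zero    = zero
enum (inside ∷ X)  (suc i) = suc (enum X i)
enum (outside ∷ X) i       = suc (enum X i)

enum-∈ : ∀ {n} (X : Subset n) i → enum X i ∈ X
enum-∈ (inside ∷ X)  zero    = here
enum-∈ (inside ∷ X)  (suc i) = there (enum-∈ X i)
enum-∈ (outside ∷ X) i       = there (enum-∈ X i)

enum-injective : ∀ {n} (X : Subset n) i j → enum X i ≡ enum X j → i ≡ j
enum-injective (inside ∷ X)  zero    zero    eq = refl
enum-injective (inside ∷ X)  (suc i) (suc j) eq = cong suc (enum-injective X i j (suc-injectiveᶠ eq))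
enum-injective (outside ∷ X) i       j       eq = enum-injective X i j (suc-injectiveᶠ eq)

enum-surjective : ∀ {n} (X : Subset n) {x} → x ∈ X → ∃ λ i → enum X i ≡ x
enum-surjective (inside ∷ X)  here       = zero , refl
enum-surjective (inside ∷ X)  (there x∈) = let i , eq = enum-surjective X x∈ in suc i , cong suc eq
enum-surjective (outside ∷ X) (there x∈) = let i , eq = enum-surjective X x∈ in i , cong suc eq

card-≤ : ∀ {n} (X : Subset n) j (P : Fin n → ℕ → Set) → (∀ x → x ∈ X → ∃ λ l → l < j × P x l) →
         (∀ x y l → P x l → P y l → x ≡ y) → ∣ X ∣ ≤ j
card-≤ X j P label functional with ∣ X ∣ ≤? j
... | yes le = le
... | no ¬le = contradiction (<-cmp-refl (pigeonhole (≰⇒> ¬le) f)) (λ x → x)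
  where
  l = λ i → label (enum X i) (enum-∈ X i)
  f : Fin ∣ X ∣ → Fin j
  f i = fromℕ< (proj₁ (proj₂ (l i)))
  <-cmp-refl : ¬ (∃₂ λ i i′ → toℕ i < toℕ i′ × f i ≡ f i′)
  <-cmp-refl (i , i′ , i<i′ , eq) = <⇒≢ i<i′ (cong toℕ (enum-injective X i i′ (functional _ _ (proj₁ (l i)) (proj₂ (proj₂ (l i)))
    (subst (P (enum X i′)) (trans (sym (toℕ-fromℕ< _)) (trans (cong toℕ (sym eq)) (toℕ-fromℕ< _))) (proj₂ (proj₂ (l i′)))))))

card-≥ : ∀ {n} (X : Subset n) {j} (g : Fin j → Fin n) → (∀ l → g l ∈ X) → (∀ l l′ → g l ≡ g l′ → l ≡ l′) → j ≤ ∣ X ∣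
card-≥ X {j} g g∈ injective with j ≤? ∣ X ∣
... | yes le = le
... | no ¬le with pigeonhole (≰⇒> ¬le) (λ l → proj₁ (enum-surjective X (g∈ l)))
...   | l , l′ , l<l′ , eq = contradiction (cong toℕ (injective l l′ (trans (sym (proj₂ (enum-surjective X (g∈ l))))
        (trans (cong (enum X) eq) (proj₂ (enum-surjective X (g∈ l′))))))) (<⇒≢ l<l′)

module _ {n k N : ℕ} (n<N : n < N) (X : Subset n) where

  -- Slots beyond the elements of `X` hold N - 1, which is not the number of a vertex since n < N.
  padded : Fin k → Fin N
  padded l with suc (toℕ l) ≤? ∣ X ∣
  ... | yes l< = fromℕ< (<-trans (toℕ<n (enum X (fromℕ< l<))) n<N)
  ... | no  _  = fromℕ< {N ∸ 1} (≤-reflexive (m+[n∸m]≡n {1} (≤-trans (s≤s z≤n) n<N)))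

  padded-choice : ∀ l → (toℕ (padded l) < n × toℕ l < ∣ X ∣) ⊎ (suc (toℕ (padded l)) ≡ N)
  padded-choice l with suc (toℕ l) ≤? ∣ X ∣
  ... | yes l< = inj₁ (subst (_< n) (sym (toℕ-fromℕ< _)) (toℕ<n (enum X (fromℕ< l<))) , l<)
  ... | no  _  = inj₂ (trans (cong suc (toℕ-fromℕ< _)) (m+[n∸m]≡n {1} (≤-trans (s≤s z≤n) n<N)))

  padded-onto : ∣ X ∣ ≤ k → ∀ {x} → x ∈ X → ∃ λ l → toℕ (padded l) ≡ toℕ x
  padded-onto X≤k {x} x∈ with enum-surjective X x∈
  ... | i , eq = fromℕ< i<k , hit
    where
    i<k = <-≤-trans (toℕ<n i) X≤k
    hit : toℕ (padded (fromℕ< i<k)) ≡ toℕ x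
    hit with suc (toℕ (fromℕ< i<k)) ≤? ∣ X ∣
    ... | yes l< = trans (toℕ-fromℕ< _) (cong toℕ (trans (cong (enum X) (toℕ-injective (trans (toℕ-fromℕ< l<) (toℕ-fromℕ< i<k)))) eq))
    ... | no ¬l< = contradiction (subst (_< ∣ X ∣) (sym (toℕ-fromℕ< i<k)) (toℕ<n i)) ¬l<

  padded-∈ : ∀ l {x} → toℕ (padded l) ≡ toℕ x → x ∈ X
  padded-∈ l {x} eq with suc (toℕ l) ≤? ∣ X ∣
  ... | yes l< = subst (_∈ X) (toℕ-injective (trans (sym (toℕ-fromℕ< _)) eq)) (enum-∈ X (fromℕ< l<))
  ... | no  _  = contradiction (subst (_< n) (sym eq) (toℕ<n x)) (≤⇒≯ (s≤s⁻¹ (subst (n <_) (sym (trans (cong suc (toℕ-fromℕ< _)) (m+[n∸m]≡n {1} (≤-trans (s≤s z≤n) n<N)))) n<N)))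

-- Closed neighbourhoods and the covering program

module _ (G : Graph) where

  Near : Vertex G → Vertex G → Set
  Near w a = w ≡ a ⊎ Edge G w a

  near-sym : ∀ {w a} → Near w a → Near a w
  near-sym (inj₁ eq) = inj₁ (sym eq)
  near-sym {w} {a} (inj₂ e) = inj₂ (subst T (Graph.sym G w a) e)

  near⇒N : ∀ {w a} → Near w a → N ⟦ G ⟧ 1 a w
  near⇒N (inj₁ refl) = 0 , z≤n , []
  near⇒N (inj₂ e)    = 1 , s≤s z≤n , e ∷ []

  N⇒near : ∀ {w a} → N ⟦ G ⟧ 1 a w → Near w a
  N⇒near (zero , _ , [])            = inj₁ refl
  N⇒near (suc zero , _ , e ∷ [])    = inj₂ e
  N⇒near (suc (suc _) , s≤s () , _)

  near? : ∀ w a → Dec (Near w a)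
  near? w a = (w ≟ꟳ a) ⊎-dec T? (Graph.adj G w a)

module _ {n} (E : Fin n → Fin n → Bool) where

  open Balls E

  ball-1⁺ : ∀ {w a} → w ≡ a ⊎ T (E w a) → Ball 1 w a
  ball-1⁺ (inj₁ eq) = inj₁ eq
  ball-1⁺ (inj₂ e)  = inj₂ (_ , refl , e)

  ball-1⁻ : ∀ {w a} → Ball 1 w a → w ≡ a ⊎ T (E w a)
  ball-1⁻ (inj₁ eq)             = inj₁ eq
  ball-1⁻ (inj₂ (_ , refl , e)) = inj₂ e

coverTail : Exp 2 0 → Fm 6 1 → Fm 6 2 → ℕ → Exp 5 3 → Exp 2 0
coverTail N φ ω α β = lets N (lets (mulᵉ 2F (sz 0F)) (lets (con 1 ⊕ sz 2F)
  (letv (tableᵉ 1F φ) (letv (tableᵉ 4F ω) (letv (con α) (letv β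
    (proc (4F ∷ 2F ∷ 3F ∷ 1F ∷ 0F ∷ []) (3F ∷ 2F ∷ 1F ∷ 0F ∷ []) coverE (λ M → eval M coverE) (λ _ _ _ → refl))))))))

-- The number k of slots is kept apart from the parameter p, which is k + d when a distance is part
-- of the input.
module Main (s : ℕ → ℕ) (b : ℕ → ℕ → ℕ) (s-computable : Computable s) (b-computable : Computable₂ b)
  (G : Graph) (p k : ℕ) (k≤p : k ≤ p) (M : ℕ → ℕ) (uqw : ∀ m → Wide G (p + 2) (s (p + 2)) m (b (p + 2) m))
  (E : Vertex G → Vertex G → Bool) (E⊆ : ∀ u v → T (E u v) → Edge G u v) where

  open Resources s b s-computable b-computable public
  open Sizes s b s-computable b-computable p (order G) public
  open Balls E

  private
    n = order G

  first-small : ∀ N lR R W → Rows G E E⊆ (p + 2) N (Core.row M n N k lR lR R W 0 0) → ∀ v → ∣ Core.earlier M n N k lR lR R W 0 0 v ∣ ≤ core₁ p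
  first-small N lR R W rows = core-bound G E E⊆ M N k lR lR R W 0 0 0 rows (no-members n) (uqw (width₁ p)) (width₁-large k≤p)

  core₁-power : ∀ {x} → x ≤ core₁ p → p2 (x * k) ≤ Q
  core₁-power x≤ = power≤Q (≤-trans x≤ (core₁≤total p)) (k≤τ k≤p)

  module CoverMain (nE : Exp 2 0) (φ : Fm 6 1) (ω : Fm 6 2) (α : ℕ) (β : Exp 5 3) where

    ν : ℕ
    ν = eval M nE (k ∷ n ∷ []) []

    σ : Vec ℕ 5
    σ = suc k ∷ ν * n ∷ ν ∷ k ∷ n ∷ []

    R = upto M 1F φ σ [] (ν * n)
    W = upto M 4F ω σ (R ∷ []) n
    β′ = eval M β σ (α ∷ W ∷ R ∷ [])

    open Cover M n ν k (ν * n) R W α β′ public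

    tail-decides : Static nE → Static (fm φ) → Static (fm ω) → Static β → ν ≤ 1 + (n + n) → Rows G E E⊆ (p + 2) ν row →
                   Decides Q M (coverTail nE φ ω α β) (k ∷ n ∷ []) [] Covers
    tail-decides sN sφ sω sβ ν≤ rows = decides-lets {x = ν} (static-safe _ _ _ sN) refl (N≤Q ν≤) (decides-lets {x = ν * n} (static-safe _ _ _ _) refl (Nn≤Q ν≤)
      (decides-lets {x = suc k} (static-safe _ _ _ _) refl (const≤ (τ≤ (1+k≤τ k≤p)))
      (decides-letv {x = R} (static-safe _ _ _ (tt , (tt , tt) , sφ)) refl (decides-letv {x = W} (static-safe _ _ _ (tt , (tt , tt) , sω)) refl
      (decides-letv {x = α} con refl (decides-letv {x = β′} (static-safe _ _ _ sβ) refl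
      (decides-proc (cover-decides (λ v _ → core₁-power (first-small ν (ν * n) R W rows v))))))))))

module _ (G : Graph) (E : Vertex G → Vertex G → Bool) (E⊆ : ∀ u v → T (E u v) → Edge G u v) where

  open Balls E

  ball-rows : ∀ (D : Vertex G → Vertex G → Set) {r} {row : ℕ → ℕ → Set} N →
    (∀ x y → x < N → row x (toℕ y) → ∃ λ w → x ≡ toℕ w × D w y) →
    (∀ w y → toℕ w < N → D w y → row (toℕ w) (toℕ y)) →
    (∀ w → (∀ a → ¬ D w a) ⊎ ∃ λ i → i ≤ r × (∀ a → D w a → Ball i w a) × (∀ a → Ball i w a → D w a)) →
    Rows G E E⊆ r N row
  ball-rows D {row = row} N row⇒D D⇒row split x with suc (toℕ x) ≤? order G
  ... | no ¬x = inj₁ λ a r → let w , e , d = row⇒D (toℕ x) a (toℕ<n x) r in contradiction (subst (_< order G) (sym e) (toℕ<n w)) ¬x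
  ... | yes x< = cases (split w₀)
    where
    w₀ = fromℕ< x<
    at : ∀ {a} → row (toℕ x) (toℕ a) → D w₀ a
    at {a} r = let w , e , d = row⇒D (toℕ x) a (toℕ<n x) r in subst (λ z → D z a) (toℕ-injective (trans (sym e) (sym (toℕ-fromℕ< x<)))) d
    back : ∀ {a} → D w₀ a → row (toℕ x) (toℕ a)
    back {a} d = subst (λ z → row z (toℕ a)) (toℕ-fromℕ< x<) (D⇒row w₀ a (subst (_< N) (sym (toℕ-fromℕ< x<)) (toℕ<n x)) d)
    cases : (∀ a → ¬ D w₀ a) ⊎ (∃ λ i → i ≤ _ × (∀ a → D w₀ a → Ball i w₀ a) × (∀ a → Ball i w₀ a → D w₀ a)) → _
    cases (inj₁ none)              = inj₁ λ a r → none a (at r)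
    cases (inj₂ (i , i≤ , f , g)) = inj₂ (w₀ , i , i≤ , (λ a r → f a (at r)) , λ a B → back (g a B))

near-rows : ∀ G (D : Vertex G → Vertex G → Set) {r} {row : ℕ → ℕ → Set} N →
  (∀ x y → x < N → row x (toℕ y) → ∃ λ w → x ≡ toℕ w × D w y) →
  (∀ w y → toℕ w < N → D w y → row (toℕ w) (toℕ y)) → 1 ≤ r →
  (∀ w → (∀ a → ¬ D w a) ⊎ ((∀ a → D w a → Near G w a) × (∀ a → Near G w a → D w a))) →
  Rows G (Graph.adj G) (λ _ _ e → e) r N row
near-rows G D {row = row} N row⇒D D⇒row 1≤r split = ball-rows G (Graph.adj G) (λ _ _ e → e) D {row = row} N row⇒D D⇒row λ w →
  [ inj₁ , (λ (f , g) → inj₂ (1 , 1≤r , (λ a d → ball-1⁺ (Graph.adj G) (f a d)) , λ a B → g a (ball-1⁻ (Graph.adj G) B))) ]′ (split w)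

nonempty-card : ∀ {n} (X : Subset n) {x} → x ∈ X → 0 < ∣ X ∣
nonempty-card X x∈ = ≤-trans (s≤s z≤n) (toℕ<n (proj₁ (enum-surjective X x∈)))

nearF : ∀ {s v} → ℕ → Fin s → Exp s v → Exp s v → Fm s v
nearF a n e e′ = (e ≐ e′) ∨ᶠ adjᶠ a n e e′

module _ (G : Graph) (a : ℕ) (M : ℕ → ℕ) (reads : ∀ u v → M (a + ix (order G) (toℕ u) (toℕ v)) ≡ bit (Graph.adj G u v)) where

  near⁻ : ∀ w v → toℕ w ≡ toℕ v ⊎ M (a + ix (order G) (toℕ w) (toℕ v)) ≢ 0 → Near G w v
  near⁻ w v (inj₁ eq) = inj₁ (toℕ-injective eq)
  near⁻ w v (inj₂ ne) = inj₂ (bit⁻ (reads w v) ne)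

  near⁺ : ∀ w v → Near G w v → toℕ w ≡ toℕ v ⊎ M (a + ix (order G) (toℕ w) (toℕ v)) ≢ 0
  near⁺ w v (inj₁ eq) = inj₁ (cong toℕ eq)
  near⁺ w v (inj₂ e)  = inj₂ (bit⁺ (reads w v) e)

module Dominated (M : ℕ → ℕ) (n N k lR R W α β : ℕ) (n<N : n < N) where

  open Cover M n N k lR R W α β

  chosen : (Fin k → Fin N) → Subset n
  chosen y = subset {n} λ w → any? λ l → toℕ (y l) ≟ toℕ w

  chosen-∈ : ∀ y {w} → w ∈ chosen y → ∃ λ l → toℕ (y l) ≡ toℕ w
  chosen-∈ y = ∈-subset⁻ (λ w → any? λ l → toℕ (y l) ≟ toℕ w)

  ∈-chosen : ∀ y {w} l → toℕ (y l) ≡ toℕ w → w ∈ chosen y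
  ∈-chosen y l eq = ∈-subset⁺ (λ w → any? λ l → toℕ (y l) ≟ toℕ w) (l , eq)

  chosen-card : ∀ {j} y → Choice j y → ∣ chosen y ∣ ≤ j
  chosen-card {j} y choice = card-≤ (chosen y) j (λ w i → ∃ λ l → toℕ l ≡ i × toℕ (y l) ≡ toℕ w) label
    λ { w w′ _ (l , refl , e) (l′ , e′ , e″) → toℕ-injective (trans (sym e) (trans (cong (toℕ ∘ y) (toℕ-injective (sym e′))) e″)) }
    where
    label : ∀ w → w ∈ chosen y → ∃ λ i → i < j × ∃ λ l → toℕ l ≡ i × toℕ (y l) ≡ toℕ w
    label w w∈ with chosen-∈ y w∈
    ... | l , e with choice l
    ...   | inj₁ (_ , l<j) = toℕ l , l<j , l , refl , e
    ...   | inj₂ last      = contradiction (subst (n <_) (trans (sym last) (cong suc e)) n<N) (≤⇒≯ (toℕ<n w))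

  ∈-uncovered : ∀ y (u : Fin n) → Rd n core (toℕ u) → ¬ (∃ λ l → row (toℕ (y l)) (toℕ u)) → u ∈ uncovered y
  ∈-uncovered y u cu none = ∈-subset⁺ (λ u → rd? n core (toℕ u) ×-dec ¬? (any? λ l → row? (toℕ (y l)) (toℕ u))) (cu , none)

  uncovered⁻ : ∀ y {u : Fin n} → u ∈ uncovered y → Rd n core (toℕ u) × ¬ (∃ λ l → row (toℕ (y l)) (toℕ u))
  uncovered⁻ y = ∈-subset⁻ (λ u → rd? n core (toℕ u) ×-dec ¬? (any? λ l → row? (toℕ (y l)) (toℕ u)))

module CoveredBy (M : ℕ → ℕ) (n N k lR R W : ℕ) (n<N : n < N) {D : Fin n → Fin n → Set} {X₀ : Subset n}
  (row⇒D : ∀ x y → x < N → Rd lR R (ix n x (toℕ y)) → ∃ λ w → x ≡ toℕ w × D w y)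
  (D⇒row : ∀ w y → D w y → Rd lR R (ix n (toℕ w) (toℕ y)))
  (W⇒X₀ : ∀ u → Rd n W (toℕ u) → u ∈ X₀) (X₀⇒W : ∀ u → u ∈ X₀ → Rd n W (toℕ u)) where

  open Cover M n N k lR R W 0 0
  open Dominated M n N k lR R W 0 0 n<N

  -- With weight and bound both 0, no core element may be left uncovered and the number of rows is
  -- limited by k alone.
  covers⁻ : Covers → ∃ λ X → ∣ X ∣ ≤ k × (∀ u → u ∈ X₀ → ∃ λ v → v ∈ X × D v u)
  covers⁻ (j , y , few , choice) = chosen y , ≤-trans (chosen-card y choice) (s≤s⁻¹ (toℕ<n j)) , dominated
    where
    covered : ∀ (u : Fin n) → Rd n core (toℕ u) → ∃ λ l → row (toℕ (y l)) (toℕ u)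
    covered u cu with any? (λ l → row? (toℕ (y l)) (toℕ u))
    ... | yes c = c
    ... | no ¬c = contradiction (≤-trans (nonempty-card (uncovered y) (∈-uncovered y u cu ¬c)) (≤-trans (m≤m+n _ _) few)) λ ()
    dominated : ∀ u → u ∈ X₀ → ∃ λ v → v ∈ chosen y × D v u
    dominated u u∈ with core-covers u (X₀⇒W u u∈) y (λ u′ cu′ _ → covered u′ cu′)
    ... | l , r with row⇒D (toℕ (y l)) u (toℕ<n (y l)) r
    ...   | w , e , d = w , ∈-chosen y l e , d

  covers⁺ : (∃ λ X → ∣ X ∣ ≤ k × (∀ u → u ∈ X₀ → ∃ λ v → v ∈ X × D v u)) → Covers
  covers⁺ (X , X≤k , dominates) = fromℕ< (s≤s X≤k) , y , ≤-trans (≤-reflexive (+-identityʳ _)) (≮⇒≥ nonempty) ,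
    λ l → subst (λ j → (toℕ (y l) < n × toℕ l < j) ⊎ (suc (toℕ (y l)) ≡ N)) (sym (toℕ-fromℕ< (s≤s X≤k))) (padded-choice n<N X l)
    where
    y = padded n<N X
    nonempty : ¬ (0 < ∣ uncovered y ∣)
    nonempty lt with uncovered⁻ y (enum-∈ (uncovered y) (fromℕ< lt))
    ... | cu , none with dominates _ (W⇒X₀ _ (proj₁ (core⁻ _ cu)))
    ...   | v , v∈ , d with padded-onto n<N X X≤k v∈
    ...     | l , e = none (l , subst (λ x → row x _) (sym e) (D⇒row v _ d))

start : Exp 2 0 → Exp 0 0
start e = lets (inp (con 0)) (lets (inp (con 1)) e)

start-decides : ∀ {Q M n k P e} → M 0 ≡ n → M 1 ≡ k → n ≤ Q → k ≤ Q → Decides Q M e (k ∷ n ∷ []) [] P → Decides Q M (start e) [] [] P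
start-decides e₀ e₁ n≤ k≤ D = decides-lets (inp con) e₀ n≤ (decides-lets (inp con) e₁ k≤ D)

roman-sum : ∀ {m} (R : Fin m → Fin 3) → sumᴸ (tabulateᴸ (λ v → toℕ (R v))) ≡
            ∣ subset (λ v → R v ≟ꟳ 1F) ∣ + 2 * ∣ subset (λ v → R v ≟ꟳ 2F) ∣
roman-sum {zero}  R = refl
roman-sum {suc m} R with R zero | roman-sum (λ v → R (suc v))
... | 0F | ih = ih
... | 1F | ih = cong suc ih
... | 2F | ih = trans (cong (2 +_) ih) (solve 2 (λ x y → con 2 :+ (x :+ con 2 :* y) := x :+ con 2 :* (con 1 :+ y)) refl
                  ∣ subset (λ v → R (suc v) ≟ꟳ 1F) ∣ ∣ subset (λ v → R (suc v) ≟ꟳ 2F) ∣)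
  where open +-*-Solver

∈⇒T : ∀ {n} {X : Subset n} {v} → v ∈ X → T (lookup X v)
∈⇒T v∈ = subst T (sym ([]=⇒lookup v∈)) tt

T⇒∈ : ∀ {n} {X : Subset n} {v} → T (lookup X v) → v ∈ X
T⇒∈ {X = X} {v} t = lookup⇒[]= v X (T⇒≡true t)
  where
  T⇒≡true : ∀ {b} → T b → b ≡ true
  T⇒≡true {true} _ = refl

-- Annotated and red-blue domination

module Setting {ℓ} (C : GraphClass ℓ) (s : ℕ → ℕ) (b : ℕ → ℕ → ℕ) (uqw : UniformlyQuasiWide C s b)
  (s-computable : Computable s) (b-computable : Computable₂ b) where

  open Resources s b s-computable b-computable

  wide : ∀ {G} → C G → ∀ r m → Wide G r (s r) m (b r m)
  wide {G} CG r m W = uqw r m G CG W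

  fpt : (Π : Problem) (e : Exp 0 0) → let open Problem Π in
    (∀ I → C (graph I) → Decides (resource (parameter I) * (order (graph I) ⊔ 1) ^ 2) (cell (encode I)) e [] [] (Yes I)) → FPT C Π
  fpt Π e correct = exp-fpt {C = C} Π e resource resource-computable 1≤resource correct

  setF : ∀ {s v} → Fin s → Exp s v → Fm s v
  setF n e = nz (inp (con 2 ⊕ (mulᵉ n (sz n) ⊕ e)))

  module SetProblem (G : Graph) (k : ℕ) (X : Subset (order G)) where

    n = order G

    M : ℕ → ℕ
    M = cell (n ∷ k ∷ matrix (Graph.adj G) ++ bits X)

    reads : ∀ u v → M (2 + ix n (toℕ u) (toℕ v)) ≡ bit (Graph.adj G u v)
    reads = cell-matrix-++ (Graph.adj G) (bits X)

    set⁻ : ∀ v → M (2 + (n * n + toℕ v)) ≢ 0 → v ∈ X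
    set⁻ v ne = T⇒∈ (bit⁻ (cell-bits (Graph.adj G) X v) ne)

    set⁺ : ∀ v → v ∈ X → M (2 + (n * n + toℕ v)) ≢ 0
    set⁺ v v∈ = bit⁺ (cell-bits (Graph.adj G) X v) (∈⇒T v∈)

  dominates⁻ : ∀ G {X W k} → (∣ X ∣ ≤ k × Dominates G 1 X W) → ∣ X ∣ ≤ k × (∀ u → u ∈ W → ∃ λ v → v ∈ X × Near G v u)
  dominates⁻ G (X≤ , dom) = X≤ , λ u u∈ → let v , v∈ , d = dom u u∈ in v , v∈ , near-sym G (N⇒near G d)

  annotatedE : Exp 0 0
  annotatedE = start (coverTail (con 1 ⊕ sz 1F) (relF 4F (nearF 2 7F (sz 1F) (sz 0F))) (setF 5F (sz 0F)) 0 (con 0))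

  annotated : FPT C AnnotatedDominatingSet
  annotated = fpt AnnotatedDominatingSet annotatedE λ (G , k , X) CG → correct G k X CG
    where
    module _ (G : Graph) (k : ℕ) (X : Subset (order G)) (CG : C G) where
      open SetProblem G k X
      open Main s b s-computable b-computable G k k ≤-refl M (wide CG (k + 2)) (Graph.adj G) (λ _ _ e → e)
      ψ = nearF 2 7F (sz 1F) (sz 0F)
      ω = setF 5F (sz 0F)
      open CoverMain (con 1 ⊕ sz 1F) (relF 4F ψ) ω 0 (con 0)
      row⇒D : ∀ x y → x < suc n → row x (toℕ y) → ∃ λ w → x ≡ toℕ w × Near G w y
      row⇒D x y x< r = let w , e , near = rel⁻ M 4F 1F ψ σ [] x (toℕ y) (toℕ<n y) (ix< x< (toℕ<n y)) r in w , e , near⁻ G 2 M reads w y near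
      D⇒row : ∀ w y → Near G w y → row (toℕ w) (toℕ y)
      D⇒row w y d = rel⁺ M 4F 1F ψ σ [] w y (ix< (m<n⇒m<1+n (toℕ<n w)) (toℕ<n y)) (near⁺ G 2 M reads w y d)
      W⇒X : ∀ u → Rd n W (toℕ u) → u ∈ X
      W⇒X u r = set⁻ u (table⁻ M 4F ω σ (R ∷ []) (toℕ u) (toℕ<n u) r)
      X⇒W : ∀ u → u ∈ X → Rd n W (toℕ u)
      X⇒W u u∈ = table⁺ M 4F ω σ (R ∷ []) (toℕ u) (toℕ<n u) (set⁺ u u∈)
      open CoveredBy M n (suc n) k (suc n * n) R W ≤-refl {Near G} {X} row⇒D D⇒row W⇒X X⇒W
      correct : Decides Q M annotatedE [] [] (Problem.Yes AnnotatedDominatingSet (G , k , X))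
      correct = start-decides refl refl n≤Q (const≤ (τ≤ (k≤τ ≤-refl)))
        (decides-map (λ c → let X′ , X≤ , dom = covers⁻ c in X′ , X≤ , λ u u∈ → let v , v∈ , d = dom u u∈ in v , v∈ , near⇒N G (near-sym G d))
                     (λ (X′ , d) → covers⁺ (X′ , dominates⁻ G d))
        (tail-decides _ _ _ _ (s≤s (m≤m+n n n))
          (near-rows G (Near G) {row = row} (suc n) row⇒D (λ w y _ → D⇒row w y) (≤-trans (s≤s z≤n) (m≤n+m 2 k)) (λ w → inj₂ ((λ _ d → d) , (λ _ d → d))))))

  -- The row of a blue vertex is empty. Blue vertices that happen to be chosen dominate nothing and
  -- are removed by an intersection.
  redBlueE : Exp 0 0
  redBlueE = start (coverTail (con 1 ⊕ sz 1F) (relF 4F (setF 7F (sz 1F) ∧ᶠ nearF 2 7F (sz 1F) (sz 0F))) (¬ᶠ setF 5F (sz 0F)) 0 (con 0))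

  redBlue : FPT C RedBlueDominatingSet
  redBlue = fpt RedBlueDominatingSet redBlueE λ (G , k , X) CG → correct G k X CG
    where
    module _ (G : Graph) (k : ℕ) (X : Subset (order G)) (CG : C G) where
      open SetProblem G k X
      open Main s b s-computable b-computable G k k ≤-refl M (wide CG (k + 2)) (Graph.adj G) (λ _ _ e → e)
      ψ = setF 7F (sz 1F) ∧ᶠ nearF 2 7F (sz 1F) (sz 0F)
      ω = ¬ᶠ setF 5F (sz 0F)
      open CoverMain (con 1 ⊕ sz 1F) (relF 4F ψ) ω 0 (con 0)
      D : Vertex G → Vertex G → Set
      D w a = w ∈ X × Near G w a
      row⇒D : ∀ x y → x < suc n → row x (toℕ y) → ∃ λ w → x ≡ toℕ w × D w y
      row⇒D x y x< r = let w , e , red , near = rel⁻ M 4F 1F ψ σ [] x (toℕ y) (toℕ<n y) (ix< x< (toℕ<n y)) r in w , e , set⁻ w red , near⁻ G 2 M reads w y near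
      D⇒row : ∀ w y → D w y → row (toℕ w) (toℕ y)
      D⇒row w y (red , d) = rel⁺ M 4F 1F ψ σ [] w y (ix< (m<n⇒m<1+n (toℕ<n w)) (toℕ<n y)) (set⁺ w red , near⁺ G 2 M reads w y d)
      W⇒X : ∀ u → Rd n W (toℕ u) → u ∈ ∁ X
      W⇒X u r = x∉p⇒x∈∁p λ u∈ → table⁻ M 4F ω σ (R ∷ []) (toℕ u) (toℕ<n u) r (set⁺ u u∈)
      X⇒W : ∀ u → u ∈ ∁ X → Rd n W (toℕ u)
      X⇒W u u∈ = table⁺ M 4F ω σ (R ∷ []) (toℕ u) (toℕ<n u) λ r → x∈∁p⇒x∉p u∈ (set⁻ u r)
      open CoveredBy M n (suc n) k (suc n * n) R W ≤-refl {D} {∁ X} row⇒D D⇒row W⇒X X⇒W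
      split : ∀ w → (∀ a → ¬ D w a) ⊎ ((∀ a → D w a → Near G w a) × (∀ a → Near G w a → D w a))
      split w with w ∈? X
      ... | yes w∈ = inj₂ ((λ a → proj₂) , (λ a → w∈ ,_))
      ... | no w∉  = inj₁ λ a → w∉ ∘ proj₁
      yes⁻ : Covers → Problem.Yes RedBlueDominatingSet (G , k , X)
      yes⁻ c = let X′ , X≤ , dom = covers⁻ c in X′ ∩ X , p∩q⊆q X′ X , ≤-trans (∣p∩q∣≤∣p∣ X′ X) X≤ ,
        λ u u∈ → let v , v∈ , red , d = dom u u∈ in v , x∈p∩q⁺ (v∈ , red) , near⇒N G (near-sym G d)
      yes⁺ : Problem.Yes RedBlueDominatingSet (G , k , X) → Covers
      yes⁺ (X′ , X′⊆ , X≤ , dom) = covers⁺ (X′ , X≤ , λ u u∈ → let v , v∈ , d = dom u u∈ in v , v∈ , X′⊆ v∈ , near-sym G (N⇒near G d))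
      correct : Decides Q M redBlueE [] [] (Problem.Yes RedBlueDominatingSet (G , k , X))
      correct = start-decides refl refl n≤Q (const≤ (τ≤ (k≤τ ≤-refl))) (decides-map yes⁻ yes⁺ (tail-decides _ _ _ _ (s≤s (m≤m+n n n))
        (near-rows G D {row = row} (suc n) row⇒D (λ w y _ → D⇒row w y) (≤-trans (s≤s z≤n) (m≤n+m 2 k)) split)))

-- Roman domination

module RomanSetting {ℓ} (C : GraphClass ℓ) (s : ℕ → ℕ) (b : ℕ → ℕ → ℕ) (uqw : UniformlyQuasiWide C s b)
  (s-computable : Computable s) (b-computable : Computable₂ b) where

  open Setting C s b uqw s-computable b-computable

  -- Row w < n is the closed neighbourhood of w, row n + v is {v}, and row 2n is empty.

  romanF : Fm 6 1
  romanF = relF 4F (nearF 2 7F (sz 1F) (sz 0F)) ∨ᶠ ex 5F (sz 1F ≐ ixᵉ 6F (sz 6F ⊕ sz 0F) (sz 0F))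

  -- A chosen neighbourhood costs the value 2 of its centre, and a core element left uncovered costs
  -- 1, since it receives the value 1 itself.
  romanE : Exp 0 0
  romanE = start (coverTail (con 1 ⊕ (sz 1F ⊕ sz 1F)) romanF (con 0 ≐ con 0) 2 (sz 3F))

  roman : FPT C RomanDomination
  roman = fpt RomanDomination romanE λ (G , k) CG → correct G k CG
    where
    module _ (G : Graph) (k : ℕ) (CG : C G) where
      n = order G
      M : ℕ → ℕ
      M = cell (n ∷ k ∷ matrix (Graph.adj G))
      reads : ∀ u v → M (2 + ix n (toℕ u) (toℕ v)) ≡ bit (Graph.adj G u v)
      reads = cell-matrix (Graph.adj G)
      open Main s b s-computable b-computable G k k ≤-refl M (wide CG (k + 2)) (Graph.adj G) (λ _ _ e → e)
      open CoverMain (con 1 ⊕ (sz 1F ⊕ sz 1F)) romanF (con 0 ≐ con 0) 2 (sz 3F)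
      open Balls (Graph.adj G)
      n<N : n < ν
      n<N = s≤s (m≤m+n n n)
      open Dominated M n ν k (ν * n) R W 2 k n<N

      row⁻ : ∀ x (a : Vertex G) → x < ν → row x (toℕ a) → (∃ λ w → x ≡ toℕ w × Near G w a) ⊎ (x ≡ n + toℕ a)
      row⁻ x a x< r with table⁻ M 1F romanF σ [] (ix n x (toℕ a)) (ix< x< (toℕ<n a)) r
      ... | inj₁ (w , v , eq , near) with *+-injective n (toℕ<n a) (toℕ<n v) eq
      ...   | e₁ , e₂ with toℕ-injective e₂
      ...     | refl = inj₁ (w , e₁ , near⁻ G 2 M reads w a near)
      row⁻ x a x< r | inj₂ (v , eq) with *+-injective n (toℕ<n a) (toℕ<n v) eq
      ...   | e₁ , e₂ = inj₂ (trans e₁ (cong (n +_) (sym e₂)))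

      near-row : ∀ w a → Near G w a → row (toℕ w) (toℕ a)
      near-row w a near = table⁺ M 1F romanF σ [] (ix n (toℕ w) (toℕ a)) (ix< (<-trans (toℕ<n w) n<N) (toℕ<n a)) (inj₁ (w , a , refl , near⁺ G 2 M reads w a near))

      single< : ∀ (a : Vertex G) → n + toℕ a < ν
      single< a = s≤s (+-monoʳ-≤ n (<⇒≤ (toℕ<n a)))

      single-row : ∀ a → row (n + toℕ a) (toℕ a)
      single-row a = table⁺ M 1F romanF σ [] (ix n (n + toℕ a) (toℕ a)) (ix< (single< a) (toℕ<n a)) (inj₂ (a , refl))

      rows : Rows G (Graph.adj G) (λ _ _ e → e) (k + 2) ν row
      rows x with suc (toℕ x) ≤? n
      ... | yes x<n = inj₂ (w , 1 , ≤-trans (s≤s z≤n) (m≤n+m 2 k) , (λ a r → f a (row⁻ (toℕ x) a (toℕ<n x) r)) ,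
                        λ a B → subst (λ z → row z (toℕ a)) (toℕ-fromℕ< x<n) (near-row w a (ball-1⁻ (Graph.adj G) B)))
        where
        w = fromℕ< x<n
        f : ∀ a → (∃ λ w → toℕ x ≡ toℕ w × Near G w a) ⊎ (toℕ x ≡ n + toℕ a) → Ball 1 w a
        f a (inj₁ (w′ , e , near)) = ball-1⁺ (Graph.adj G) (subst (λ z → Near G z a) (toℕ-injective (trans (sym e) (sym (toℕ-fromℕ< x<n)))) near)
        f a (inj₂ e)               = contradiction (subst (_< n) e x<n) (≤⇒≯ (m≤m+n n (toℕ a)))
      ... | no x≮n with any? (λ a → toℕ x ≟ n + toℕ a)
      ...   | yes (z , e) = inj₂ (z , 0 , z≤n , (λ a r → g a (row⁻ (toℕ x) a (toℕ<n x) r)) , λ { a refl → subst (λ y → row y (toℕ a)) (sym e) (single-row a) })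
        where
        g : ∀ a → (∃ λ w → toℕ x ≡ toℕ w × Near G w a) ⊎ (toℕ x ≡ n + toℕ a) → z ≡ a
        g a (inj₁ (w , e′ , _)) = contradiction (subst (_< n) (sym e′) (toℕ<n w)) x≮n
        g a (inj₂ e′)           = toℕ-injective (+-cancelˡ-≡ n _ _ (trans (sym e) e′))
      ...   | no none = inj₁ λ a r → h a (row⁻ (toℕ x) a (toℕ<n x) r)
        where
        h : ∀ a → ¬ ((∃ λ w → toℕ x ≡ toℕ w × Near G w a) ⊎ (toℕ x ≡ n + toℕ a))
        h a (inj₁ (w , e′ , _)) = x≮n (subst (_< n) (sym e′) (toℕ<n w))
        h a (inj₂ e′)           = none (a , e′)

      all : ∀ (u : Vertex G) → Rd n W (toℕ u)
      all u = table⁺ M 4F (con 0 ≐ con 0) σ (R ∷ []) (toℕ u) (toℕ<n u) refl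

      last-empty : ∀ x (a : Vertex G) → suc x ≡ ν → ¬ row x (toℕ a)
      last-empty x a e r with row⁻ x a (≤-reflexive e) r
      ... | inj₁ (w , e′ , _) = <⇒≢ (<-≤-trans (toℕ<n w) (m≤m+n n n)) (trans (sym e′) (cong (_∸ 1) e))
      ... | inj₂ e′           = <⇒≢ (+-monoʳ-< n (toℕ<n a)) (trans (sym e′) (cong (_∸ 1) e))

      -- The slots left over by the chosen rows are filled with the singletons
      -- of the uncovered elements.

      yes⁻ : Covers → Problem.Yes RomanDomination (G , k)
      yes⁻ (j , y , few , choice) = value , defended , ≤-trans (≤-reflexive (roman-sum value)) (≤-trans
          (+-mono-≤ (p⊆q⇒∣p∣≤∣q∣ one⊆) (*-monoʳ-≤ 2 (≤-trans (p⊆q⇒∣p∣≤∣q∣ two⊆) (chosen-card y choice)))) few)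
        where
        X = chosen y
        U = uncovered y
        value : Vertex G → Fin 3
        value v with v ∈? X | v ∈? U
        ... | yes _ | _     = 2F
        ... | no _  | yes _ = 1F
        ... | no _  | no _  = 0F
        value-0 : ∀ v → value v ≡ 0F → v ∉ X × v ∉ U
        value-0 v e with v ∈? X | v ∈? U
        value-0 v () | yes _ | _
        value-0 v () | no _  | yes _
        ... | no v∉X | no v∉U = v∉X , v∉U
        value-1 : ∀ v → value v ≡ 1F → v ∈ U
        value-1 v e with v ∈? X | v ∈? U
        value-1 v () | yes _ | _
        value-1 v () | no _  | no _
        ... | no _ | yes v∈U = v∈U
        value-2 : ∀ v → value v ≡ 2F → v ∈ X
        value-2 v e with v ∈? X | v ∈? U
        ... | yes v∈X | _ = v∈X
        value-2 v () | no _ | yes _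
        value-2 v () | no _ | no _
        value-chosen : ∀ v → v ∈ X → value v ≡ 2F
        value-chosen v v∈ with v ∈? X | v ∈? U
        ... | yes _ | _   = refl
        ... | no v∉X | _  = contradiction v∈ v∉X
        one⊆ : subset (λ v → value v ≟ꟳ 1F) ⊆ U
        one⊆ {v} v∈ = value-1 v (∈-subset⁻ (λ v → value v ≟ꟳ 1F) v∈)
        two⊆ : subset (λ v → value v ≟ꟳ 2F) ⊆ X
        two⊆ {v} v∈ = value-2 v (∈-subset⁻ (λ v → value v ≟ꟳ 2F) v∈)
        -- The weight bound gives even ∣U∣ + 2j at most k, so every uncovered core element finds a
        -- free slot.
        fits : toℕ j + ∣ U ∣ ≤ k
        fits = ≤-trans (≤-reflexive (+-comm (toℕ j) ∣ U ∣)) (≤-trans (+-monoʳ-≤ ∣ U ∣ (m≤m+n (toℕ j) _)) few)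
        slot : Fin k → Fin ν
        slot l with suc (toℕ l) ≤? toℕ j | suc (toℕ l ∸ toℕ j) ≤? ∣ U ∣
        ... | yes _ | _     = y l
        ... | no _  | yes < = fromℕ< (single< (enum U (fromℕ< <)))
        ... | no _  | no _  = y l
        slot-first : ∀ l → toℕ l < toℕ j → slot l ≡ y l
        slot-first l l<j with suc (toℕ l) ≤? toℕ j | suc (toℕ l ∸ toℕ j) ≤? ∣ U ∣
        ... | yes _ | _  = refl
        ... | no l≮j | _ = contradiction l<j l≮j
        slot-single : ∀ l i → toℕ l ≡ toℕ j + toℕ i → toℕ (slot l) ≡ n + toℕ (enum U i)
        slot-single l i e with suc (toℕ l) ≤? toℕ j | suc (toℕ l ∸ toℕ j) ≤? ∣ U ∣
        ... | yes l<j | _     = contradiction (subst (_< toℕ j) e l<j) (≤⇒≯ (m≤m+n (toℕ j) (toℕ i)))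
        ... | no _    | yes < = trans (toℕ-fromℕ< _) (cong (λ z → n + toℕ (enum U z)) (toℕ-injective (trans (toℕ-fromℕ< <) (trans (cong (_∸ toℕ j) e) (m+n∸m≡n (toℕ j) (toℕ i))))))
        ... | no _    | no ≮  = contradiction (subst (_< ∣ U ∣) (sym (trans (cong (_∸ toℕ j) e) (m+n∸m≡n (toℕ j) (toℕ i)))) (toℕ<n i)) ≮
        slot⁻ : ∀ l → (slot l ≡ y l) ⊎ (∃ λ i → toℕ (slot l) ≡ n + toℕ (enum U i))
        slot⁻ l with suc (toℕ l) ≤? toℕ j | suc (toℕ l ∸ toℕ j) ≤? ∣ U ∣
        ... | yes _ | _     = inj₁ refl
        ... | no _  | yes < = inj₂ (fromℕ< < , toℕ-fromℕ< _)
        ... | no _  | no _  = inj₁ refl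
        slot-covers : ∀ (u : Vertex G) → Rd n core (toℕ u) → ∃ λ l → row (toℕ (slot l)) (toℕ u)
        slot-covers u cu = decide (any? (λ l → row? (toℕ (y l)) (toℕ u)))
          where
          by-choice : ∀ l → row (toℕ (y l)) (toℕ u) → (toℕ (y l) < n × toℕ l < toℕ j) ⊎ (suc (toℕ (y l)) ≡ ν) → ∃ λ l → row (toℕ (slot l)) (toℕ u)
          by-choice l r (inj₁ (_ , l<j)) = l , subst (λ z → row (toℕ z) (toℕ u)) (sym (slot-first l l<j)) r
          by-choice l r (inj₂ last)      = contradiction r (last-empty (toℕ (y l)) u last)
          by-single : (∃ λ i → enum U i ≡ u) → ∃ λ l → row (toℕ (slot l)) (toℕ u)
          by-single (i , refl) = let l< = <-≤-trans (+-monoʳ-< (toℕ j) (toℕ<n i)) fits in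
            fromℕ< l< , subst (λ z → row z (toℕ u)) (sym (slot-single (fromℕ< l<) i (toℕ-fromℕ< l<))) (single-row u)
          decide : Dec (∃ λ l → row (toℕ (y l)) (toℕ u)) → ∃ λ l → row (toℕ (slot l)) (toℕ u)
          decide (yes (l , r)) = by-choice l r (choice l)
          decide (no none)     = by-single (enum-surjective U (∈-uncovered y u cu none))
        -- The k slots cover the core and hence v. A singleton slot containing v would put v into
        -- `U`, so v lies in the neighbourhood of a chosen vertex, which differs from v as v is not
        -- in `X`.
        defended : ∀ v → value v ≡ 0F → ∃ λ x → Edge G v x × value x ≡ 2F
        defended v e = let l , r = core-covers v (all v) slot (λ u cu _ → slot-covers u cu) in
            by l (row⁻ (toℕ (slot l)) v (toℕ<n (slot l)) r) (slot⁻ l)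
          where
          v∉ : v ∉ X × v ∉ U
          v∉ = value-0 v e
          neighbour : ∀ w → w ∈ X → Near G w v → ∃ λ x → Edge G v x × value x ≡ 2F
          neighbour w w∈ (inj₁ refl) = contradiction w∈ (proj₁ v∉)
          neighbour w w∈ (inj₂ edge) = w , subst T (Graph.sym G w v) edge , value-chosen w w∈
          not-single : ∀ l → (toℕ (y l) < n × toℕ l < toℕ j) ⊎ (suc (toℕ (y l)) ≡ ν) → toℕ (y l) ≢ n + toℕ v
          not-single l (inj₁ (yl< , _)) eq = <⇒≱ yl< (subst (n ≤_) (sym eq) (m≤m+n n _))
          not-single l (inj₂ last)      eq = <⇒≢ (+-monoʳ-< n (toℕ<n v)) (trans (sym eq) (cong (_∸ 1) last))
          by : ∀ l → (∃ λ w → toℕ (slot l) ≡ toℕ w × Near G w v) ⊎ (toℕ (slot l) ≡ n + toℕ v) →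
               (slot l ≡ y l) ⊎ (∃ λ i → toℕ (slot l) ≡ n + toℕ (enum U i)) → ∃ λ x → Edge G v x × value x ≡ 2F
          by l (inj₁ (w , e₁ , near)) (inj₁ e₂)       = neighbour w (∈-chosen y l (trans (cong toℕ (sym e₂)) e₁)) near
          by l (inj₁ (w , e₁ , _))    (inj₂ (i , e₂)) = contradiction (subst (_< n) (trans (sym e₁) e₂) (toℕ<n w)) (≤⇒≯ (m≤m+n n _))
          by l (inj₂ e₁)              (inj₁ e₂)       = contradiction (sym (trans (sym e₁) (cong toℕ e₂))) (not-single l (choice l))
          by l (inj₂ e₁)              (inj₂ (i , e₂)) =
            contradiction (subst (_∈ U) (toℕ-injective (+-cancelˡ-≡ n _ _ (trans (sym e₂) e₁))) (enum-∈ U i)) (proj₂ v∉)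

      -- The vertices of value 2 are taken as rows; a core element that they miss is not defended,
      -- so it must have value 1 and is paid for by the sum.
      yes⁺ : Problem.Yes RomanDomination (G , k) → Covers
      yes⁺ (value , defended , sum≤) = fromℕ< (s≤s X≤k) , y ,
          subst (λ j → ∣ uncovered y ∣ + 2 * j ≤ k) (sym (toℕ-fromℕ< (s≤s X≤k))) (≤-trans (+-monoˡ-≤ (2 * ∣ X ∣) (p⊆q⇒∣p∣≤∣q∣ uncovered⊆)) weight) ,
          λ l → subst (λ j → (toℕ (y l) < n × toℕ l < j) ⊎ (suc (toℕ (y l)) ≡ ν)) (sym (toℕ-fromℕ< (s≤s X≤k))) (padded-choice n<N X l)
        where
        X = subset (λ v → value v ≟ꟳ 2F)
        O = subset (λ v → value v ≟ꟳ 1F)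
        y = padded n<N X
        weight : ∣ O ∣ + 2 * ∣ X ∣ ≤ k
        weight = ≤-trans (≤-reflexive (sym (roman-sum value))) sum≤
        X≤k : ∣ X ∣ ≤ k
        X≤k = ≤-trans (≤-trans (m≤m+n ∣ X ∣ _) (m≤n+m _ ∣ O ∣)) weight
        uncovered⊆ : uncovered y ⊆ O
        uncovered⊆ {u} u∈ with uncovered⁻ y u∈
        ... | cu , none with value u in e
        ...   | 0F = let x , edge , e′ = defended u e ; l , e″ = padded-onto n<N X X≤k (∈-subset⁺ (λ v → value v ≟ꟳ 2F) e′) in
                     contradiction (l , subst (λ z → row z (toℕ u)) (sym e″) (near-row x u (inj₂ (subst T (Graph.sym G u x) edge)))) none
        ...   | 1F = ∈-subset⁺ (λ v → value v ≟ꟳ 1F) e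
        ...   | 2F = let l , e″ = padded-onto n<N X X≤k (∈-subset⁺ (λ v → value v ≟ꟳ 2F) e) in
                     contradiction (l , subst (λ z → row z (toℕ u)) (sym e″) (near-row u u (inj₁ refl))) none

      correct : Decides Q M romanE [] [] (Problem.Yes RomanDomination (G , k))
      correct = start-decides refl refl n≤Q (const≤ (τ≤ (k≤τ ≤-refl))) (decides-map yes⁻ yes⁺ (tail-decides _ _ _ _ ≤-refl rows))

-- Sets of compatible vertices and exchange

-- Picking a set of pairwise compatible vertices that dominates W.  Domination
-- is tested on the core C of W.  Candidates are restricted to the core Z of all
-- vertices with respect to the conflict relation, formed separately for each
-- trace on C: a vertex of a solution outside Z can be exchanged for one in Z
-- with the same trace that is in conflict with no other vertex of the solution.

inF : ∀ {s} → Fin s → Fin s → Exp s 8 → Fin s → Exp s 8 → Fm s 8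
inF n m U one u = rdᶠ n (val 0F) u ∧ᶠ rdᶠ m U (ixᵉ one (rankᵉ n n (val 0F) u) (con 0))

pickF : Fm 7 8
pickF = ex 0F (
  (val 7F ≼ sum 3F (fm (inF 4F 3F (sz 1F) 8F (sz 0F)))) ∧ᶠ (sum 3F (fm (inF 4F 3F (sz 1F) 8F (sz 0F))) ≼ sz 5F) ∧ᶠ
  al 3F (al 4F ((inF 5F 4F (sz 2F) 9F (sz 1F) ∧ᶠ inF 5F 4F (sz 2F) 9F (sz 0F) ∧ᶠ ¬ᶠ (sz 1F ≐ sz 0F)) ⇒ᶠ ¬ᶠ rdᶠ 8F (val 4F) (ixᵉ 5F (sz 1F) (sz 0F)))) ∧ᶠ
  al 3F (rdᶠ 4F (val 1F) (sz 0F) ⇒ᶠ ex 4F (inF 5F 4F (sz 2F) 9F (sz 0F) ∧ᶠ rdᶠ 8F (val 3F) (ixᵉ 5F (sz 0F) (sz 1F)))))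

pickE : Exp 5 5
pickE = letv (con 0) (letv (proc (0F ∷ 1F ∷ 2F ∷ 3F ∷ 3F ∷ []) (1F ∷ 3F ∷ 0F ∷ 0F ∷ []) coreE coreV coreV-spec)
  (letv (proc (0F ∷ 1F ∷ 2F ∷ 3F ∷ 3F ∷ []) (3F ∷ 5F ∷ 2F ∷ 0F ∷ []) coreE coreV coreV-spec)
  (lets (mulᵉ 4F (rankᵉ 0F 0F (val 0F) (sz 0F))) (lets (p2E 0F) (fm pickF)))))

module Pick (M : ℕ → ℕ) (n N k lR D F W A lo : ℕ) where

  module First = Core M n N k lR lR D W 0 0
  C = First.core
  module Second = Core M n N k lR lR F A D C
  Z = Second.core

  rowD rowF : ℕ → ℕ → Set
  rowD = First.row
  rowF = Second.row

  Picked : Subset n → Set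
  Picked X = lo ≤ ∣ X ∣ × ∣ X ∣ ≤ k × (∀ u v → u ∈ X → v ∈ X → u ≢ v → ¬ rowF (toℕ u) (toℕ v)) ×
    (∀ (w : Fin n) → Rd n C (toℕ w) → ∃ λ u → u ∈ X × rowD (toℕ u) (toℕ w))

  Picks : Set
  Picks = ∃ λ X → (∀ u → u ∈ X → Rd n Z (toℕ u)) × Picked X

  private
    t = rank n n Z n
    σ₀ : Vec ℕ 7
    σ₀ = p2 (t * 1) ∷ t * 1 ∷ n ∷ N ∷ k ∷ lR ∷ 1 ∷ []
    ρ₀ : Vec ℕ 8
    ρ₀ = Z ∷ C ∷ 0 ∷ D ∷ F ∷ W ∷ A ∷ lo ∷ []

    In : Fin (p2 (t * 1)) → Fin n → Set
    In U u = Rd n Z (toℕ u) × Rd (t * 1) (toℕ U) (ix 1 (rank n n Z (toℕ u)) 0)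

    in? : ∀ U u → Dec (In U u)
    in? U u = rd? n Z (toℕ u) ×-dec rd? (t * 1) (toℕ U) (ix 1 (rank n n Z (toℕ u)) 0)

    count-in : ∀ U → eval M (sum 3F (fm (inF 4F 3F (sz 1F) 8F (sz 0F)))) (toℕ U ∷ σ₀) ρ₀ ≡ ∣ subset (in? U) ∣
    count-in U = count-fm M 3F (inF 4F 3F (sz 1F) 8F (sz 0F)) (toℕ U ∷ σ₀) ρ₀ (in? U) (λ u s → s) (λ u s → s)

  pick⁻ : Sem M pickF σ₀ ρ₀ → Picks
  pick⁻ (U , lo≤ , ≤k , compatible , dominates) = subset (in? U) , (λ u u∈ → proj₁ (∈-subset⁻ (in? U) u∈)) ,
    subst (lo ≤_) (count-in U) lo≤ , subst (_≤ k) (count-in U) ≤k ,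
    (λ u v u∈ v∈ u≢v → compatible u v (∈-subset⁻ (in? U) u∈ , ∈-subset⁻ (in? U) v∈ , λ e → u≢v (toℕ-injective e))) ,
    λ w cw → let u , u∈ , d = dominates w cw in u , ∈-subset⁺ (in? U) u∈ , d

  pick⁺ : Picks → Sem M pickF σ₀ ρ₀
  pick⁺ (X , X⊆Z , lo≤ , ≤k , compatible , dominates) = U , subst (lo ≤_) (sym card) lo≤ , subst (_≤ k) (sym card) ≤k ,
    (λ u v (u∈ , v∈ , u≢v) → compatible u v (in⇒X u∈) (in⇒X v∈) (λ e → u≢v (cong toℕ e))) ,
    λ w cw → let u , u∈ , d = dominates w cw in u , X⇒in u∈ , d
    where
    guessed = guess₂ {k = 1} {t} (λ u → rd? n Z (toℕ u)) (λ u → rank n n Z (toℕ u)) (λ u zu → rank-mono-< {n} {n} {Z} (toℕ<n u) (toℕ<n u) zu)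
                (λ u v zu zv → rank-injective n Z u v zu zv) {B = λ u _ → u ∈ X} (λ u _ → u ∈? X)
    U = proj₁ guessed
    in⇒X : ∀ {u} → In U u → u ∈ X
    in⇒X {u} (zu , r) = proj₁ (proj₂ guessed u 0F zu) r
    X⇒in : ∀ {u} → u ∈ X → In U u
    X⇒in {u} u∈ = X⊆Z u u∈ , proj₂ (proj₂ guessed u 0F (X⊆Z u u∈)) u∈
    card : eval M (sum 3F (fm (inF 4F 3F (sz 1F) 8F (sz 0F)))) (toℕ U ∷ σ₀) ρ₀ ≡ ∣ X ∣
    card = trans (count-in U) (cong ∣_∣ (⊆-antisym (λ {u} u∈ → in⇒X (∈-subset⁻ (in? U) u∈)) (λ {u} u∈ → ∈-subset⁺ (in? U) (X⇒in u∈))))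

  pick-decides : ∀ {Q} → (∀ v → v ≤ n → p2 (∣ First.earlier v ∣ * k) ≤ Q) → (∀ v → v ≤ n → p2 (∣ Second.earlier v ∣ * k) ≤ Q) →
                 p2 (∣ Second.earlier n ∣ * 1) ≤ Q → Decides Q M pickE (n ∷ N ∷ k ∷ lR ∷ 1 ∷ []) (D ∷ F ∷ W ∷ A ∷ lo ∷ []) Picks
  pick-decides {Q} small₁ small₂ small = decides-letv con refl (decides-letv {x = C} (proc (First.core-safe small₁)) refl
    (decides-letv {x = Z} (proc (Second.core-safe small₂)) refl
    (decides-lets {x = t * 1} (static-safe _ _ _ _) refl (≤-trans (n≤p2 _) P≤) (decides-lets {x = p2 (t * 1)} (static-safe _ _ _ _) refl P≤
      (decides (static-safe _ _ _ _) (reflect-map pick⁻ pick⁺ (fm-reflects {M = M} pickF σ₀ ρ₀)))))))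
    where
    P≤ : p2 (t * 1) ≤ Q
    P≤ = ≤-trans (p2-mono (*-monoˡ-≤ 1 (≤-reflexive (rank-card n n Z n)))) small

module Exchange (M : ℕ → ℕ) (n N k lR D F W A lo : ℕ) (n<N : n < N) {Dom Conf : Fin n → Fin n → Set}
  (rowD⇒ : ∀ x y → x < N → Rd lR D (ix n x (toℕ y)) → ∃ λ w → x ≡ toℕ w × Dom w y) (⇒rowD : ∀ w y → Dom w y → Rd lR D (ix n (toℕ w) (toℕ y)))
  (rowF⇒ : ∀ x y → x < N → Rd lR F (ix n x (toℕ y)) → ∃ λ w → x ≡ toℕ w × Conf w y) (⇒rowF : ∀ w y → Conf w y → Rd lR F (ix n (toℕ w) (toℕ y)))
  (conf-refl : ∀ w → Conf w w) (conf-sym : ∀ v w → Conf v w → Conf w v) (all : ∀ (u : Fin n) → Rd n A (toℕ u)) where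

  open Pick M n N k lR D F W A lo

  Solution : Subset n → Set
  Solution X = lo ≤ ∣ X ∣ × ∣ X ∣ ≤ k × (∀ u v → u ∈ X → v ∈ X → u ≢ v → ¬ Conf u v) × (∀ w → Rd n W (toℕ w) → ∃ λ u → u ∈ X × Dom u w)

  rowD⁻ : ∀ w y → rowD (toℕ w) (toℕ y) → Dom w y
  rowD⁻ w y r = let w′ , e , d = rowD⇒ (toℕ w) y (<-trans (toℕ<n w) n<N) r in subst (λ z → Dom z y) (toℕ-injective (sym e)) d

  rowF⁻ : ∀ w y → rowF (toℕ w) (toℕ y) → Conf w y
  rowF⁻ w y r = let w′ , e , d = rowF⇒ (toℕ w) y (<-trans (toℕ<n w) n<N) r in subst (λ z → Conf z y) (toℕ-injective (sym e)) d

  picks⇒solution : Picks → ∃ Solution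
  picks⇒solution (X , _ , lo≤ , ≤k , compatible , dominates) = X , lo≤ , ≤k ,
    (λ u v u∈ v∈ u≢v c → compatible u v u∈ v∈ u≢v (⇒rowF u v c)) , dominated
    where
    y : Fin k → Fin N
    y = padded n<N X
    dominated : ∀ w → Rd n W (toℕ w) → ∃ λ u → u ∈ X × Dom u w
    dominated w ww with First.core-covers w ww y (λ u cu _ → let x , x∈ , d = dominates u cu ; l , e = padded-onto n<N X ≤k x∈ in
                                                     l , subst (λ z → rowD z (toℕ u)) (sym e) d)
    ... | l , r with rowD⇒ (toℕ (y l)) w (toℕ<n (y l)) r
    ...   | u , e , d = u , padded-∈ n<N X l e , d

  module _ {j : ℕ} (j≤k : j ≤ k) where

    Good : (Fin j → Fin n) → Set
    Good g = (∀ i i′ → i ≢ i′ → ¬ Conf (g i) (g i′)) × (∀ w → Rd n C (toℕ w) → ∃ λ i → Dom (g i) w)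

    module _ (g : Fin j → Fin n) (good : Good g) (c : Fin j) where

      others : Fin k → Fin N
      others l with suc (toℕ l) ≤? j
      ... | no  _  = fromℕ< {N ∸ 1} (≤-reflexive (m+[n∸m]≡n {1} (≤-trans (s≤s z≤n) n<N)))
      ... | yes l< with fromℕ< l< ≟ꟳ c
      ...   | yes _ = fromℕ< {N ∸ 1} (≤-reflexive (m+[n∸m]≡n {1} (≤-trans (s≤s z≤n) n<N)))
      ...   | no  _ = fromℕ< (<-trans (toℕ<n (g (fromℕ< l<))) n<N)

      others⁻ : ∀ l w → toℕ (others l) ≡ toℕ w → ∃ λ i → i ≢ c × g i ≡ w
      others⁻ l w e with suc (toℕ l) ≤? j
      ... | no  _  = contradiction (subst (_< n) (trans (sym e) (toℕ-fromℕ< _)) (toℕ<n w)) (≤⇒≯ (s≤s⁻¹ (≤-trans n<N (≤-reflexive (sym (m+[n∸m]≡n {1} (≤-trans (s≤s z≤n) n<N)))))))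
      ... | yes l< with fromℕ< l< ≟ꟳ c
      ...   | yes _ = contradiction (subst (_< n) (trans (sym e) (toℕ-fromℕ< _)) (toℕ<n w)) (≤⇒≯ (s≤s⁻¹ (≤-trans n<N (≤-reflexive (sym (m+[n∸m]≡n {1} (≤-trans (s≤s z≤n) n<N)))))))
      ...   | no ≢c = fromℕ< l< , ≢c , toℕ-injective (trans (sym (toℕ-fromℕ< _)) e)

      others⁺ : ∀ i → i ≢ c → ∃ λ l → toℕ (others l) ≡ toℕ (g i)
      others⁺ i i≢c = l , hit
        where
        l = fromℕ< (<-≤-trans (toℕ<n i) j≤k)
        l≡i : toℕ l ≡ toℕ i
        l≡i = toℕ-fromℕ< (<-≤-trans (toℕ<n i) j≤k)
        hit : toℕ (others l) ≡ toℕ (g i)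
        hit with suc (toℕ l) ≤? j
        ... | no ≮ = contradiction (subst (_< j) (sym l≡i) (toℕ<n i)) ≮
        ... | yes l< with fromℕ< l< ≟ꟳ c
        ...   | yes e = contradiction (trans (toℕ-injective (trans (sym l≡i) (sym (toℕ-fromℕ< l<)))) e) i≢c
        ...   | no _  = trans (toℕ-fromℕ< _) (cong (toℕ ∘ g) (toℕ-injective (trans (toℕ-fromℕ< l<) l≡i)))

      Fit : Fin n → Set
      Fit z = Rd n Z (toℕ z) × Second.Same (toℕ z) (toℕ (g c)) × (∀ i → i ≢ c → ¬ Conf (g i) z)

      covered? : ∀ (z : Fin n) → Dec (∃ λ l → rowF (toℕ (others l)) (toℕ z))
      covered? z = any? λ l → Second.row? (toℕ (others l)) (toℕ z)

      same? : ∀ u v → Dec (Second.Same u v)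
      same? u v = all? {n} λ w → rd? n C (toℕ w) →-dec
        ((rd? lR D (ix n u (toℕ w)) →-dec rd? lR D (ix n v (toℕ w))) ×-dec (rd? lR D (ix n v (toℕ w)) →-dec rd? lR D (ix n u (toℕ w))))

      -- The conflict rows of the other members fill the k slots of `others`, with an empty row in
      -- place of c. If each element of the second core with the trace of `g c` were in conflict
      -- with one of them, these rows would cover `g c` too, contradicting compatibility.
      fit : ∃ Fit
      fit with any? {n} (λ z → rd? n Z (toℕ z) ×-dec same? (toℕ z) (toℕ (g c)) ×-dec ¬? (covered? z))
      ... | yes (z , zz , same , free) = z , zz , same , λ i i≢c conf → let l , e = others⁺ i i≢c in
        free (l , subst (λ x → rowF x (toℕ z)) (sym e) (⇒rowF (g i) z conf))
      ... | no none with Second.core-covers (g c) (all (g c)) others covers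
        where
        covers : ∀ (u : Fin n) → Rd n Z (toℕ u) → Second.Same (toℕ u) (toℕ (g c)) → ∃ λ l → rowF (toℕ (others l)) (toℕ u)
        covers u zu same with covered? u
        ... | yes r = r
        ... | no ¬r = contradiction (u , zu , same , ¬r) none
      ...   | l , r with rowF⇒ (toℕ (others l)) (g c) (toℕ<n (others l)) r
      ...     | w , e , conf with others⁻ l w e
      ...       | i , i≢c , refl = contradiction conf (proj₁ good i c i≢c)

      replaced : Fin j → Fin n
      replaced i with i ≟ꟳ c
      ... | yes _ = proj₁ fit
      ... | no  _ = g i

      replaced-c : ∀ i → i ≡ c → replaced i ≡ proj₁ fit
      replaced-c i e with i ≟ꟳ c
      ... | yes _ = refl
      ... | no ≢c = contradiction e ≢c

      replaced-other : ∀ i → i ≢ c → replaced i ≡ g i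
      replaced-other i i≢c with i ≟ꟳ c
      ... | yes e = contradiction e i≢c
      ... | no _  = refl

      replaced-good : Good replaced
      replaced-good = compatible , dominates
        where
        z = proj₁ fit
        free = proj₂ (proj₂ (proj₂ fit))
        compatible : ∀ i i′ → i ≢ i′ → ¬ Conf (replaced i) (replaced i′)
        compatible i i′ i≢i′ conf with i ≟ꟳ c | i′ ≟ꟳ c
        ... | yes e | yes e′ = i≢i′ (trans e (sym e′))
        ... | yes _ | no ≢c  = free i′ ≢c (conf-sym _ _ conf)
        ... | no ≢c | yes _  = free i ≢c conf
        ... | no _  | no _   = proj₁ good i i′ i≢i′ conf
        dominates : ∀ w → Rd n C (toℕ w) → ∃ λ i → Dom (replaced i) w
        dominates w cw with proj₂ good w cw
        ... | i , d with i ≟ꟳ c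
        ...   | no ≢c = i , subst (λ x → Dom x w) (sym (replaced-other i ≢c)) d
        ...   | yes refl = i , subst (λ x → Dom x w) (sym (replaced-c i refl)) (rowD⁻ z w (proj₂ (proj₁ (proj₂ (proj₂ fit)) w cw) (⇒rowD (g i) w d)))

    -- Positions are treated in turn. A replacement has the trace of the old member, so the first
    -- core stays dominated, and the positions treated before keep their vertices.
    exchange : ∀ c → c ≤ j → (∃ λ g → Good g) → ∃ λ g → Good g × (∀ i → toℕ i < c → Rd n Z (toℕ (g i)))
    exchange zero    _   (g , good) = g , good , λ i ()
    exchange (suc c) c<j given with exchange c (<⇒≤ c<j) given
    ... | g , good , within = replaced g good i₀ , replaced-good g good i₀ , within′
      where
      i₀ = fromℕ< c<j
      within′ : ∀ i → toℕ i < suc c → Rd n Z (toℕ (replaced g good i₀ i))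
      within′ i i≤c = decide (i ≟ꟳ i₀)
        where
        decide : Dec (i ≡ i₀) → Rd n Z (toℕ (replaced g good i₀ i))
        decide (yes e) = subst (λ x → Rd n Z (toℕ x)) (sym (replaced-c g good i₀ i e)) (proj₁ (proj₂ (fit g good i₀)))
        decide (no ne) = subst (λ x → Rd n Z (toℕ x)) (sym (replaced-other g good i₀ i ne))
          (within i (≤∧≢⇒< (s≤s⁻¹ i≤c) (λ e → ne (toℕ-injective (trans e (sym (toℕ-fromℕ< c<j)))))))

  solution⇒picks : ∃ Solution → Picks
  solution⇒picks (X , lo≤ , ≤k , compatible , dominates) with exchange ≤k ∣ X ∣ ≤-refl (enum X , initially)
    where
    initially : Good ≤k (enum X)
    initially = (λ i i′ i≢i′ → compatible _ _ (enum-∈ X i) (enum-∈ X i′) (λ e → i≢i′ (enum-injective X i i′ e))) ,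
      λ w cw → let u , u∈ , d = dominates w (proj₁ (First.core⁻ w cw)) ; i , e = enum-surjective X u∈ in i , subst (λ x → Dom x w) (sym e) d
  ... | g , (compatible′ , dominates′) , within = Y , (λ u u∈ → let i , e = Y⁻ u∈ in subst (λ x → Rd n Z (toℕ x)) e (within i (toℕ<n i))) ,
    ≤-trans lo≤ (card-≥ Y g (λ i → Y⁺ i) (λ i i′ e → injective i i′ e)) ,
    ≤-trans (card-≤ Y ∣ X ∣ (λ x l → ∃ λ i → toℕ i ≡ l × g i ≡ x) (λ x x∈ → let i , e = Y⁻ x∈ in toℕ i , toℕ<n i , i , refl , e)
      λ { x x′ _ (i , refl , e) (i′ , e′ , e″) → trans (sym e) (trans (cong g (toℕ-injective (sym e′))) e″) }) ≤k ,
    (λ u v u∈ v∈ u≢v r → let i , e = Y⁻ u∈ ; i′ , e′ = Y⁻ v∈ in compatible′ i i′ (λ q → u≢v (trans (sym e) (trans (cong g q) e′)))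
      (subst₂ Conf (sym e) (sym e′) (rowF⁻ u v r))) ,
    λ w cw → let i , d = dominates′ w cw in g i , Y⁺ i , ⇒rowD (g i) w d
    where
    Y = subset (λ x → any? λ i → g i ≟ꟳ x)
    Y⁻ : ∀ {x} → x ∈ Y → ∃ λ i → g i ≡ x
    Y⁻ = ∈-subset⁻ (λ x → any? λ i → g i ≟ꟳ x)
    Y⁺ : ∀ i → g i ∈ Y
    Y⁺ i = ∈-subset⁺ (λ x → any? λ i → g i ≟ꟳ x) (i , refl)
    -- As every vertex is in conflict with itself, compatible members are distinct, and the
    -- exchanged set is as large as the original.
    injective : ∀ i i′ → g i ≡ g i′ → i ≡ i′
    injective i i′ e with i ≟ꟳ i′
    ... | yes eq = eq
    ... | no ne  = contradiction (subst (λ x → Conf (g i) x) e (conf-refl (g i))) (compatible′ i i′ ne)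

-- Independence, efficient domination, perfect codes and kernels

-- With arcs u → v read from the input, w dominates v if w = v or v → w.

domF : Fm 8 1
domF = sz 1F ≐ sz 0F ∨ᶠ adjᶠ 2 7F (sz 0F) (sz 1F)

-- The number c switches domination: `W` consists of all vertices for c = 0 and is empty for c = 1.
-- With `lo` equal to k the size is prescribed exactly.
pickTail : Fm 8 2 → ℕ → Exp 5 4 → Exp 2 0
pickTail ψ c lo = lets (con 1 ⊕ sz 1F) (lets (mulᵉ 2F (sz 0F)) (lets (con 1)
  (letv (tableᵉ 1F (relF 4F domF)) (letv (tableᵉ 1F (relF 4F ψ)) (letv (tableᵉ 4F (con 0 ≐ con c)) (letv (tableᵉ 4F (con 0 ≐ con 0)) (letv lo
    (proc (4F ∷ 2F ∷ 3F ∷ 1F ∷ 0F ∷ []) (4F ∷ 3F ∷ 2F ∷ 1F ∷ 0F ∷ []) pickE (λ M → eval M pickE) (λ _ _ _ → refl)))))))))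

module PickMain (s : ℕ → ℕ) (b : ℕ → ℕ → ℕ) (s-computable : Computable s) (b-computable : Computable₂ b)
  (G : Graph) (k : ℕ) (M : ℕ → ℕ) (uqw : ∀ m → Wide G (k + 2) (s (k + 2)) m (b (k + 2) m))
  (arc : Vertex G → Vertex G → Bool) (arc⊆ : ∀ u v → T (arc v u) → Edge G u v)
  (reads : ∀ u v → M (2 + ix (order G) (toℕ u) (toℕ v)) ≡ bit (arc u v)) where

  open Main s b s-computable b-computable G k k ≤-refl M uqw (λ w a → arc a w) arc⊆ public

  private
    n = order G

  Dom : Vertex G → Vertex G → Set
  Dom w a = w ≡ a ⊎ T (arc a w)

  module WithConflict (ψ : Fm 8 2) (Conf : Vertex G → Vertex G → Set)
    (conf⁻ : ∀ w a σ ρ → Sem M ψ (toℕ a ∷ toℕ w ∷ ix n (toℕ w) (toℕ a) ∷ 1 ∷ σ ∷ suc n ∷ k ∷ n ∷ []) ρ → Conf w a)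
    (conf⁺ : ∀ w a σ ρ → Conf w a → Sem M ψ (toℕ a ∷ toℕ w ∷ ix n (toℕ w) (toℕ a) ∷ 1 ∷ σ ∷ suc n ∷ k ∷ n ∷ []) ρ)
    (conf-refl : ∀ w → Conf w w) (conf-sym : ∀ v w → Conf v w → Conf w v)
    (conf-ball : ∀ w → ∃ λ i → i ≤ k + 2 × (∀ a → Conf w a → Balls.Ball (Graph.adj G) i w a) × (∀ a → Balls.Ball (Graph.adj G) i w a → Conf w a))
    (c : ℕ) (lo : Exp 5 4) where

    private
      N′ l D F W A least : ℕ
      N′ = suc n
      l = N′ * n
      σ : Vec ℕ 5
      σ = 1 ∷ l ∷ N′ ∷ k ∷ n ∷ []
      D = upto M 1F (relF 4F domF) σ [] l
      F = upto M 1F (relF 4F ψ) σ (D ∷ []) l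
      W = upto M 4F (con 0 ≐ con c) σ (F ∷ D ∷ []) n
      A = upto M 4F (con 0 ≐ con 0) σ (W ∷ F ∷ D ∷ []) n
      least = eval M lo σ (A ∷ W ∷ F ∷ D ∷ [])

      open Pick M n N′ k l D F W A least

      rowD⇒ : ∀ x y → x < N′ → rowD x (toℕ y) → ∃ λ w → x ≡ toℕ w × Dom w y
      rowD⇒ x y x< r = let w , e , sem = rel⁻ M 4F 1F domF σ [] x (toℕ y) (toℕ<n y) (ix< x< (toℕ<n y)) r in
        w , e , [ inj₁ ∘ toℕ-injective , inj₂ ∘ bit⁻ (reads y w) ]′ sem

      ⇒rowD : ∀ w y → Dom w y → rowD (toℕ w) (toℕ y)
      ⇒rowD w y d = rel⁺ M 4F 1F domF σ [] w y (ix< (m<n⇒m<1+n (toℕ<n w)) (toℕ<n y)) (sem d)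
        where
        sem : Dom w y → toℕ w ≡ toℕ y ⊎ M (2 + ix n (toℕ y) (toℕ w)) ≢ 0
        sem (inj₁ eq) = inj₁ (cong toℕ eq)
        sem (inj₂ t)  = inj₂ (bit⁺ (reads y w) t)

      rowF⇒ : ∀ x y → x < N′ → rowF x (toℕ y) → ∃ λ w → x ≡ toℕ w × Conf w y
      rowF⇒ x y x< r = let w , e , sem = rel⁻ M 4F 1F ψ σ (D ∷ []) x (toℕ y) (toℕ<n y) (ix< x< (toℕ<n y)) r in
        w , e , conf⁻ w y l _ (subst (λ z → Sem M ψ (toℕ y ∷ toℕ w ∷ ix n z (toℕ y) ∷ σ) (upto M 1F (relF 4F ψ) σ (D ∷ []) (ix n x (toℕ y)) ∷ D ∷ [])) e sem)

      ⇒rowF : ∀ w y → Conf w y → rowF (toℕ w) (toℕ y)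
      ⇒rowF w y d = rel⁺ M 4F 1F ψ σ (D ∷ []) w y (ix< (m<n⇒m<1+n (toℕ<n w)) (toℕ<n y)) (conf⁺ w y l _ d)

      open Exchange M n N′ k l D F W A least ≤-refl rowD⇒ ⇒rowD rowF⇒ ⇒rowF conf-refl conf-sym
        (λ u → table⁺ M 4F (con 0 ≐ con 0) σ (W ∷ F ∷ D ∷ []) (toℕ u) (toℕ<n u) refl)

      rows₁ : Rows G (λ w a → arc a w) arc⊆ (k + 2) N′ rowD
      rows₁ = ball-rows G (λ w a → arc a w) arc⊆ Dom {row = rowD} N′ rowD⇒ (λ w y _ → ⇒rowD w y) λ w →
        inj₂ (1 , ≤-trans (s≤s z≤n) (m≤n+m 2 k) , (λ a d → ball-1⁺ (λ w a → arc a w) d) , λ a B → ball-1⁻ (λ w a → arc a w) B)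

      rows₂ : Rows G (Graph.adj G) (λ _ _ e → e) (k + 2) N′ rowF
      rows₂ = ball-rows G (Graph.adj G) (λ _ _ e → e) Conf {row = rowF} N′ rowF⇒ (λ w y _ → ⇒rowF w y) λ w → inj₂ (conf-ball w)

      small₁ : ∀ v → ∣ First.earlier v ∣ ≤ core₁ k
      small₁ = first-small N′ l D W rows₁

      small₂ : ∀ v → ∣ Second.earlier v ∣ ≤ core₂ k
      small₂ = core-bound G (Graph.adj G) (λ _ _ e → e) M N′ k l l F A D C (core₁ k) rows₂
        (core-size G (λ w a → arc a w) arc⊆ M N′ k l l D W 0 0 small₁) (uqw (width₂ k)) (width₂-large ≤-refl)

    Selected : Subset n → Set
    Selected X = least ≤ ∣ X ∣ × ∣ X ∣ ≤ k × (∀ u v → u ∈ X → v ∈ X → u ≢ v → ¬ Conf u v) × (0 ≡ c → ∀ w → ∃ λ u → u ∈ X × Dom u w)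

    pickTail-decides : Static (fm ψ) → Static lo → Decides Q M (pickTail ψ c lo) (k ∷ n ∷ []) [] (∃ Selected)
    pickTail-decides sψ sl = decides-map
      (λ p → let X , lo≤ , ≤k , compatible , dominates = picks⇒solution p in X , lo≤ , ≤k , compatible ,
         λ e w → dominates w (table⁺ M 4F (con 0 ≐ con c) σ (F ∷ D ∷ []) (toℕ w) (toℕ<n w) e))
      (λ (X , lo≤ , ≤k , compatible , dominates) → solution⇒picks (X , lo≤ , ≤k , compatible ,
         λ w r → dominates (table⁻ M 4F (con 0 ≐ con c) σ (F ∷ D ∷ []) (toℕ w) (toℕ<n w) r) w))
      (decides-lets {x = N′} (static-safe _ _ _ _) refl (N≤Q (s≤s (m≤m+n n n))) (decides-lets {x = l} (static-safe _ _ _ _) refl (Nn≤Q (s≤s (m≤m+n n n)))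
      (decides-lets {x = 1} (static-safe _ _ _ _) refl (const≤ (τ≤ (≤-trans (s≤s z≤n) 4≤τ)))
      (decides-letv {x = D} (static-safe _ _ _ _) refl (decides-letv {x = F} (static-safe (tableᵉ 1F (relF 4F ψ)) _ _ (table-static {m = Fin 5 ∋ 1F} {φ = relF 4F ψ} (relF-static {n = Fin 5 ∋ 4F} {ψ = ψ} sψ))) refl
      (decides-letv {x = W} (static-safe _ _ _ _) refl (decides-letv {x = A} (static-safe _ _ _ _) refl (decides-letv {x = least} (static-safe _ _ _ sl) refl
      (decides-proc (pick-decides (λ v _ → core₁-power (small₁ v)) (λ v _ → power≤Q (≤-trans (small₂ v) (core₂≤total k)) (k≤τ ≤-refl))
        (power≤Q (≤-trans (small₂ n) (core₂≤total k)) (≤-trans (s≤s z≤n) 4≤τ))))))))))))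

-- The matrix is read in both directions, so that for a digraph this is adjacency in the underlying
-- graph.
adjacentF twoStepF : Fm 8 2
adjacentF = nearF 2 7F (sz 1F) (sz 0F) ∨ᶠ adjᶠ 2 7F (sz 0F) (sz 1F)
twoStepF = adjacentF ∨ᶠ ex 7F (adjᶠ 2 8F (sz 2F) (sz 0F) ∧ᶠ adjᶠ 2 8F (sz 0F) (sz 1F))

TwoStep : ∀ G → Vertex G → Vertex G → Set
TwoStep G w a = Near G w a ⊎ ∃ λ x → Edge G w x × Edge G x a

module _ (G : Graph) where

  open Balls (Graph.adj G)

  near-ball : ∀ {r} w → ∃ λ i → i ≤ r + 2 × (∀ a → Near G w a → Ball i w a) × (∀ a → Ball i w a → Near G w a)
  near-ball {r} w = 1 , ≤-trans (s≤s z≤n) (m≤n+m 2 r) , (λ a → ball-1⁺ (Graph.adj G)) , λ a → ball-1⁻ (Graph.adj G)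

  twoStep-ball : ∀ {r} w → ∃ λ i → i ≤ r + 2 × (∀ a → TwoStep G w a → Ball i w a) × (∀ a → Ball i w a → TwoStep G w a)
  twoStep-ball {r} w = 2 , m≤n+m 2 r , to , from
    where
    to : ∀ a → TwoStep G w a → Ball 2 w a
    to a (inj₁ near)        = inj₁ (ball-1⁺ (Graph.adj G) near)
    to a (inj₂ (x , e , f)) = inj₂ (x , inj₂ (w , refl , e) , f)
    from : ∀ a → Ball 2 w a → TwoStep G w a
    from a (inj₁ B) = inj₁ (ball-1⁻ (Graph.adj G) B)
    from a (inj₂ (x , B , f)) with ball-1⁻ (Graph.adj G) B
    ... | inj₁ refl = inj₁ (inj₂ f)
    ... | inj₂ e    = inj₂ (x , e , f)

  edge-sym : ∀ u v → Edge G u v → Edge G v u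
  edge-sym u v = subst T (Graph.sym G u v)

  twoStep-sym : ∀ v w → TwoStep G v w → TwoStep G w v
  twoStep-sym v w (inj₁ near)        = inj₁ (near-sym G near)
  twoStep-sym v w (inj₂ (x , e , f)) = inj₂ (x , edge-sym x w f , edge-sym v x e)

  far⁻ : ∀ {x y} → x ≢ y → Dist≥ ⟦ G ⟧ 3 x y → ¬ TwoStep G x y
  far⁻ x≢y far (inj₁ (inj₁ eq))      = x≢y eq
  far⁻ x≢y far (inj₁ (inj₂ e))       = contradiction (far 1 (e ∷ [])) λ { (s≤s ()) }
  far⁻ x≢y far (inj₂ (_ , e , f))    = contradiction (far 2 (e ∷ f ∷ [])) λ { (s≤s (s≤s ())) }

  far⁺ : ∀ {x y} → ¬ TwoStep G x y → Dist≥ ⟦ G ⟧ 3 x y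
  far⁺ ¬two zero                []           = contradiction (inj₁ (inj₁ refl)) ¬two
  far⁺ ¬two (suc zero)          (e ∷ [])     = contradiction (inj₁ (inj₂ e)) ¬two
  far⁺ ¬two (suc (suc zero))    (e ∷ f ∷ []) = contradiction (inj₂ (_ , e , f)) ¬two
  far⁺ ¬two (suc (suc (suc l))) _            = s≤s (s≤s (s≤s z≤n))

  dominating⁻ : ∀ {X} → Dominating G 1 X → ∀ w → ∃ λ u → u ∈ X × Near G u w
  dominating⁻ dom w = let u , u∈ , d = dom w ∈⊤ in u , u∈ , near-sym G (N⇒near G d)

  dominating⁺ : ∀ {X} → (∀ w → ∃ λ u → u ∈ X × Near G u w) → Dominating G 1 X
  dominating⁺ dom w _ = let u , u∈ , d = dom w in u , u∈ , near⇒N G (near-sym G d)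

  independent⁻ : ∀ {X} → Independent G X → ∀ u v → u ∈ X → v ∈ X → u ≢ v → ¬ Near G u v
  independent⁻ ind u v u∈ v∈ u≢v (inj₁ eq) = u≢v eq
  independent⁻ ind u v u∈ v∈ u≢v (inj₂ e)  = ind u v u∈ v∈ e

  independent⁺ : ∀ {X} → (∀ u v → u ∈ X → v ∈ X → u ≢ v → ¬ Near G u v) → Independent G X
  independent⁺ ind u v u∈ v∈ e = ind u v u∈ v∈ (λ { refl → subst T (Graph.irrefl G u) e }) (inj₂ e)

T-∨ˡ : ∀ a b → T a → T (a ∨ b)
T-∨ˡ a b t = Equivalence.from (T-∨ {a} {b}) (inj₁ t)

T-∨⁻ : ∀ a b → T (a ∨ b) → T a ⊎ T b
T-∨⁻ a b = Equivalence.to (T-∨ {a} {b})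

module PickSetting {ℓ} (C : GraphClass ℓ) (s : ℕ → ℕ) (b : ℕ → ℕ → ℕ) (uqw : UniformlyQuasiWide C s b)
  (s-computable : Computable s) (b-computable : Computable₂ b) where

  open Setting C s b uqw s-computable b-computable public

  independentTail efficientTail independentDominatingTail : Exp 2 0
  independentTail           = pickTail adjacentF 1 (sz 3F)
  efficientTail             = pickTail twoStepF 0 (sz 3F)
  independentDominatingTail = pickTail adjacentF 0 (con 0)

  module Directed (G : Graph) (k : ℕ) (CG : C G) (M : ℕ → ℕ) (arc : Vertex G → Vertex G → Bool) (arc⊆ : ∀ u v → T (arc v u) → Edge G u v)
    (edge⊆ : ∀ u v → Edge G u v → T (arc u v) ⊎ T (arc v u)) (reads : ∀ u v → M (2 + ix (order G) (toℕ u) (toℕ v)) ≡ bit (arc u v)) where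

    open PickMain s b s-computable b-computable G k M (wide CG (k + 2)) arc arc⊆ reads public

    Adjacent : Vertex G → Vertex G → Set
    Adjacent w a = (toℕ w ≡ toℕ a ⊎ M (2 + ix (order G) (toℕ w) (toℕ a)) ≢ 0) ⊎ M (2 + ix (order G) (toℕ a) (toℕ w)) ≢ 0

    adjacent⁻ : ∀ w a → Adjacent w a → Near G w a
    adjacent⁻ w a (inj₁ (inj₁ eq)) = inj₁ (toℕ-injective eq)
    adjacent⁻ w a (inj₁ (inj₂ ne)) = inj₂ (edge-sym G a w (arc⊆ a w (bit⁻ (reads w a) ne)))
    adjacent⁻ w a (inj₂ ne)        = inj₂ (arc⊆ w a (bit⁻ (reads a w) ne))

    adjacent⁺ : ∀ w a → Near G w a → Adjacent w a
    adjacent⁺ w a (inj₁ eq) = inj₁ (inj₁ (cong toℕ eq))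
    adjacent⁺ w a (inj₂ e) with edge⊆ w a e
    ... | inj₁ t = inj₁ (inj₂ (bit⁺ (reads w a) t))
    ... | inj₂ t = inj₂ (bit⁺ (reads a w) t)

    module WithAdjacent = WithConflict adjacentF (Near G) (λ w a _ _ → adjacent⁻ w a) (λ w a _ _ → adjacent⁺ w a)
      (λ _ → inj₁ refl) (λ _ _ → near-sym G) (near-ball G {k})

    input-decides : ∀ {e P} → M 0 ≡ order G → M 1 ≡ k → Decides Q M e (k ∷ order G ∷ []) [] P → Decides Q M (start e) [] [] P
    input-decides e₀ e₁ = start-decides e₀ e₁ n≤Q (const≤ (τ≤ (k≤τ ≤-refl)))

  module Undirected (G : Graph) (k : ℕ) (CG : C G) where

    open Directed G k CG (cell (order G ∷ k ∷ matrix (Graph.adj G))) (Graph.adj G) (λ u v → edge-sym G v u) (λ _ _ → inj₁) (cell-matrix (Graph.adj G)) public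

    private
      M = cell (order G ∷ k ∷ matrix (Graph.adj G))
      reads = cell-matrix (Graph.adj G)

    dom⇒near : ∀ {u w} → Dom u w → Near G u w
    dom⇒near (inj₁ eq) = inj₁ eq
    dom⇒near {u} {w} (inj₂ e) = inj₂ (edge-sym G w u e)

    near⇒dom : ∀ {u w} → Near G u w → Dom u w
    near⇒dom (inj₁ eq) = inj₁ eq
    near⇒dom {u} {w} (inj₂ e) = inj₂ (edge-sym G u w e)

    TwoStepRead : Vertex G → Vertex G → Set
    TwoStepRead w a = Adjacent w a ⊎ ∃ λ (x : Vertex G) → M (2 + ix (order G) (toℕ w) (toℕ x)) ≢ 0 × M (2 + ix (order G) (toℕ x) (toℕ a)) ≢ 0

    twoStep⁻ : ∀ w a → TwoStepRead w a → TwoStep G w a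
    twoStep⁻ w a (inj₁ adj)         = inj₁ (adjacent⁻ w a adj)
    twoStep⁻ w a (inj₂ (x , e , f)) = inj₂ (x , bit⁻ (reads w x) e , bit⁻ (reads x a) f)

    twoStep⁺ : ∀ w a → TwoStep G w a → TwoStepRead w a
    twoStep⁺ w a (inj₁ near)        = inj₁ (adjacent⁺ w a near)
    twoStep⁺ w a (inj₂ (x , e , f)) = inj₂ (x , bit⁺ (reads w x) e , bit⁺ (reads x a) f)

    module WithTwoStep = WithConflict twoStepF (TwoStep G) (λ w a _ _ → twoStep⁻ w a) (λ w a _ _ → twoStep⁺ w a)
      (λ _ → inj₁ (inj₁ refl)) (twoStep-sym G) (twoStep-ball G {k})

    independent-decides : Decides Q M independentTail (k ∷ order G ∷ []) [] (∃ λ X → ∣ X ∣ ≡ k × Independent G X)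
    independent-decides = decides-map
      (λ (X , ≥k , ≤k , far , _) → X , ≤-antisym ≤k ≥k , independent⁺ G far)
      (λ (X , eq , ind) → X , ≤-reflexive (sym eq) , ≤-reflexive eq , independent⁻ G ind , λ ())
      (WithAdjacent.pickTail-decides 1 (sz 3F) _ _)

    efficient-decides : Decides Q M efficientTail (k ∷ order G ∷ []) []
      (∃ λ X → ∣ X ∣ ≡ k × (∀ w → ∃ λ u → u ∈ X × Near G u w) × (∀ u v → u ∈ X → v ∈ X → u ≢ v → ¬ TwoStep G u v))
    efficient-decides = decides-map
      (λ (X , ≥k , ≤k , far , dom) → X , ≤-antisym ≤k ≥k , (λ w → let u , u∈ , d = dom refl w in u , u∈ , dom⇒near d) , far)
      (λ (X , eq , dom , far) → X , ≤-reflexive (sym eq) , ≤-reflexive eq , far , λ _ w → let u , u∈ , d = dom w in u , u∈ , near⇒dom d)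
      (WithTwoStep.pickTail-decides 0 (sz 3F) _ _)

  independentSet : FPT C IndependentSet
  independentSet = fpt IndependentSet (start independentTail) λ (G , k) CG → let open Undirected G k CG in
    input-decides refl refl independent-decides

  independentDominatingSet : FPT C IndependentDominatingSet
  independentDominatingSet = fpt IndependentDominatingSet (start independentDominatingTail) λ (G , k) CG → let open Undirected G k CG in
    input-decides refl refl (decides-map
      (λ (X , _ , ≤k , far , dom) → X , ≤k , dominating⁺ G (λ w → let u , u∈ , d = dom refl w in u , u∈ , dom⇒near d) , independent⁺ G far)
      (λ (X , ≤k , dom , ind) → X , z≤n , ≤k , independent⁻ G ind , λ _ w → let u , u∈ , d = dominating⁻ G dom w in u , u∈ , near⇒dom d)
      (WithAdjacent.pickTail-decides 0 (con 0) _ _))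

  efficientDominatingSet : FPT C EfficientDominatingSet
  efficientDominatingSet = fpt EfficientDominatingSet (start efficientTail) λ (G , k) CG → let open Undirected G k CG in
    input-decides refl refl (decides-map
      (λ (X , eq , dom , far) → X , eq , dominating⁺ G dom , λ x y x∈ y∈ x≢y → far⁺ G (far x y x∈ y∈ x≢y))
      (λ (X , eq , dom , far) → X , eq , dominating⁻ G dom , λ x y x∈ y∈ x≢y → far⁻ G x≢y (far x y x∈ y∈ x≢y))
      efficient-decides)

  -- Two members at distance at most 2 are exactly two members whose closed neighbourhoods meet; so
  -- perfect codes are the efficient dominating sets, and the program is the same.
  perfectCode : FPT C PerfectCode
  perfectCode = fpt PerfectCode (start efficientTail) λ (G , k) CG → let open Undirected G k CG in
    input-decides refl refl (decides-map
      (λ (X , eq , dom , far) → X , eq , λ v → let u , u∈ , d = dom v in u , (u∈ , near⇒N G d) ,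
        λ {y} (y∈ , d′) → unique G far u∈ y∈ d (N⇒near G d′))
      (λ (X , eq , code) → X , eq , (λ w → let u , (u∈ , d) , _ = code w in u , u∈ , N⇒near G d) ,
        λ u v u∈ v∈ u≢v two → u≢v (meet G code u∈ v∈ two))
      efficient-decides)
    where
    unique : ∀ G {X} → (∀ u v → u ∈ X → v ∈ X → u ≢ v → ¬ TwoStep G u v) → ∀ {u y v} → u ∈ X → y ∈ X → Near G u v → Near G y v → u ≡ y
    unique G far {u} {y} u∈ y∈ d d′ with u ≟ꟳ y
    ... | yes eq = eq
    ... | no ne  = contradiction (join d d′) (far u y u∈ y∈ ne)
      where
      join : ∀ {v} → Near G u v → Near G y v → TwoStep G u y
      join (inj₁ refl) d′          = inj₁ (near-sym G d′)
      join (inj₂ e)    (inj₁ refl) = inj₁ (inj₂ e)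
      join {v} (inj₂ e) (inj₂ f)   = inj₂ (v , e , edge-sym G y v f)
    meet : ∀ G {X} → (∀ v → ∃! _≡_ λ x → x ∈ X × N ⟦ G ⟧ 1 v x) → ∀ {u v} → u ∈ X → v ∈ X → TwoStep G u v → u ≡ v
    meet G code {u} {v} u∈ v∈ (inj₁ near) = let _ , _ , same = code v in
      trans (sym (same (u∈ , near⇒N G near))) (same (v∈ , near⇒N G (inj₁ refl)))
    meet G code {u} {v} u∈ v∈ (inj₂ (x , e , f)) = let _ , _ , same = code x in
      trans (sym (same (u∈ , near⇒N G (inj₂ e)))) (same (v∈ , near⇒N G (inj₂ (edge-sym G x v f))))

  -- A kernel is a set that is independent in the underlying graph and dominates against the
  -- direction of arcs, so the program for independent domination is run on the arc matrix.
  digraphKernel : FPT C DigraphKernel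
  digraphKernel = fpt DigraphKernel (start independentDominatingTail) λ (D , k) CD → correct D k CD
    where
    module _ (D : Digraph) (k : ℕ) (CD : C (underlying D)) where
      open Digraph D using (arc)
      open Directed (underlying D) k CD (cell (Digraph.order D ∷ k ∷ matrix arc)) arc
        (λ u v → subst T (∨-comm (arc v u) (arc u v)) ∘ T-∨ˡ (arc v u) (arc u v)) (λ u v → T-∨⁻ (arc u v) (arc v u)) (cell-matrix arc)
      correct : Decides Q (cell (Digraph.order D ∷ k ∷ matrix arc)) (start independentDominatingTail) [] [] (Problem.Yes DigraphKernel (D , k))
      correct = input-decides refl refl (decides-map
        (λ (X , _ , ≤k , far , dom) → X , ≤k ,
          (λ u v u∈ v∈ a → far u v u∈ v∈ (λ { refl → subst T (Digraph.irrefl D u) a }) (inj₂ (T-∨ˡ (arc u v) (arc v u) a))) ,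
          λ u u∉ → absorbed X u u∉ (dom refl u))
        (λ (X , ≤k , stable , absorbing) → X , z≤n , ≤k , (λ u v u∈ v∈ u≢v → apart X stable u∈ v∈ u≢v) , λ _ w → dominated X absorbing w)
        (WithAdjacent.pickTail-decides 0 (con 0) _ _))
        where
        absorbed : ∀ X u → u ∉ X → (∃ λ v → v ∈ X × Dom v u) → ∃ λ v → v ∈ X × T (arc u v)
        absorbed X u u∉ (v , v∈ , inj₁ refl) = contradiction v∈ u∉
        absorbed X u u∉ (v , v∈ , inj₂ a)    = v , v∈ , a
        apart : ∀ X → (∀ u v → u ∈ X → v ∈ X → ¬ T (arc u v)) → ∀ {u v} → u ∈ X → v ∈ X → u ≢ v → ¬ Near (underlying D) u v
        apart X stable u∈ v∈ u≢v (inj₁ eq) = u≢v eq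
        apart X stable {u} {v} u∈ v∈ u≢v (inj₂ e) with T-∨⁻ (arc u v) (arc v u) e
        ... | inj₁ a = stable u v u∈ v∈ a
        ... | inj₂ a = stable v u v∈ u∈ a
        dominated : ∀ X → (∀ u → u ∉ X → ∃ λ v → v ∈ X × T (arc u v)) → ∀ w → ∃ λ u → u ∈ X × Dom u w
        dominated X absorbing w with w ∈? X
        ... | yes w∈ = w , w∈ , inj₁ refl
        ... | no w∉  = let v , v∈ , a = absorbing w w∉ in v , v∈ , inj₂ a

-- Maximum minimal dominating sets

bruteF : Fm 3 0
bruteF = ex 0F (
  (sz 2F ≼ sum 3F (fm (rdᶠ 4F (sz 1F) (sz 0F)))) ∧ᶠ
  al 3F (ex 4F (rdᶠ 5F (sz 2F) (sz 0F) ∧ᶠ nearF 2 5F (sz 0F) (sz 1F))) ∧ᶠ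
  al 3F (rdᶠ 4F (sz 1F) (sz 0F) ⇒ᶠ ¬ᶠ al 4F (ex 5F (rdᶠ 6F (sz 3F) (sz 0F) ∧ᶠ ¬ᶠ (sz 0F ≐ sz 2F) ∧ᶠ nearF 2 6F (sz 0F) (sz 1F)))))

bruteE : Exp 2 0
bruteE = lets (p2E 1F) (fm bruteF)

-- The second test has to be safe only where the first fails. Trying 2^n sets is affordable just
-- then, because the absence of an independent k-set bounds n.
decides-ifz : ∀ {s v Q M P P′} {c a : Exp s v} {σ ρ} → Decides Q M c σ ρ P → (P → P′) → (¬ P → Decides Q M a σ ρ P′) →
              Decides Q M (ifz c a (con 1)) σ ρ P′
decides-ifz {M = M} {c = c} {a} {σ} {ρ} (decides S (accepts e p)) f g =
  decides (ifz S (λ e₀ → contradiction (trans (sym e) e₀) λ ()) (λ _ → con)) (subst (λ x → Reflect (ifz-sem x (eval M a σ ρ) 1) _) (sym e) (accepts refl (f p)))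
decides-ifz {M = M} {c = c} {a} {σ} {ρ} (decides S (rejects e ¬p)) f g =
  decides (ifz S (λ _ → Decides.safe (g ¬p)) (λ _ → con)) (subst (λ x → Reflect (ifz-sem x (eval M a σ ρ) 1) _) (sym e) (Decides.reflects (g ¬p)))

module _ (G : Graph) where

  private
    n = order G

  Covering : Subset n → Set
  Covering X = ∀ w → ∃ λ u → u ∈ X × Near G u w

  -- Supersets of dominating sets dominate, so minimality can be tested by removing single vertices,
  -- without a quantifier over subsets.
  Irredundant : Subset n → Set
  Irredundant X = ∀ x → x ∈ X → ¬ (∀ w → ∃ λ u → u ∈ X × u ≢ x × Near G u w)

  minimal⁺ : ∀ {X} → Covering X → Irredundant X → MinimalDominating G X
  minimal⁺ {X} dom irr = dominating⁺ G dom , λ { Y (Y⊆ , x , x∈ , x∉) domY → irr x x∈ λ w →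
    let u , u∈ , d = dominating⁻ G domY w in u , Y⊆ u∈ , (λ { refl → x∉ u∈ }) , d }

  minimal⁻ : ∀ {X} → MinimalDominating G X → Covering X × Irredundant X
  minimal⁻ {X} (dom , min) = dominating⁻ G dom , λ x x∈ cov → min (X - x) (x∈p⇒p-x⊂p x∈)
    (dominating⁺ G λ w → let u , u∈ , u≢x , d = cov w in u , x∈p∧x≢y⇒x∈p-y u∈ u≢x , d)

  maximal : ∀ fuel X → Independent G X → n ≤ ∣ X ∣ + fuel → ∃ λ Y → X ⊆ Y × Independent G Y × Covering Y
  maximal fuel X ind le with any? (λ w → all? λ u → u ∈? X →-dec ¬? (near? G u w))
  ... | no none = X , (λ u∈ → u∈) , ind , cover
    where
    cover : Covering X
    cover w with any? (λ u → u ∈? X ×-dec near? G u w)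
    ... | yes c = c
    ... | no ¬c = contradiction (w , λ u u∈ near → ¬c (u , u∈ , near)) none
  ... | yes (w , free) = extend fuel le
    where
    X′ = X ∪ ⁅ w ⁆
    X⊂X′ : X ⊂ X′
    X⊂X′ = p⊆p∪q ⁅ w ⁆ , w , q⊆p∪q X ⁅ w ⁆ (x∈⁅x⁆ w) , λ w∈ → free w w∈ (inj₁ refl)
    ind′ : Independent G X′
    ind′ u v u∈ v∈ e with x∈p∪q⁻ X ⁅ w ⁆ u∈ | x∈p∪q⁻ X ⁅ w ⁆ v∈
    ... | inj₁ u∈ | inj₁ v∈ = ind u v u∈ v∈ e
    ... | inj₁ u∈ | inj₂ v∈ = free u u∈ (inj₂ (subst (Edge G u) (x∈⁅y⁆⇒x≡y w v∈) e))
    ... | inj₂ u∈ | inj₁ v∈ = free v v∈ (inj₂ (edge-sym G w v (subst (λ x → Edge G x v) (x∈⁅y⁆⇒x≡y w u∈) e)))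
    ... | inj₂ u∈ | inj₂ v∈ = subst T (Graph.irrefl G w) (subst₂ (Edge G) (x∈⁅y⁆⇒x≡y w u∈) (x∈⁅y⁆⇒x≡y w v∈) e)
    extend : ∀ fuel → n ≤ ∣ X ∣ + fuel → ∃ λ Y → X ⊆ Y × Independent G Y × Covering Y
    extend zero     le = contradiction (≤-trans (p⊂q⇒∣p∣<∣q∣ X⊂X′) (∣p∣≤n X′)) (≤⇒≯ (subst (n ≤_) (+-identityʳ ∣ X ∣) le))
    extend (suc fuel) le with maximal fuel X′ ind′ (≤-trans le (≤-trans (≤-reflexive (+-suc ∣ X ∣ fuel)) (+-monoˡ-≤ fuel (p⊂q⇒∣p∣<∣q∣ X⊂X′))))
    ... | Y , X′⊆ , rest = Y , (λ u∈ → X′⊆ (p⊆p∪q ⁅ w ⁆ u∈)) , rest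

  independent-irredundant : ∀ {X} → Independent G X → Irredundant X
  independent-irredundant ind x x∈ cov with cov x
  ... | u , u∈ , u≢x , inj₁ eq = u≢x eq
  ... | u , u∈ , u≢x , inj₂ e  = ind u x u∈ x∈ e

  large-minimal : ∀ {k} → (∃ λ X → ∣ X ∣ ≡ k × Independent G X) → ∃ λ X → MinimalDominating G X × ∣ X ∣ ≥ k
  large-minimal (X , refl , ind) with maximal n X ind (m≤n+m n ∣ X ∣)
  ... | Y , X⊆Y , ind′ , cov = Y , minimal⁺ cov (independent-irredundant ind′) , p⊆q⇒∣p∣≤∣q∣ X⊆Y

  shrink : ∀ k (A : Subset n) → k ≤ ∣ A ∣ → ∃ λ X → ∣ X ∣ ≡ k × X ⊆ A
  shrink k A k≤ = X , ≤-antisym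
      (card-≤ X k (λ x l → ∃ λ i → toℕ i ≡ l × g i ≡ x) (λ x x∈ → let i , e = X⁻ x∈ in toℕ i , toℕ<n i , i , refl , e)
        λ { x x′ _ (i , refl , e) (i′ , e′ , e″) → trans (sym e) (trans (cong g (toℕ-injective (sym e′))) e″) })
      (card-≥ X g (λ i → ∈-subset⁺ (λ x → any? λ i → g i ≟ꟳ x) (i , refl)) λ i i′ e →
        toℕ-injective (trans (sym (toℕ-inject≤ i k≤)) (trans (cong toℕ (enum-injective A _ _ e)) (toℕ-inject≤ i′ k≤)))) ,
    λ x∈ → let i , e = X⁻ x∈ in subst (_∈ A) e (enum-∈ A _)
    where
    g : Fin k → Fin n
    g i = enum A (inject≤ i k≤)
    X = subset (λ x → any? λ i → g i ≟ꟳ x)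
    X⁻ : ∀ {x} → x ∈ X → ∃ λ i → g i ≡ x
    X⁻ = ∈-subset⁻ (λ x → any? λ i → g i ≟ꟳ x)

  -- If u and v were adjacent, v would lie in the balls of both, since neither is deleted.
  scattered-independent : ∀ {S A r} → Scattered G S (r + 2) A → Independent G A
  scattered-independent {S} {A} {r} (A⊆ , sc) u v u∈ v∈ e = sc (u , A⊆ u∈) (v , A⊆ v∈) u∈ v∈
    (λ { refl → subst T (Graph.irrefl G u) e }) ((v , A⊆ v∈) , (1 , ≤-trans (s≤s z≤n) (m≤n+m 2 r) , edge-sym G u v e ∷ []) , (0 , z≤n , []))

  many-independent : ∀ {s m B k} → Wide G (k + 2) s m B → k ≤ m → ¬ (∃ λ X → ∣ X ∣ ≡ k × Independent G X) → n ≤ B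
  many-independent {k = k} wide k≤m none = ≮⇒≥ λ big → go (wide ⊤ˢ (subst (_ <_) (sym (∣⊤∣≡n n)) big))
    where
    go : ¬ (∃ λ S → ∣ S ∣ < _ × ∃ λ A → A ⊆ ⊤ˢ × _ ≤ ∣ A ∣ × Scattered G S (k + 2) A)
    go (S , _ , A , _ , m≤ , sc) with shrink k A (≤-trans k≤m m≤)
    ... | X , eq , X⊆A = none (X , eq , λ u v u∈ v∈ → scattered-independent {r = k} sc u v (X⊆A u∈) (X⊆A v∈))

module MinimalSetting {ℓ} (C : GraphClass ℓ) (s : ℕ → ℕ) (b : ℕ → ℕ → ℕ) (uqw : UniformlyQuasiWide C s b)
  (s-computable : Computable s) (b-computable : Computable₂ b) where

  open PickSetting C s b uqw s-computable b-computable

  maximumMinimal : FPT C MaximumMinimalDominatingSet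
  maximumMinimal = fpt MaximumMinimalDominatingSet (start (ifz independentTail bruteE (con 1))) λ (G , k) CG → correct G k CG
    where
    module _ (G : Graph) (k : ℕ) (CG : C G) where
      open Undirected G k CG
      n = order G
      M = cell (n ∷ k ∷ matrix (Graph.adj G))
      reads = cell-matrix (Graph.adj G)

      Yes : Set
      Yes = ∃ λ X → MinimalDominating G X × ∣ X ∣ ≥ k

      brute⁻ : Sem M bruteF (p2 n ∷ k ∷ n ∷ []) [] → Yes
      brute⁻ (U , k≤ , dom , irr) = X , minimal⁺ G (λ w → let u , u∈ , near = dom w in u , ∈-subset⁺ in? u∈ , near⁻ G 2 M reads u w near)
          (λ x x∈ cov → irr x (∈-subset⁻ in? x∈) λ w → let u , u∈ , u≢x , d = cov w in u , ∈-subset⁻ in? u∈ , (λ e → u≢x (toℕ-injective e)) , near⁺ G 2 M reads u w d) ,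
        subst (k ≤_) (count-fm M 3F (rdᶠ 4F (sz 1F) (sz 0F)) (toℕ U ∷ p2 n ∷ k ∷ n ∷ []) [] in? (λ _ r → r) (λ _ r → r)) k≤
        where
        in? : ∀ (u : Vertex G) → Dec (Rd n (toℕ U) (toℕ u))
        in? u = rd? n (toℕ U) (toℕ u)
        X = subset in?

      brute⁺ : Yes → Sem M bruteF (p2 n ∷ k ∷ n ∷ []) []
      brute⁺ (X , min , k≤) = U , subst (k ≤_) (sym card) k≤ ,
          (λ w → let u , u∈ , d = proj₁ (minimal⁻ G min) w in u , ∈⇒rd u∈ , near⁺ G 2 M reads u w d) ,
          λ x r cov → proj₂ (minimal⁻ G min) x (rd⇒∈ r) λ w → let u , r , u≢x , near = cov w in u , rd⇒∈ r , (λ e → u≢x (cong toℕ e)) , near⁻ G 2 M reads u w near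
        where
        coded? : ∀ j → Dec (∃ λ (x : Vertex G) → x ∈ X × toℕ x ≡ j)
        coded? j = any? λ x → x ∈? X ×-dec toℕ x ≟ j
        guessed = guess n (λ j → does (coded? j))
        U = proj₁ guessed
        rd⇒∈ : ∀ {u : Vertex G} → Rd n (toℕ U) (toℕ u) → u ∈ X
        rd⇒∈ {u} r with does-T (coded? (toℕ u)) (bit⁻ (proj₂ guessed (toℕ u) (toℕ<n u)) r)
        ... | x , x∈ , e = subst (_∈ X) (toℕ-injective e) x∈
        ∈⇒rd : ∀ {u : Vertex G} → u ∈ X → Rd n (toℕ U) (toℕ u)
        ∈⇒rd {u} u∈ = bit⁺ (proj₂ guessed (toℕ u) (toℕ<n u)) (T-does (coded? (toℕ u)) (u , u∈ , refl))
        card : eval M (sum 3F (fm (rdᶠ 4F (sz 1F) (sz 0F)))) (toℕ U ∷ p2 n ∷ k ∷ n ∷ []) [] ≡ ∣ X ∣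
        card = trans (count-fm M 3F (rdᶠ 4F (sz 1F) (sz 0F)) (toℕ U ∷ p2 n ∷ k ∷ n ∷ []) [] (_∈? X) (λ u r → rd⇒∈ r) (λ u u∈ → ∈⇒rd u∈))
          (cong ∣_∣ (⊆-antisym (∈-subset⁻ (_∈? X)) (∈-subset⁺ (_∈? X))))

      brute-decides : n ≤ core₁ k → Decides Q M bruteE (k ∷ n ∷ []) [] Yes
      brute-decides n≤ = decides-lets {x = p2 n} (static-safe _ _ _ _) refl
        (subst (λ x → p2 x ≤ Q) (*-identityʳ n) (power≤Q (≤-trans n≤ (core₁≤total k)) (≤-trans (s≤s z≤n) 4≤τ)))
        (decides (static-safe _ _ _ _) (reflect-map brute⁻ brute⁺ (fm-reflects {M = M} bruteF (p2 n ∷ k ∷ n ∷ []) [])))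

      correct : Decides Q M (start (ifz independentTail bruteE (con 1))) [] [] Yes
      correct = input-decides refl refl (decides-ifz independent-decides (large-minimal G) λ none →
        brute-decides (many-independent G (wide CG (k + 2) (width₁ k)) (≤-trans (≤-trans (m≤m+n k 2) (m≤n+m (k + 2) (s (k + 2) * (k + 3)))) (n≤p2 (s (k + 2) * (k + 3) + (k + 2)))) none))

-- Trees as witnesses of connectedness

∣p∪q∣≤ : ∀ {n} (p q : Subset n) → ∣ p ∪ q ∣ ≤ ∣ p ∣ + ∣ q ∣
∣p∪q∣≤ []            []            = z≤n
∣p∪q∣≤ (inside ∷ p)  (inside ∷ q)  = s≤s (≤-trans (∣p∪q∣≤ p q) (+-monoʳ-≤ ∣ p ∣ (n≤1+n ∣ q ∣)))
∣p∪q∣≤ (inside ∷ p)  (outside ∷ q) = s≤s (∣p∪q∣≤ p q)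
∣p∪q∣≤ (outside ∷ p) (inside ∷ q)  = ≤-trans (s≤s (∣p∪q∣≤ p q)) (≤-reflexive (sym (+-suc ∣ p ∣ ∣ q ∣)))
∣p∪q∣≤ (outside ∷ p) (outside ∷ q) = ∣p∪q∣≤ p q

∉⇒⊂ : ∀ {n} {p q : Subset n} {x} → p ⊆ q → x ∈ q → x ∉ p → p ⊂ q
∉⇒⊂ p⊆q x∈q x∉p = p⊆q , _ , x∈q , x∉p

module Trees {n : ℕ} (H : Fin n → Fin n → Set) (H-sym : ∀ u v → H u v → H v u) where

  data Path (X : Subset n) : Fin n → Fin n → Set where
    stop : ∀ {u} → u ∈ X → Path X u u
    step : ∀ {u w v} → u ∈ X → H u w → Path X w v → Path X u v

  path-trans : ∀ {X u w v} → Path X u w → Path X w v → Path X u v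
  path-trans (stop _)     q = q
  path-trans (step u∈ h p) q = step u∈ h (path-trans p q)

  path-start : ∀ {X u v} → Path X u v → u ∈ X
  path-start (stop u∈)     = u∈
  path-start (step u∈ _ _) = u∈

  path-sym : ∀ {X u v} → Path X u v → Path X v u
  path-sym (stop u∈)     = stop u∈
  path-sym (step u∈ h p) = path-trans (path-sym p) (step (path-start p) (H-sym _ _ h) (stop u∈))

  path-mono : ∀ {X Y u v} → X ⊆ Y → Path X u v → Path Y u v
  path-mono X⊆Y (stop u∈)     = stop (X⊆Y u∈)
  path-mono X⊆Y (step u∈ h p) = step (X⊆Y u∈) h (path-mono X⊆Y p)

  crossing : ∀ {X u v} Y → Path X u v → u ∈ Y → v ∉ Y → ∃₂ λ a c → a ∈ Y × c ∉ Y × c ∈ X × H a c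
  crossing Y (stop u∈X) u∈ v∉ = contradiction u∈ v∉
  crossing Y (step {w = w} u∈X h p) u∈ v∉ with w ∈? Y
  ... | yes w∈ = crossing Y p w∈ v∉
  ... | no w∉  = _ , w , u∈ , w∉ , path-start p , h

  -- join h t₁ t₂ hangs the tree t₁ below the root of t₂.

  data Tree : Fin n → Set where
    leaf : ∀ {v} → Tree v
    join : ∀ {v w} → H v w → Tree w → Tree v → Tree v

  -- Counts with repetition, since the two parts of a `join` may share vertices; the table of trees
  -- cannot exclude this. Hence `card-nodes` is only an inequality.
  size : ∀ {v} → Tree v → ℕ
  size leaf           = 1
  size (join _ t₁ t₂) = size t₁ + size t₂

  nodes : ∀ {v} → Tree v → Subset n
  nodes {v} leaf       = ⁅ v ⁆
  nodes (join _ t₁ t₂) = nodes t₁ ∪ nodes t₂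

  1≤size : ∀ {v} (t : Tree v) → 1 ≤ size t
  1≤size leaf           = ≤-refl
  1≤size (join _ t₁ t₂) = ≤-trans (1≤size t₁) (m≤m+n _ _)

  root∈ : ∀ {v} (t : Tree v) → v ∈ nodes t
  root∈ {v} leaf       = x∈⁅x⁆ v
  root∈ (join _ t₁ t₂) = q⊆p∪q (nodes t₁) (nodes t₂) (root∈ t₂)

  card-nodes : ∀ {v} (t : Tree v) → ∣ nodes t ∣ ≤ size t
  card-nodes {v} leaf       = ≤-reflexive (∣⁅x⁆∣≡1 v)
  card-nodes (join _ t₁ t₂) = ≤-trans (∣p∪q∣≤ (nodes t₁) (nodes t₂)) (+-mono-≤ (card-nodes t₁) (card-nodes t₂))

  root-path : ∀ {v} (t : Tree v) {x} → x ∈ nodes t → Path (nodes t) v x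
  root-path {v} leaf x∈ rewrite x∈⁅y⁆⇒x≡y v x∈ = stop (x∈⁅x⁆ v)
  root-path {v} (join h t₁ t₂) x∈ with x∈p∪q⁻ (nodes t₁) (nodes t₂) x∈
  ... | inj₁ x∈₁ = step (q⊆p∪q (nodes t₁) (nodes t₂) (root∈ t₂)) h (path-mono (p⊆p∪q (nodes t₂)) (root-path t₁ x∈₁))
  ... | inj₂ x∈₂ = path-mono (q⊆p∪q (nodes t₁) (nodes t₂)) (root-path t₂ x∈₂)

  record Grown {v} (t : Tree v) (c : Fin n) : Set where
    field
      tree  : Tree v
      size≡ : size tree ≡ suc (size t)
      old   : nodes t ⊆ nodes tree
      new   : c ∈ nodes tree
      only  : nodes tree ⊆ nodes t ∪ ⁅ c ⁆

  open Grown

  attach : ∀ {v a c} (t : Tree v) → a ∈ nodes t → H a c → Grown t c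
  attach {v} {a} {c} leaf a∈ h = record
    { tree = join (subst (λ x → H x c) (x∈⁅y⁆⇒x≡y v a∈) h) leaf leaf ; size≡ = refl
    ; old = q⊆p∪q ⁅ c ⁆ ⁅ v ⁆ ; new = p⊆p∪q ⁅ v ⁆ (x∈⁅x⁆ c)
    ; only = λ x∈ → x∈p∪q⁺ ([ inj₂ , inj₁ ]′ (x∈p∪q⁻ ⁅ c ⁆ ⁅ v ⁆ x∈)) }
  attach {v} {a} {c} (join {w = w} g t₁ t₂) a∈ h with x∈p∪q⁻ (nodes t₁) (nodes t₂) a∈
  ... | inj₁ a∈₁ = record
    { tree = join g (tree A) t₂ ; size≡ = cong (_+ size t₂) (size≡ A)
    ; old = λ x∈ → x∈p∪q⁺ ([ inj₁ ∘ old A , inj₂ ]′ (x∈p∪q⁻ (nodes t₁) (nodes t₂) x∈)) ; new = p⊆p∪q (nodes t₂) (new A)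
    ; only = λ x∈ → x∈p∪q⁺ ([ (λ y → [ inj₁ ∘ p⊆p∪q (nodes t₂) , inj₂ ]′ (x∈p∪q⁻ (nodes t₁) ⁅ c ⁆ (only A y))) , inj₁ ∘ q⊆p∪q (nodes t₁) (nodes t₂) ]′
                        (x∈p∪q⁻ (nodes (tree A)) (nodes t₂) x∈)) }
    where A = attach t₁ a∈₁ h
  ... | inj₂ a∈₂ = record
    { tree = join g t₁ (tree A) ; size≡ = trans (cong (size t₁ +_) (size≡ A)) (+-suc (size t₁) (size t₂))
    ; old = λ x∈ → x∈p∪q⁺ ([ inj₁ , inj₂ ∘ old A ]′ (x∈p∪q⁻ (nodes t₁) (nodes t₂) x∈)) ; new = q⊆p∪q (nodes t₁) (nodes (tree A)) (new A)
    ; only = λ x∈ → x∈p∪q⁺ ([ inj₁ ∘ p⊆p∪q (nodes t₂) , (λ y → [ inj₁ ∘ q⊆p∪q (nodes t₁) (nodes t₂) , inj₂ ]′ (x∈p∪q⁻ (nodes t₂) ⁅ c ⁆ (only A y))) ]′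
                        (x∈p∪q⁻ (nodes t₁) (nodes (tree A)) x∈)) }
    where A = attach t₂ a∈₂ h

  -- Inside a region all of which is reachable from the root, a tree grows to
  -- any prescribed number of nodes.

  grow : ∀ fuel {v} (t : Tree v) {R k} → (∀ x → x ∈ R → Path R v x) → nodes t ⊆ R → k ≤ ∣ R ∣ → ∣ nodes t ∣ + fuel ≡ k →
         ∃ λ (t′ : Tree v) → nodes t ⊆ nodes t′ × nodes t′ ⊆ R × ∣ nodes t′ ∣ ≡ k × (size t ≤ ∣ nodes t ∣ → size t′ ≤ k)
  grow zero       t reach t⊆R k≤ eq = t , (λ x∈ → x∈) , t⊆R , trans (sym (+-identityʳ _)) eq , λ le → ≤-trans le (≤-reflexive (trans (sym (+-identityʳ _)) eq))
  grow (suc fuel) {v} t {R} {k} reach t⊆R k≤ eq with any? (λ x → x ∈? R ×-dec ¬? (x ∈? nodes t))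
  ... | no none = contradiction (≤-trans k≤ (p⊆q⇒∣p∣≤∣q∣ R⊆t)) (<⇒≱ (subst (∣ nodes t ∣ <_) eq (≤-trans (s≤s (m≤m+n _ fuel)) (≤-reflexive (sym (+-suc _ fuel))))))
    where
    R⊆t : R ⊆ nodes t
    R⊆t {x} x∈ with x ∈? nodes t
    ... | yes y = y
    ... | no ¬y = contradiction (x , x∈ , ¬y) none
  ... | yes (x , x∈ , x∉) with crossing (nodes t) (reach x x∈) (root∈ t) x∉
  ...   | a , c , a∈ , c∉ , c∈R , h with attach t a∈ h
  ...     | A with grow fuel (tree A) reach sub-R k≤ (trans (cong (_+ fuel) card) (trans (sym (+-suc _ fuel)) eq))
    where
    sub-R : nodes (tree A) ⊆ R
    sub-R y∈ = [ t⊆R , (λ y∈c → subst (_∈ R) (sym (x∈⁅y⁆⇒x≡y c y∈c)) c∈R) ]′ (x∈p∪q⁻ (nodes t) ⁅ c ⁆ (only A y∈))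
    card : ∣ nodes (tree A) ∣ ≡ suc ∣ nodes t ∣
    card = ≤-antisym (≤-trans (p⊆q⇒∣p∣≤∣q∣ (only A)) (≤-trans (∣p∪q∣≤ (nodes t) ⁅ c ⁆) (≤-reflexive (trans (cong (∣ nodes t ∣ +_) (∣⁅x⁆∣≡1 c)) (+-comm _ 1)))))
      (p⊂q⇒∣p∣<∣q∣ (∉⇒⊂ (old A) (new A) c∉))
  ...       | t′ , A⊆t′ , t′⊆R , eq′ , sz≤ = t′ , (λ y∈ → A⊆t′ (old A y∈)) , t′⊆R , eq′ ,
    λ le → sz≤ (subst (_≤ ∣ nodes (tree A) ∣) (sym (size≡ A)) (≤-trans (s≤s le) (p⊂q⇒∣p∣<∣q∣ (∉⇒⊂ (old A) (new A) c∉))))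

  Linked : Subset n → Set
  Linked X = ∀ u v → u ∈ X → v ∈ X → Path X u v

  nodes-linked : ∀ {v} (t : Tree v) → Linked (nodes t)
  nodes-linked t u w u∈ w∈ = path-trans (path-sym (root-path t u∈)) (root-path t w∈)

  -- A single root repeats no vertex, and growing adds new vertices only, so the size never exceeds
  -- the number of nodes.
  spanning : ∀ {X r} → Linked X → r ∈ X → ∃ λ (t : Tree r) → X ⊆ nodes t × size t ≤ ∣ X ∣
  spanning {X} {r} linked r∈ with m≤n⇒∃[o]m+o≡n {∣ nodes (leaf {r}) ∣} {∣ X ∣} (p⊆q⇒∣p∣≤∣q∣ leaf⊆)
    where
    leaf⊆ : ⁅ r ⁆ ⊆ X
    leaf⊆ x∈ = subst (_∈ X) (sym (x∈⁅y⁆⇒x≡y r x∈)) r∈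
  ... | fuel , eq with grow fuel (leaf {r}) {X} {∣ X ∣} (λ x x∈ → linked r x r∈ x∈) (λ x∈ → subst (_∈ X) (sym (x∈⁅y⁆⇒x≡y r x∈)) r∈) ≤-refl eq
  ...   | t , _ , t⊆X , card , small = t , X⊆t , small (≤-reflexive (sym (∣⁅x⁆∣≡1 r)))
    where
    X⊆t : X ⊆ nodes t
    X⊆t {x} x∈ with x ∈? nodes t
    ... | yes y = y
    ... | no x∉ = contradiction card (<⇒≢ (p⊂q⇒∣p∣<∣q∣ (∉⇒⊂ t⊆X x∈ x∉)))

  -- `H` may relate a vertex to itself, as balls do; such steps are dropped when a path becomes a
  -- walk.
  module Graphs (_~_ : Fin n → Fin n → Set) (H⇒~ : ∀ u v → H u v → u ≡ v ⊎ u ~ v) (~⇒H : ∀ u v → u ~ v → H u v) where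

    linked⇒connected : ∀ {X} → Linked X → Connected (induced (relGraph (Fin n) _~_) (_∈ X))
    linked⇒connected {X} linked (u , u∈) (v , v∈) = walk (linked u v u∈ v∈) u∈ v∈
      where
      walk : ∀ {u v} → Path X u v → (u∈ : u ∈ X) (v∈ : v ∈ X) → ∃ λ l → Walk (induced (relGraph (Fin n) _~_) (_∈ X)) l (u , u∈) (v , v∈)
      walk (stop _) u∈ v∈ with []=-irrelevant u∈ v∈
      ... | refl = 0 , []
      walk (step {u} {w} _ h p) u∈ v∈ with H⇒~ u w h
      ... | inj₁ refl = walk p u∈ v∈
      ... | inj₂ e    = let l , q = walk p (path-start p) v∈ in suc l , _∷_ {w = w , path-start p} e q

    connected⇒linked : ∀ {X} → Connected (induced (relGraph (Fin n) _~_) (_∈ X)) → Linked X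
    connected⇒linked {X} connected u v u∈ v∈ = path (proj₂ (connected (u , u∈) (v , v∈)))
      where
      path : ∀ {l x y} → Walk (induced (relGraph (Fin n) _~_) (_∈ X)) l x y → Path X (proj₁ x) (proj₁ y)
      path {x = _ , x∈} []      = stop x∈
      path {x = _ , x∈} (e ∷ p) = step x∈ (~⇒H _ _ e) (path p)

-- Balls whose radius is part of the input

module Walks (G : Graph) where

  open Balls (Graph.adj G)

  walk-sym : ∀ {l u v} → Walk ⟦ G ⟧ l u v → Walk ⟦ G ⟧ l v u
  walk-sym []      = []
  walk-sym {u = u} (_∷_ {w = w} e p) = snoc (walk-sym p) (edge-sym G u w e)

  ball⇒walk : ∀ i {x a} → Ball i x a → Dist≤ ⟦ G ⟧ i x a
  ball⇒walk zero    refl = 0 , z≤n , []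
  ball⇒walk (suc i) (inj₁ B) = let l , l≤ , p = ball⇒walk i B in l , m≤n⇒m≤1+n l≤ , p
  ball⇒walk (suc i) (inj₂ (w , B , e)) = let l , l≤ , p = ball⇒walk i B in suc l , s≤s l≤ , snoc p e

  ball-cons : ∀ i {x w a} → Edge G x w → Ball i w a → Ball (suc i) x a
  ball-cons zero    {x} e refl               = inj₂ (x , refl , e)
  ball-cons (suc i) e (inj₁ B)           = inj₁ (ball-cons i e B)
  ball-cons (suc i) e (inj₂ (v , B , f)) = inj₂ (v , ball-cons i e B , f)

  walk⇒ball : ∀ i {l x a} → l ≤ i → Walk ⟦ G ⟧ l x a → Ball i x a
  walk⇒ball i       l≤       []      = ball-refl i _
  walk⇒ball (suc i) (s≤s l≤) (e ∷ p) = ball-cons i e (walk⇒ball i l≤ p)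

  ball-sym : ∀ i {x a} → Ball i x a → Ball i a x
  ball-sym i B = let l , l≤ , p = ball⇒walk i B in walk⇒ball i l≤ (walk-sym p)

code₃ : ℕ → ℕ → ℕ → ℕ → ℕ → ℕ
code₃ m n x y z = ix m x (ix n y z)

code₃-injective : ∀ {n} {x x′ : ℕ} {y y′ z z′ : Fin n} → code₃ (n * n) n x (toℕ y) (toℕ z) ≡ code₃ (n * n) n x′ (toℕ y′) (toℕ z′) → x ≡ x′ × y ≡ y′ × z ≡ z′
code₃-injective {n} {y = y} {y′} {z} {z′} eq with *+-injective (n * n) (ix< (toℕ<n y) (toℕ<n z)) (ix< (toℕ<n y′) (toℕ<n z′)) eq
... | e , e′ with *+-injective n (toℕ<n z) (toℕ<n z′) e′
...   | f , g = e , toℕ-injective f , toℕ-injective g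

-- As d is part of the input, no fixed formula defines its balls. Entry (l , u , v) says that v is
-- in the l-ball of u and refers to radius l - 1; radius is the leading coordinate, so that entry
-- comes earlier.
ballF : ℕ → Fm 7 1
ballF a = ex 3F (ex 7F (ex 8F (
  (sz 3F ≐ ixᵉ 5F (sz 2F) (ixᵉ 9F (sz 1F) (sz 0F))) ∧ᶠ
  ((sz 2F ≐ con 0 ∧ᶠ sz 1F ≐ sz 0F) ∨ᶠ
   ex 6F ((sz 3F ≐ con 1 ⊕ sz 0F) ∧ᶠ
     (rdᶠ 4F (val 0F) (ixᵉ 6F (sz 0F) (ixᵉ (# 10) (sz 2F) (sz 1F))) ∨ᶠ
      ex (# 10) (rdᶠ 5F (val 0F) (ixᵉ 7F (sz 1F) (ixᵉ (# 11) (sz 3F) (sz 0F))) ∧ᶠ adjᶠ a (# 11) (sz 0F) (sz 2F))))))))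

module BallTable (G : Graph) (M : ℕ → ℕ) (a k d : ℕ) (reads : ∀ u v → M (a + ix (order G) (toℕ u) (toℕ v)) ≡ bit (Graph.adj G u v)) where

  private
    n = order G

  ball-σ : Vec ℕ 6
  ball-σ = suc d * (n * n) ∷ n * n ∷ suc d ∷ d ∷ k ∷ n ∷ []

  ball-table : ℕ
  ball-table = upto M 0F (ballF a) ball-σ [] (suc d * (n * n))

  ball-code : ℕ → Vertex G → Vertex G → ℕ
  ball-code l u v = code₃ (n * n) n l (toℕ u) (toℕ v)

  open Balls (Graph.adj G)

  private
    code< : ∀ {l l′} u v → l < l′ → ball-code l u v < l′ * (n * n)
    code< u v l< = ix< l< (ix< (toℕ<n u) (toℕ<n v))

    code-mono : ∀ {l l′} u v u′ v′ → l < l′ → ball-code l u v < ball-code l′ u′ v′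
    code-mono u v u′ v′ l< = *+-mono-< (n * n) _ (ix< (toℕ<n u) (toℕ<n v)) l<

  private
    Entry : ℕ → Vertex G → Vertex G → Set
    Entry l u v = Rd (suc d * (n * n)) ball-table (ball-code l u v)

    decode : ∀ l u v → l < suc d → Entry l u v →
             (l ≡ 0 × u ≡ v) ⊎ ∃ λ l′ → l ≡ suc l′ × (Entry l′ u v ⊎ ∃ λ w → Entry l′ u w × T (Graph.adj G w v))
    decode l u v l< r with table⁻ M 0F (ballF a) ball-σ [] (ball-code l u v) (code< u v l<) r
    ... | l₀ , u₀ , v₀ , eq , body with code₃-injective {n} {l} {toℕ l₀} {u} {u₀} {v} {v₀} eq
    decode .(toℕ l₀) u v l< r | l₀ , .u , .v , eq , inj₁ (e , e′) | refl , refl , refl = inj₁ (e , toℕ-injective e′)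
    decode .(toℕ l₀) u v l< r | l₀ , .u , .v , eq , inj₂ (l′ , e , body) | refl , refl , refl = inj₂ (toℕ l′ , e , lower body)
      where
      earlier : ∀ w → Rd (ball-code (toℕ l₀) u v) (upto M 0F (ballF a) ball-σ [] (ball-code (toℕ l₀) u v)) (ball-code (toℕ l′) u w) → Entry (toℕ l′) u w
      earlier w r = table-earlier M 0F (ballF a) ball-σ [] (ball-code (toℕ l′) u w)
        (code-mono {toℕ l′} {toℕ l₀} u w u v (subst (toℕ l′ <_) (sym e) ≤-refl)) (code< u w (toℕ<n l′)) r
      lower : _ ⊎ _ → Entry (toℕ l′) u v ⊎ ∃ λ w → Entry (toℕ l′) u w × T (Graph.adj G w v)
      lower (inj₁ r)           = inj₁ (earlier v r)
      lower (inj₂ (w , r , e)) = inj₂ (w , earlier w r , bit⁻ (reads w v) e)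

  ball-read⁻ : ∀ l u v → l < suc d → Rd (suc d * (n * n)) ball-table (ball-code l u v) → Ball l u v
  ball-read⁻ zero u v l< r = centre (decode 0 u v l< r)
    where
    centre : (0 ≡ 0 × u ≡ v) ⊎ (∃ λ l′ → 0 ≡ suc l′ × _) → u ≡ v
    centre (inj₁ (_ , eq)) = eq
    centre (inj₂ (_ , () , _))
  ball-read⁻ (suc l) u v l< r = further (decode (suc l) u v l< r)
    where
    further : (suc l ≡ 0 × u ≡ v) ⊎ (∃ λ l′ → suc l ≡ suc l′ × (Entry l′ u v ⊎ ∃ λ w → Entry l′ u w × T (Graph.adj G w v))) → Ball (suc l) u v
    further (inj₁ (() , _))
    further (inj₂ (_ , refl , inj₁ r′))           = inj₁ (ball-read⁻ l u v (<-trans ≤-refl l<) r′)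
    further (inj₂ (_ , refl , inj₂ (w , r′ , e))) = inj₂ (w , ball-read⁻ l u w (<-trans ≤-refl l<) r′ , e)

  ball-read⁺ : ∀ l u v → l < suc d → Ball l u v → Rd (suc d * (n * n)) ball-table (ball-code l u v)
  ball-read⁺ zero u .u l< refl = table⁺ M 0F (ballF a) ball-σ [] (ball-code 0 u u) (code< u u l<) (zero , u , u , refl , inj₁ (refl , refl))
  ball-read⁺ (suc l) u v l< B = table⁺ M 0F (ballF a) ball-σ [] (ball-code (suc l) u v) (code< u v l<)
    (fromℕ< l< , u , v , cong (λ z → code₃ (n * n) n z (toℕ u) (toℕ v)) (sym (toℕ-fromℕ< l<)) , inj₂ (fromℕ< l<′ , trans (toℕ-fromℕ< l<) (cong suc (sym (toℕ-fromℕ< l<′))) , lower B))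
    where
    l<′ : l < suc d
    l<′ = <-trans ≤-refl l<
    i = ball-code (suc l) u v
    earlier : ∀ w → Ball l u w → Rd i (upto M 0F (ballF a) ball-σ [] i) (ball-code (toℕ (fromℕ< l<′)) u w)
    earlier w B = subst (λ z → Rd i (upto M 0F (ballF a) ball-σ [] i) (ball-code z u w)) (sym (toℕ-fromℕ< l<′))
      (table-earlier M 0F (ballF a) ball-σ [] (ball-code l u w) (code< u w l<′) (code-mono {l} {suc l} u w u v ≤-refl) (ball-read⁺ l u w l<′ B))
    lower : Ball (suc l) u v → _ ⊎ _
    lower (inj₁ B)           = inj₁ (earlier v B)
    lower (inj₂ (w , B , e)) = inj₂ (w , earlier w B , bit⁺ (reads w v) e)

-- Domination by trees

-- Entry (j , U , v) of the table of trees: some tree with at most j nodes and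
-- root v dominates the part U of the core, by induction on j.

markF : ∀ {s v} → Fin s → Fin s → Fin s → Exp s v → Exp s v → Exp s v → Fm s v
markF n m one C U u = rdᶠ n C u ∧ᶠ rdᶠ m U (ixᵉ one (rankᵉ n n C u) (con 0))

treeF : Fm 10 4
treeF = ex 5F (ex 4F (ex 9F (
  (sz 3F ≐ ixᵉ (# 10) (ixᵉ 6F (sz 2F) (sz 1F)) (sz 0F)) ∧ᶠ
  ((con 1 ≼ sz 2F ∧ᶠ al (# 10) (markF (# 11) 8F (# 10) (val 1F) (sz 2F) (sz 0F) ⇒ᶠ rdᶠ (# 13) (val 3F) (ixᵉ (# 11) (sz 1F) (sz 0F)))) ∨ᶠ
   ex 8F (ex 9F (ex 8F (ex 9F (ex (# 14) (
     (sz 4F ⊕ sz 3F ≐ sz 7F) ∧ᶠ con 1 ≼ sz 4F ∧ᶠ con 1 ≼ sz 3F ∧ᶠ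
     al (# 15) (markF (# 16) (# 13) (# 15) (val 1F) (sz 7F) (sz 0F) ⇒ᶠ
       (markF (# 16) (# 13) (# 15) (val 1F) (sz 3F) (sz 0F) ∨ᶠ markF (# 16) (# 13) (# 15) (val 1F) (sz 2F) (sz 0F))) ∧ᶠ
     rdᶠ (# 17) (val 2F) (ixᵉ (# 15) (sz 5F) (sz 0F)) ∧ᶠ
     rdᶠ 8F (val 0F) (ixᵉ (# 15) (ixᵉ (# 11) (sz 4F) (sz 2F)) (sz 0F)) ∧ᶠ
     rdᶠ 8F (val 0F) (ixᵉ (# 15) (ixᵉ (# 11) (sz 3F) (sz 1F)) (sz 5F)))))))))))

-- A solution of size 0 exists for the empty graph only. Otherwise the tree may have fewer than k
-- vertices and is enlarged afterwards, for which k must not exceed n.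
spanF : Fm 9 4
spanF = (sz 7F ≐ con 0 ∧ᶠ sz 6F ≐ con 0) ∨ᶠ (con 1 ≼ sz 7F ∧ᶠ sz 7F ≼ sz 6F ∧ᶠ ex 6F (ex 3F (
  al 8F (rdᶠ 9F (val 1F) (sz 0F) ⇒ᶠ markF 9F 6F 8F (val 1F) (sz 1F) (sz 0F)) ∧ᶠ
  rdᶠ 2F (val 0F) (ixᵉ 8F (ixᵉ 4F (sz 9F) (sz 0F)) (sz 1F)))))

spanE : Exp 3 3
spanE = lets (con 1) (lets (con 1 ⊕ sz 2F) (lets (mulᵉ 1F (rankᵉ 2F 2F (val 0F) (sz 2F))) (lets (p2E 0F)
  (lets (mulᵉ 0F (sz 2F)) (lets (mulᵉ 5F (sz 0F)) (letv (tableᵉ 0F treeF) (fm spanF)))))))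

module TreeTable (M : ℕ → ℕ) (n k lR C H D : ℕ) {Link Dom : Fin n → Fin n → Set} (link-sym : ∀ u v → Link u v → Link v u)
  (link⁻ : ∀ u v → Rd lR H (ix n (toℕ u) (toℕ v)) → Link u v) (link⁺ : ∀ u v → Link u v → Rd lR H (ix n (toℕ u) (toℕ v)))
  (dom⁻ : ∀ u v → Rd lR D (ix n (toℕ u) (toℕ v)) → Dom u v) (dom⁺ : ∀ u v → Dom u v → Rd lR D (ix n (toℕ u) (toℕ v))) where

  open Trees Link link-sym

  private
    t₀ m P q len : ℕ
    t₀  = rank n n C n
    m   = t₀ * 1
    P   = p2 m
    q   = suc k * P
    len = q * n

    σ : Vec ℕ 9
    σ = len ∷ q ∷ P ∷ m ∷ suc k ∷ 1 ∷ n ∷ k ∷ lR ∷ []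
    ρ : Vec ℕ 3
    ρ = C ∷ H ∷ D ∷ []

    T′ : ℕ → ℕ
    T′ = upto M 0F treeF σ ρ

    code : ℕ → Fin P → Fin n → ℕ
    code j U v = ix n (ix P j (toℕ U)) (toℕ v)

    code< : ∀ {j} (U : Fin P) v → j < suc k → code j U v < len
    code< U v j< = ix< (ix< j< (toℕ<n U)) (toℕ<n v)

    -- The two parts of a tree have smaller budgets, and the budget is the leading coordinate; so
    -- the entries they need are already in the table.
    code-mono : ∀ {j j′} U v U′ v′ → j < j′ → code j U v < code j′ U′ v′
    code-mono U v U′ v′ j< = *+-mono-< n _ (toℕ<n v) (*+-mono-< P _ (toℕ<n U) j<)

    code-injective : ∀ {j j′} U v U′ v′ → code j U v ≡ code j′ U′ v′ → j ≡ j′ × U ≡ U′ × v ≡ v′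
    code-injective U v U′ v′ eq with *+-injective n (toℕ<n v) (toℕ<n v′) eq
    ... | e , e′ with *+-injective P (toℕ<n U) (toℕ<n U′) e
    ...   | f , f′ = f , toℕ-injective f′ , toℕ-injective e′

    Mark : Fin P → Fin n → Set
    Mark U u = Rd n C (toℕ u) × Rd m (toℕ U) (ix 1 (rank n n C (toℕ u)) 0)

    Entry : ℕ → Fin P → Fin n → Set
    Entry j U v = Rd len (T′ len) (code j U v)

    Single : ℕ → Fin P → Fin n → Set
    Single j U v = 1 ≤ j × (∀ u → Mark U u → Dom v u)

    -- `U₁` and `U₂` together may exceed `U`, as an entry claims only that at least its part of the
    -- core is dominated.
    Split : ℕ → Fin P → Fin n → Set
    Split j U v = ∃₂ λ j₁ j₂ → ∃₂ λ U₁ U₂ → ∃ λ w → j₁ + j₂ ≡ j × 1 ≤ j₁ × 1 ≤ j₂ ×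
      (∀ u → Mark U u → Mark U₁ u ⊎ Mark U₂ u) × Link v w × Entry j₁ U₁ w × Entry j₂ U₂ v

    Raw : ℕ → ℕ → ℕ → Fin P → Fin n → Set
    Raw i A j U v = (1 ≤ j × (∀ (u : Fin n) → Mark U u → Rd lR D (ix n (toℕ v) (toℕ u)))) ⊎
      ∃ λ (j₁ : Fin (suc k)) → ∃ λ (j₂ : Fin (suc k)) → ∃ λ (U₁ : Fin P) → ∃ λ (U₂ : Fin P) → ∃ λ (w : Fin n) →
        toℕ j₁ + toℕ j₂ ≡ j × 1 ≤ toℕ j₁ × 1 ≤ toℕ j₂ × (∀ (u : Fin n) → Mark U u → Mark U₁ u ⊎ Mark U₂ u) ×
        Rd lR H (ix n (toℕ v) (toℕ w)) × Rd i A (code (toℕ j₁) U₁ w) × Rd i A (code (toℕ j₂) U₂ v)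

    RawAt : ℕ → ℕ → Set
    RawAt i A = ∃ λ (j : Fin (suc k)) → ∃ λ (U : Fin P) → ∃ λ (v : Fin n) → i ≡ code (toℕ j) U v × Raw i A (toℕ j) U v

    raw⁻ : ∀ i A → Sem M treeF (i ∷ σ) (A ∷ ρ) → RawAt i A
    raw⁻ i A sem = sem

    raw⁺ : ∀ i A → RawAt i A → Sem M treeF (i ∷ σ) (A ∷ ρ)
    raw⁺ i A raw = raw

    decode-raw : ∀ j U v → j < suc k → ∀ {i} → i ≡ code j U v → Raw i (T′ i) j U v → Single j U v ⊎ Split j U v
    decode-raw j U v j< refl (inj₁ (1≤ , dom)) = inj₁ (1≤ , λ u mk → dom⁻ v u (dom u mk))
    decode-raw j U v j< refl (inj₂ (j₁ , j₂ , U₁ , U₂ , w , total , 1≤₁ , 1≤₂ , marks , h , r₁ , r₂)) =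
      inj₂ (toℕ j₁ , toℕ j₂ , U₁ , U₂ , w , total , 1≤₁ , 1≤₂ , marks , link⁻ v w h ,
        earlier j₁ U₁ w (subst (toℕ j₁ <_) total (m<m+n (toℕ j₁) 1≤₂)) r₁ , earlier j₂ U₂ v (subst (toℕ j₂ <_) total (m<n+m (toℕ j₂) 1≤₁)) r₂)
      where
      earlier : ∀ (i : Fin (suc k)) U″ w → toℕ i < j → Rd (code j U v) (T′ (code j U v)) (code (toℕ i) U″ w) → Entry (toℕ i) U″ w
      earlier i U″ w i< r = table-earlier M 0F treeF σ ρ (code (toℕ i) U″ w) (code-mono U″ w U v i<) (code< U″ w (toℕ<n i)) r

    decode-at : ∀ j U v → j < suc k → RawAt (code j U v) (T′ (code j U v)) → Single j U v ⊎ Split j U v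
    decode-at j U v j< (j′ , U′ , v′ , eq , raw) = aligned (code-injective {j} {toℕ j′} U v U′ v′ eq) raw
      where
      aligned : j ≡ toℕ j′ × U ≡ U′ × v ≡ v′ → Raw (code j U v) (T′ (code j U v)) (toℕ j′) U′ v′ → Single j U v ⊎ Split j U v
      aligned (refl , refl , refl) raw = decode-raw j U v j< refl raw

    decode : ∀ j U v → j < suc k → Entry j U v → Single j U v ⊎ Split j U v
    decode j U v j< r = decode-at j U v j< (raw⁻ _ _ (table⁻ M 0F treeF σ ρ (code j U v) (code< U v j<) r))

    encode-raw : ∀ j U v → j < suc k → Single j U v ⊎ Split j U v → ∀ {j′} → j′ ≡ j → Raw (code j U v) (T′ (code j U v)) j′ U v
    encode-raw j U v j< (inj₁ (1≤ , dom)) refl = inj₁ (1≤ , λ u mk → dom⁺ v u (dom u mk))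
    encode-raw j U v j< (inj₂ (j₁ , j₂ , U₁ , U₂ , w , total , 1≤₁ , 1≤₂ , marks , h , r₁ , r₂)) refl =
      inj₂ (fromℕ< l₁ , fromℕ< l₂ , U₁ , U₂ , w , trans (cong₂ _+_ (toℕ-fromℕ< l₁) (toℕ-fromℕ< l₂)) total ,
        subst (1 ≤_) (sym (toℕ-fromℕ< l₁)) 1≤₁ , subst (1 ≤_) (sym (toℕ-fromℕ< l₂)) 1≤₂ , marks , link⁺ v w h ,
        later U₁ w (toℕ-fromℕ< l₁) l₁ j₁< r₁ , later U₂ v (toℕ-fromℕ< l₂) l₂ j₂< r₂)
      where
      j₁< : j₁ < j
      j₁< = subst (j₁ <_) total (m<m+n j₁ 1≤₂)
      j₂< : j₂ < j
      j₂< = subst (j₂ <_) total (m<n+m j₂ 1≤₁)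
      l₁ : j₁ < suc k
      l₁ = <-trans j₁< j<
      l₂ : j₂ < suc k
      l₂ = <-trans j₂< j<
      later : ∀ {i i′} U″ w → i′ ≡ i → i < suc k → i < j → Entry i U″ w → Rd (code j U v) (T′ (code j U v)) (code i′ U″ w)
      later {i} U″ w refl i<k i< r = table-earlier M 0F treeF σ ρ (code i U″ w) (code< U″ w i<k) (code-mono U″ w U v i<) r

    encode : ∀ j U v → j < suc k → Single j U v ⊎ Split j U v → Entry j U v
    encode j U v j< body = table⁺ M 0F treeF σ ρ (code j U v) (code< U v j<)
      (raw⁺ _ _ (fromℕ< j< , U , v , cong (λ z → code z U v) (sym (toℕ-fromℕ< j<)) , encode-raw j U v j< body (toℕ-fromℕ< j<)))

    Dominated : ∀ {v} → Tree v → Fin n → Set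
    Dominated t u = ∃ λ x → x ∈ nodes t × Dom x u

    dominated? : ∀ {v} (t : Tree v) u → Dec (Dominated t u)
    dominated? t u = any? λ x → x ∈? nodes t ×-dec dec-map (rd? lR D (ix n (toℕ x) (toℕ u))) (dom⁻ x u) (dom⁺ x u)
      where
      dec-map : ∀ {A B : Set} → Dec A → (A → B) → (B → A) → Dec B
      dec-map (yes a) f g = yes (f a)
      dec-map (no ¬a) f g = no (¬a ∘ g)

    tree⁻ : ∀ fuel j U v → j ≤ fuel → j < suc k → Entry j U v → ∃ λ (t : Tree v) → size t ≤ j × (∀ u → Mark U u → Dominated t u)
    tree⁻ fuel j U v j≤ j< r = build fuel j≤ (decode j U v j< r)
      where
      build : ∀ fuel → j ≤ fuel → Single j U v ⊎ Split j U v → ∃ λ (t : Tree v) → size t ≤ j × (∀ u → Mark U u → Dominated t u)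
      build fuel j≤ (inj₁ (1≤ , dom)) = leaf , 1≤ , λ u mk → v , x∈⁅x⁆ v , dom u mk
      build zero j≤ (inj₂ (j₁ , j₂ , _ , _ , _ , total , 1≤₁ , _)) = contradiction (≤-trans 1≤₁ (≤-trans (m≤m+n j₁ j₂) (≤-trans (≤-reflexive total) j≤))) λ ()
      build (suc fuel) j≤ (inj₂ (j₁ , j₂ , U₁ , U₂ , w , total , 1≤₁ , 1≤₂ , marks , h , r₁ , r₂)) = hang
        (tree⁻ fuel j₁ U₁ w (s≤s⁻¹ (≤-trans j₁< j≤)) (<-trans j₁< j<) r₁) (tree⁻ fuel j₂ U₂ v (s≤s⁻¹ (≤-trans j₂< j≤)) (<-trans j₂< j<) r₂)
        where
        j₁< : j₁ < j
        j₁< = subst (j₁ <_) total (m<m+n j₁ 1≤₂)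
        j₂< : j₂ < j
        j₂< = subst (j₂ <_) total (m<n+m j₂ 1≤₁)
        hang : (∃ λ (t : Tree w) → size t ≤ j₁ × (∀ u → Mark U₁ u → Dominated t u)) → (∃ λ (t : Tree v) → size t ≤ j₂ × (∀ u → Mark U₂ u → Dominated t u)) →
               ∃ λ (t : Tree v) → size t ≤ j × (∀ u → Mark U u → Dominated t u)
        hang (t₁ , s₁ , c₁) (t₂ , s₂ , c₂) = join h t₁ t₂ , ≤-trans (+-mono-≤ s₁ s₂) (≤-reflexive total) , λ u mk →
          [ (λ mk₁ → let x , x∈ , d = c₁ u mk₁ in x , p⊆p∪q (nodes t₂) x∈ , d) , (λ mk₂ → let x , x∈ , d = c₂ u mk₂ in x , q⊆p∪q (nodes t₁) (nodes t₂) x∈ , d) ]′ (marks u mk)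

    marking : ∀ {B : Fin n → Set} → (∀ u → Dec (B u)) → ∃ λ (U : Fin P) → (∀ u → Mark U u → B u) × (∀ u → Rd n C (toℕ u) → B u → Mark U u)
    marking {B} B? = proj₁ guessed , (λ u (cu , r) → proj₁ (proj₂ guessed u 0F cu) r) , λ u cu b → cu , proj₂ (proj₂ guessed u 0F cu) b
      where
      guessed = guess₂ {k = 1} {t₀} (λ u → rd? n C (toℕ u)) (λ u → rank n n C (toℕ u)) (λ u cu → rank-mono-< {n} {n} {C} (toℕ<n u) (toℕ<n u) cu)
                  (λ u v cu cv → rank-injective n C u v cu cv) {B = λ u _ → B u} (λ u _ → B? u)

    tree⁺ : ∀ {v} (t : Tree v) j U → size t ≤ j → j < suc k → (∀ u → Mark U u → Dominated t u) → Entry j U v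
    tree⁺ {v} leaf j U s≤ j< cover = encode j U v j< (inj₁ (s≤ , λ u mk → let x , x∈ , d = cover u mk in subst (λ z → Dom z u) (x∈⁅y⁆⇒x≡y v x∈) d))
    tree⁺ {v} (join {w = w} h t₁ t₂) j U s≤ j< cover = encode j U v j< (inj₂ (j₁ , size t₂ , U₁ , U₂ , w , total , ≤-trans (1≤size t₁) s₁ , 1≤size t₂ , marks , h ,
        tree⁺ t₁ j₁ U₁ s₁ (≤-<-trans (m∸n≤m j (size t₂)) j<) (proj₁ (proj₂ M₁)) , tree⁺ t₂ (size t₂) U₂ ≤-refl (≤-<-trans (≤-trans (m≤n+m (size t₂) (size t₁)) s≤) j<) (proj₁ (proj₂ M₂))))
      where
      -- The two budgets must add up to exactly j, so the slack goes to the first subtree.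
      j₁ = j ∸ size t₂
      total : j₁ + size t₂ ≡ j
      total = m∸n+n≡m (≤-trans (m≤n+m (size t₂) (size t₁)) s≤)
      s₁ : size t₁ ≤ j₁
      s₁ = m+n≤o⇒m≤o∸n (size t₁) s≤
      M₁ = marking (dominated? t₁)
      M₂ = marking (dominated? t₂)
      U₁ = proj₁ M₁
      U₂ = proj₁ M₂
      marks : ∀ u → Mark U u → Mark U₁ u ⊎ Mark U₂ u
      marks u mk with cover u mk
      ... | x , x∈ , d = [ (λ x∈₁ → inj₁ (proj₂ (proj₂ M₁) u (proj₁ mk) (x , x∈₁ , d))) , (λ x∈₂ → inj₂ (proj₂ (proj₂ M₂) u (proj₁ mk) (x , x∈₂ , d))) ]′ (x∈p∪q⁻ (nodes t₁) (nodes t₂) x∈)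

  Spans : Set
  Spans = (k ≡ 0 × n ≡ 0) ⊎ (1 ≤ k × k ≤ n × ∃ λ v → ∃ λ (t : Tree v) → size t ≤ k × (∀ (u : Fin n) → Rd n C (toℕ u) → ∃ λ x → x ∈ nodes t × Dom x u))

  private
    RawSpan : Set
    RawSpan = (k ≡ 0 × n ≡ 0) ⊎ (1 ≤ k × k ≤ n × ∃ λ (v : Fin n) → ∃ λ (U : Fin P) → (∀ (u : Fin n) → Rd n C (toℕ u) → Mark U u) × Entry k U v)

    rawSpan⁻ : Sem M spanF σ (T′ len ∷ ρ) → RawSpan
    rawSpan⁻ sem = sem

    rawSpan⁺ : RawSpan → Sem M spanF σ (T′ len ∷ ρ)
    rawSpan⁺ raw = raw

    span⁻ : RawSpan → Spans
    span⁻ (inj₁ e) = inj₁ e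
    span⁻ (inj₂ (1≤k , k≤n , v , U , all , r)) =
      let t , s≤ , cover = tree⁻ k k U v ≤-refl ≤-refl r in inj₂ (1≤k , k≤n , v , t , s≤ , λ u cu → cover u (all u cu))

    span⁺ : Spans → RawSpan
    span⁺ (inj₁ e) = inj₁ e
    span⁺ (inj₂ (1≤k , k≤n , v , t , s≤ , cover)) =
      let U , mk⁻ , mk⁺ = marking (dominated? t) in inj₂ (1≤k , k≤n , v , U , (λ u cu → mk⁺ u cu (cover u cu)) , tree⁺ t k U s≤ ≤-refl mk⁻)

  span-decides : ∀ {Q} → 1 ≤ Q → suc k ≤ Q → P ≤ Q → q ≤ Q → len ≤ Q → Decides Q M spanE (n ∷ k ∷ lR ∷ []) ρ Spans
  span-decides 1≤ k≤ P≤ q≤ len≤ = decides-lets {x = 1} con refl 1≤ (decides-lets {x = suc k} (static-safe _ _ _ _) refl k≤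
    (decides-lets {x = m} (static-safe _ _ _ _) refl (≤-trans (n≤p2 m) P≤) (decides-lets {x = P} (static-safe _ _ _ _) refl P≤
    (decides-lets {x = q} (static-safe _ _ _ _) refl q≤ (decides-lets {x = len} (static-safe _ _ _ _) refl len≤
    (decides-letv {x = T′ len} (static-safe _ _ _ _) refl
    (decides (static-safe _ _ _ _) (reflect-map (span⁻ ∘ rawSpan⁻) (rawSpan⁺ ∘ span⁺) (fm-reflects {M = M} spanF σ (T′ len ∷ ρ))))))))))

-- Connected domination

withinF : ∀ {v} → Fin v → Fm 11 v
withinF B = rdᶠ 5F (val B) (ixᵉ 6F (sz 8F) (ixᵉ (# 10) (sz 1F) (sz 0F)))

connectedTail : ℕ → Fm 11 3 → Exp 3 0
connectedTail a χ = lets (con 1 ⊕ sz 0F) (lets (mulᵉ 3F (sz 3F)) (lets (mulᵉ 0F (sz 1F)) (letv (tableᵉ 0F (ballF a))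
  (lets (con 1 ⊕ sz 5F) (lets (mulᵉ 6F (sz 0F))
  (letv (tableᵉ 0F (relF 7F (withinF 1F))) (letv (tableᵉ 0F (relF 7F χ)) (letv (tableᵉ 7F (con 0 ≐ con 0)) (letv (con 0)
  (letv (proc (7F ∷ 1F ∷ 6F ∷ 0F ∷ 0F ∷ []) (3F ∷ 1F ∷ 0F ∷ 0F ∷ []) coreE coreV coreV-spec)
  (proc (7F ∷ 6F ∷ 0F ∷ []) (0F ∷ 3F ∷ 4F ∷ []) spanE (λ M → eval M spanE) (λ _ _ _ → refl))))))))))))

module ConnectedMain (s : ℕ → ℕ) (b : ℕ → ℕ → ℕ) (s-computable : Computable s) (b-computable : Computable₂ b)
  (G : Graph) (p k : ℕ) (k≤p : k ≤ p) (M : ℕ → ℕ) (uqw : ∀ m → Wide G (p + 2) (s (p + 2)) m (b (p + 2) m))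
  (a d : ℕ) (d≤ : d ≤ p + 2) (reads : ∀ u v → M (a + ix (order G) (toℕ u) (toℕ v)) ≡ bit (Graph.adj G u v)) where

  open Main s b s-computable b-computable G p k k≤p M uqw (Graph.adj G) (λ _ _ e → e) public
  open BallTable G M a k d reads
  open Balls (Graph.adj G)

  private
    n N′ l : ℕ
    n  = order G
    N′ = suc n
    l  = N′ * n

    σ : Vec ℕ 8
    σ = l ∷ N′ ∷ ball-σ

    D : ℕ
    D = upto M 0F (relF 7F (withinF 1F)) σ (ball-table ∷ []) l

    Within : Vertex G → Vertex G → Set
    Within = Ball d

  within⁻ : ∀ u v → Rd (suc d * (n * n)) ball-table (code₃ (n * n) n d (toℕ u) (toℕ v)) → Within u v
  within⁻ u v = ball-read⁻ d u v ≤-refl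

  within⁺ : ∀ u v → Within u v → Rd (suc d * (n * n)) ball-table (code₃ (n * n) n d (toℕ u) (toℕ v))
  within⁺ u v = ball-read⁺ d u v ≤-refl

  private
    rowD⇒ : ∀ x y → x < N′ → Rd l D (ix n x (toℕ y)) → ∃ λ w → x ≡ toℕ w × Within w y
    rowD⇒ x y x< r = let w , e , sem = rel⁻ M 7F 0F (withinF 1F) σ (ball-table ∷ []) x (toℕ y) (toℕ<n y) (ix< x< (toℕ<n y)) r in
      w , e , within⁻ w y sem

    ⇒rowD : ∀ w y → Within w y → Rd l D (ix n (toℕ w) (toℕ y))
    ⇒rowD w y B = rel⁺ M 7F 0F (withinF 1F) σ (ball-table ∷ []) w y (ix< (m<n⇒m<1+n (toℕ<n w)) (toℕ<n y)) (within⁺ w y B)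

    rowD⁻ : ∀ w y → Rd l D (ix n (toℕ w) (toℕ y)) → Within w y
    rowD⁻ w y r = let w′ , e , B = rowD⇒ (toℕ w) y (m<n⇒m<1+n (toℕ<n w)) r in subst (λ z → Within z y) (toℕ-injective (sym e)) B

  module WithLink (χ : Fm 11 3) (Link : Vertex G → Vertex G → Set) (link-sym : ∀ u v → Link u v → Link v u)
    (link⁻ : ∀ u v A D → Sem M χ (toℕ v ∷ toℕ u ∷ ix n (toℕ u) (toℕ v) ∷ σ) (A ∷ D ∷ ball-table ∷ []) → Link u v)
    (link⁺ : ∀ u v A D → Link u v → Sem M χ (toℕ v ∷ toℕ u ∷ ix n (toℕ u) (toℕ v) ∷ σ) (A ∷ D ∷ ball-table ∷ []))
    (within-path : ∀ u v → Ball d u v → Trees.Path Link link-sym ⊤ˢ u v) where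

    open Trees Link link-sym public

    private
      H W : ℕ
      H = upto M 0F (relF 7F χ) σ (D ∷ ball-table ∷ []) l
      W = upto M 7F (con 0 ≐ con 0) σ (H ∷ D ∷ ball-table ∷ []) n

      open Core M n N′ k l l D W 0 0

      C : ℕ
      C = core

      linkH⁻ : ∀ u v → Rd l H (ix n (toℕ u) (toℕ v)) → Link u v
      linkH⁻ u v r = let w , e , sem = rel⁻ M 7F 0F χ σ (D ∷ ball-table ∷ []) (toℕ u) (toℕ v) (toℕ<n v) (ix< (m<n⇒m<1+n (toℕ<n u)) (toℕ<n v)) r in
        link⁻ u v _ D (subst (λ z → Sem M χ (toℕ v ∷ z ∷ ix n (toℕ u) (toℕ v) ∷ σ) _) (sym e) sem)

      linkH⁺ : ∀ u v → Link u v → Rd l H (ix n (toℕ u) (toℕ v))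
      linkH⁺ u v h = rel⁺ M 7F 0F χ σ (D ∷ ball-table ∷ []) u v (ix< (m<n⇒m<1+n (toℕ<n u)) (toℕ<n v)) (link⁺ u v _ D h)

      open TreeTable M n k l C H D {Link} {Within} link-sym linkH⁻ linkH⁺ rowD⁻ ⇒rowD using (Spans; span-decides)

    Solution : Subset n → Set
    Solution X = ∣ X ∣ ≡ k × (∀ w → ∃ λ u → u ∈ X × Ball d u w) × Linked X

    private
      all : ∀ (u : Vertex G) → Rd n W (toℕ u)
      all u = table⁺ M 7F (con 0 ≐ con 0) σ (H ∷ D ∷ ball-table ∷ []) (toℕ u) (toℕ<n u) refl

      spans⇒ : Spans → ∃ Solution
      spans⇒ (inj₁ (k≡0 , n≡0)) = ⊥ˢ , trans (∣⊥∣≡0 n) (sym k≡0) ,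
        (λ w → contradiction (subst (toℕ w <_) n≡0 (toℕ<n w)) λ ()) , λ u v u∈ _ → contradiction u∈ ∉⊥
      spans⇒ (inj₂ (1≤k , k≤n , v , t , s≤ , cover)) = finish (m≤n⇒∃[o]m+o≡n (≤-trans (card-nodes t) s≤))
        where
        dominated : ∀ w → ∃ λ u → u ∈ nodes t × Ball d u w
        dominated w = let i , r = covered w ; u , e , B = rowD⇒ (toℕ (y i)) w (toℕ<n (y i)) r in u , padded-∈ ≤-refl (nodes t) i e , B
          where
          y : Fin k → Fin N′
          y = padded ≤-refl (nodes t)
          slot : ∀ (u : Vertex G) → (∃ λ x → x ∈ nodes t × Within x u) → ∃ λ i → row (toℕ (y i)) (toℕ u)
          slot u (x , x∈ , B) = let i , e = padded-onto {k = k} {N′} ≤-refl (nodes t) (≤-trans (card-nodes t) s≤) x∈ in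
            i , subst (λ z → row z (toℕ u)) (sym e) (⇒rowD x u B)
          covered : ∀ (w : Vertex G) → ∃ λ i → row (toℕ (y i)) (toℕ w)
          covered w = core-covers w (all w) y (λ u cu _ → slot u (cover u cu))
        -- Every vertex is dominated by a node of the tree, and `within-path` leads from that node
        -- to it. So all vertices are reachable from the root, and the tree grows to exactly k
        -- nodes.
        reach : ∀ x → x ∈ ⊤ˢ → Path ⊤ˢ v x
        reach x _ = let u , u∈ , B = dominated x in path-trans (path-mono (λ _ → ∈⊤) (root-path t u∈)) (within-path u x B)
        finish : (∃ λ fuel → ∣ nodes t ∣ + fuel ≡ k) → ∃ Solution
        finish (fuel , eq) = let t′ , t⊆t′ , _ , card , _ = grow fuel t reach (λ _ → ∈⊤) (≤-trans k≤n (≤-reflexive (sym (∣⊤∣≡n n)))) eq in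
          nodes t′ , card , (λ w → let u , u∈ , B = dominated w in u , t⊆t′ u∈ , B) , nodes-linked t′

      ⇒spans : ∃ Solution → Spans
      ⇒spans (X , card , dominated , linked) = decide (k ≟ 0)
        where
        decide : Dec (k ≡ 0) → Spans
        decide (yes k≡0) = inj₁ (k≡0 , n≤0⇒n≡0 (≮⇒≥ λ 0<n → let _ , u∈ , _ = dominated (fromℕ< 0<n) in
              contradiction (subst (0 <_) (trans card k≡0) (nonempty-card X u∈)) λ ()))
        decide (no k≢0) = build (spanning {X} {r} linked (enum-∈ X _))
          where
          1≤k : 1 ≤ k
          1≤k = n≢0⇒n>0 k≢0
          r = enum X (fromℕ< (subst (0 <_) (sym card) 1≤k))
          build : (∃ λ (t : Tree r) → X ⊆ nodes t × size t ≤ ∣ X ∣) → Spans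
          build (t , X⊆t , s≤) = inj₂ (1≤k , subst (_≤ n) card (∣p∣≤n X) , r , t , subst (size t ≤_) card s≤ ,
            λ u _ → let x , x∈ , B = dominated u in x , X⊆t x∈ , B)

      rows : Rows G (Graph.adj G) (λ _ _ e → e) (p + 2) N′ row
      rows = ball-rows G (Graph.adj G) (λ _ _ e → e) Within {row = row} N′ rowD⇒ (λ w y _ → ⇒rowD w y) λ w → inj₂ (d , d≤ , (λ _ B → B) , (λ _ B → B))

      small : ∀ v → ∣ earlier v ∣ ≤ core₁ p
      small = first-small N′ l D W rows

      t₀≤ : rank n n C n * 1 ≤ τ
      t₀≤ = ≤-trans (≤-reflexive (*-identityʳ _)) (≤-trans (≤-trans (≤-reflexive (rank-card n n C n)) (small n)) (core₁≤total p))

      1+d≤τ : suc d ≤ τ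
      1+d≤τ = ≤-trans (s≤s d≤) (≤-trans (≤-reflexive (+-comm 1 (p + 2))) (≤-trans (+-monoʳ-≤ (p + 2) (s≤s z≤n)) (p≤total p)))

      nn≤ : n * n ≤ Q
      nn≤ = ≤-trans (≤-reflexive (sym (+-identityʳ (n * n)))) (size≤ (τ≤ (≤-trans (s≤s z≤n) 4≤τ)) (m≤m⊔n n 1) (m≤m⊔n n 1))

      q≤ : suc k * p2 (rank n n C n * 1) ≤ Q
      q≤ = const≤ (*-mono-≤ (1+k≤τ k≤p) (p2-mono (≤-trans t₀≤ (≤-trans (≤-reflexive (sym (*-identityʳ τ))) (*-monoʳ-≤ τ (1≤total p))))))

    connected-decides : Static (fm χ) → Decides Q M (connectedTail a χ) (d ∷ k ∷ n ∷ []) [] (∃ Solution)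
    connected-decides sχ = decides-map spans⇒ ⇒spans
      (decides-lets {x = suc d} (static-safe _ _ _ _) refl (const≤ (τ≤ 1+d≤τ)) (decides-lets {x = n * n} (static-safe _ _ _ _) refl nn≤
      (decides-lets {x = suc d * (n * n)} (static-safe _ _ _ _) refl (size≤ (τ≤ 1+d≤τ) (m≤m⊔n n 1) (m≤m⊔n n 1))
      (decides-letv {x = ball-table} (static-safe _ _ _ _) refl
      (decides-lets {x = N′} (static-safe _ _ _ _) refl (N≤Q (s≤s (m≤m+n n n))) (decides-lets {x = l} (static-safe _ _ _ _) refl (Nn≤Q (s≤s (m≤m+n n n)))
      (decides-letv {x = D} (static-safe _ _ _ _) refl
      (decides-letv {x = H} (static-safe (tableᵉ 0F (relF 7F χ)) _ _ (table-static {m = Fin 8 ∋ 0F} {φ = relF 7F χ} (relF-static {n = Fin 8 ∋ 7F} {ψ = χ} sχ))) refl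
      (decides-letv {x = W} (static-safe _ _ _ _) refl (decides-letv {x = 0} con refl
      (decides-letv {x = C} (proc (core-safe (λ v _ → core₁-power (small v)))) refl
      (decides-proc (span-decides (const≤ (τ≤ (≤-trans (s≤s z≤n) 4≤τ))) (const≤ (τ≤ (1+k≤τ k≤p)))
        (power≤Q {rank n n C n} {1} (≤-trans (≤-reflexive (sym (*-identityʳ (rank n n C n)))) t₀≤) (≤-trans (s≤s z≤n) 4≤τ)) q≤ (table≤Q (1+k≤τ k≤p) t₀≤))))))))))))))

edgeF : ℕ → Fm 11 3
edgeF a = adjᶠ a (# 10) (sz 1F) (sz 0F)

module ConnectedSetting {ℓ} (C : GraphClass ℓ) (s : ℕ → ℕ) (b : ℕ → ℕ → ℕ) (uqw : UniformlyQuasiWide C s b)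
  (s-computable : Computable s) (b-computable : Computable₂ b) where

  open Setting C s b uqw s-computable b-computable public

  module WithinDistance (G : Graph) (p k : ℕ) (k≤p : k ≤ p) (CG : C G) (M : ℕ → ℕ) (a d : ℕ) (d≤ : d ≤ p + 2)
    (reads : ∀ u v → M (a + ix (order G) (toℕ u) (toℕ v)) ≡ bit (Graph.adj G u v)) where

    open ConnectedMain s b s-computable b-computable G p k k≤p M (wide CG (p + 2)) a d d≤ reads public
    open Balls (Graph.adj G)
    open Walks G

    dominating⇒ : ∀ {X} → Dominating G d X → ∀ w → ∃ λ u → u ∈ X × Ball d u w
    dominating⇒ dom w = let u , u∈ , l , l≤ , p = dom w ∈⊤ in u , u∈ , ball-sym d (walk⇒ball d l≤ p)

    ⇒dominating : ∀ {X} → (∀ w → ∃ λ u → u ∈ X × Ball d u w) → Dominating G d X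
    ⇒dominating dom w _ = let u , u∈ , B = dom w in u , u∈ , ball⇒walk d (ball-sym d B)

    module ByEdges where

      open Trees (Edge G) (edge-sym G) using (Path; stop; step; path-trans)

      ball-path : ∀ i u v → Ball i u v → Path ⊤ˢ u v
      ball-path zero    u .u refl               = stop ∈⊤
      ball-path (suc i) u v (inj₁ B)            = ball-path i u v B
      ball-path (suc i) u v (inj₂ (w , B , e)) = path-trans (ball-path i u w B) (step ∈⊤ e (stop ∈⊤))

      open WithLink (edgeF a) (Edge G) (edge-sym G) (λ u v _ _ → bit⁻ (reads u v)) (λ u v _ _ → bit⁺ (reads u v)) (ball-path d)

      open Graphs (Edge G) (λ _ _ → inj₂) (λ _ _ e → e)

      edges-decide : Decides Q M (connectedTail a (edgeF a)) (d ∷ k ∷ order G ∷ []) []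
        (∃ λ X → ∣ X ∣ ≡ k × Dominating G d X × Connected (induced ⟦ G ⟧ (_∈ X)))
      edges-decide = decides-map
        (λ (X , card , dom , linked) → X , card , ⇒dominating dom , linked⇒connected linked)
        (λ (X , card , dom , connected) → X , card , dominating⇒ dom , connected⇒linked connected) (connected-decides _)

    module ByBalls where

      open Trees (Ball d) (λ u v → ball-sym d) using (Path; stop; step)

      open WithLink (withinF 2F) (Ball d) (λ u v → ball-sym d) (λ u v _ _ → within⁻ u v) (λ u v _ _ → within⁺ u v) (λ u v B → step ∈⊤ B (stop ∈⊤))

      power-edge : ∀ u v → Ball d u v → u ≡ v ⊎ (u ≢ v × Dist≤ ⟦ G ⟧ d u v)
      power-edge u v B with u ≟ꟳ v
      ... | yes eq = inj₁ eq
      ... | no ne  = inj₂ (ne , ball⇒walk d B)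

      open Graphs (λ u v → u ≢ v × Dist≤ ⟦ G ⟧ d u v) power-edge (λ u v (_ , l , l≤ , p) → walk⇒ball d l≤ p)

      balls-decide : Decides Q M (connectedTail a (withinF 2F)) (d ∷ k ∷ order G ∷ []) []
        (∃ λ X → ∣ X ∣ ≡ k × Dominating G d X × Connected (induced (power ⟦ G ⟧ d) (_∈ X)))
      balls-decide = decides-map
        (λ (X , card , dom , linked) → X , card , ⇒dominating dom , linked⇒connected linked)
        (λ (X , card , dom , connected) → X , card , dominating⇒ dom , connected⇒linked connected) (connected-decides _)

  -- The case d = 1, with the distance supplied as a constant so that the parameter is k alone.
  connected : FPT C ConnectedDominatingSet
  connected = fpt ConnectedDominatingSet (start (lets (con 1) (connectedTail 2 (edgeF 2)))) λ (G , k) CG →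
    let open WithinDistance G k k ≤-refl CG (cell (order G ∷ k ∷ matrix (Graph.adj G))) 2 1 (≤-trans (s≤s z≤n) (m≤n+m 2 k)) (cell-matrix (Graph.adj G)) in
    start-decides refl refl n≤Q (const≤ (τ≤ (k≤τ ≤-refl))) (decides-lets con refl (const≤ (τ≤ (≤-trans (s≤s z≤n) 4≤τ))) ByEdges.edges-decide)

  module Radius (G : Graph) (k d : ℕ) (CG : C G) where

    open WithinDistance G (k + d) k (m≤m+n k d) CG (cell (order G ∷ k ∷ d ∷ matrix (Graph.adj G))) 3 d
      (≤-trans (m≤n+m d k) (m≤m+n (k + d) 2)) (cell-matrix (Graph.adj G)) public

    with-radius : ∀ {e P} → Decides Q (cell (order G ∷ k ∷ d ∷ matrix (Graph.adj G))) e (d ∷ k ∷ order G ∷ []) [] P →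
                  Decides Q (cell (order G ∷ k ∷ d ∷ matrix (Graph.adj G))) (start (lets (inp (con 2)) e)) [] [] P
    with-radius D = start-decides refl refl n≤Q (const≤ (τ≤ (k≤τ (m≤m+n k d)))) (decides-lets (inp con) refl (const≤ (τ≤ (k≤τ (m≤n+m d k)))) D)

  connectedWithin : FPT C ConnectedDDominatingSet
  connectedWithin = fpt ConnectedDDominatingSet (start (lets (inp (con 2)) (connectedTail 3 (edgeF 3)))) λ (G , k , d) CG →
    let open Radius G k d CG in with-radius ByEdges.edges-decide

  distanceConnectedWithin : FPT C DConnectedDDominatingSet
  distanceConnectedWithin = fpt DConnectedDDominatingSet (start (lets (inp (con 2)) (connectedTail 3 (withinF 2F)))) λ (G , k , d) CG →
    let open Radius G k d CG in with-radius ByBalls.balls-decide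

theorem5p3 : ∀ {ℓ} (C : GraphClass ℓ) (s : ℕ → ℕ) (b : ℕ → ℕ → ℕ) →
    NowhereDense C → UniformlyQuasiWide C s b → Computable s → Computable₂ b →
    FPT C ConnectedDominatingSet ×
    FPT C ConnectedDDominatingSet ×
    FPT C DConnectedDDominatingSet ×
    FPT C AnnotatedDominatingSet ×
    FPT C EfficientDominatingSet ×
    FPT C MaximumMinimalDominatingSet ×
    FPT C RomanDomination ×
    FPT C RedBlueDominatingSet ×
    FPT C IndependentSet ×
    FPT C IndependentDominatingSet ×
    FPT C PerfectCode ×
    FPT C DigraphKernel
theorem5p3 C s b _ uqw s-computable b-computable =
    connected , connectedWithin , distanceConnectedWithin , annotated , efficientDominatingSet , maximumMinimal , roman , redBlue ,
    independentSet , independentDominatingSet , perfectCode , digraphKernel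
  where
  open ConnectedSetting C s b uqw s-computable b-computable using (connected; connectedWithin; distanceConnectedWithin; annotated; redBlue)
  open RomanSetting C s b uqw s-computable b-computable using (roman)
  open PickSetting C s b uqw s-computable b-computable using (efficientDominatingSet; independentSet; independentDominatingSet; perfectCode; digraphKernel)
  open MinimalSetting C s b uqw s-computable b-computable using (maximumMinimal)
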